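{- For any $0\le t\le 1$, there exists an algorithm for the restricted target-(min,max)-product problem on $n\times n$ matrices whose time cost is $\tilde O\left(n^{2+t}+n^{\omega(2-t,1,1)}\right)$.
   Context: The restricted target-(min,max)-product problem: the input is a matrix $A\in\mathbb{R}^{n\times n}$, a matrix $B\in\{ -\infty,\infty\}^{n\times n}$, and a target matrix $T\in\mathbb{R}^{n\times n}$ (with entries $a_{ij},b_{ij},t_{ij}$), where for every $i,j\in[n]=\{1,\dots,n\}$, $t_{ij}\le\min_{k=1}^{n}\{\max(a_{ik},b_{kj})\}$. The output is the matrix $C\in\{0,1\}^{n\times n}$ such that for every $i,j\in[n]$, $c_{ij}=1$ if and only if $t_{ij}=\min_{k=1}^{n}\{\max(a_{ik},b_{kj})\}$. $\omega(a,b,c)$ denotes the exponent of $n$ in the running time of the fastest algorithm for multiplying an $n^{a}\times n^{b}$ matrix by an $n^{b}\times n^{c}$ matrix, so that such a product can be computed in $O(n^{\omega(a,b,c)})$ time. $\tilde O$ suppresses poly-logarithmic factors. -}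

module Defs where

open import Level using (0ℓ)
open import Algebra.Bundles using (CommutativeRing)
open import Algebra.Definitions.RawMonoid using (sum)
import Algebra.Construct.NaturalChoice.Max as Max
import Algebra.Construct.NaturalChoice.Min as Min
import Algebra.Properties.Ring as RingProperties
import Algebra.Properties.Semiring.Exp as Exp
import Algebra.Properties.Semiring.Mult as Mult
open import Data.Bool.Base using (Bool; true; false; not; if_then_else_; _∧_)
open import Data.Empty using (⊥-elim)
open import Data.Fin.Base using (Fin; zero; suc; toℕ)
open import Data.Integer.Base as ℤ using (ℤ; ∣_∣)
import Data.Integer.Properties as ℤ
open import Data.Nat.Base as ℕ using (ℕ; zero; suc)
open import Data.Nat.Logarithm using (⌊log₂_⌋)
import Data.Nat.Properties as ℕ
open import Data.Product.Base using (∃; ∃-syntax; _×_; _,_; proj₁)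
open import Data.Sign.Base using (Sign)
open import Data.Sum.Base using (_⊎_; inj₁; inj₂)
open import Data.Unit.Base using (⊤)
open import Data.Vec.Functional using (foldr)
open import Function.Bundles using (_⇔_)
open import Relation.Binary.Bundles using (TotalOrder)
open import Relation.Binary.Core using (Rel)
open import Relation.Binary.Structures using (IsDecTotalOrder)
import Relation.Binary.Construct.Add.Extrema.Equality as AddExtremaEquality
import Relation.Binary.Construct.Add.Extrema.NonStrict as AddExtrema
import Relation.Binary.Reasoning.Setoid as SetoidReasoning
open import Relation.Binary.PropositionalEquality.Core as ≡ using (_≡_; _≢_)
open import Relation.Nullary.Construct.Add.Extrema using (_±; ⊥±; ⊤±; [_])
open import Relation.Nullary.Decidable.Core using (does; yes; no)
open import Relation.Nullary.Negation.Core using (¬_)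

------------------------------------------------------------------------
-- Real numbers

-- The classical axioms of ℝ.  Decidability of the order and the
-- Archimedean property follow classically from the other axioms; they are
-- listed because that derivation is not constructive.  The value of 0# ⁻¹
-- is unspecified.
record CompleteOrderedField : Set₁ where
  field
    commutativeRing : CommutativeRing 0ℓ 0ℓ

  open CommutativeRing commutativeRing public renaming (zero to *-zero)

  infix 4 _≤_
  infix 9 _⁻¹

  field
    _≤_             : Rel Carrier 0ℓ
    isDecTotalOrder : IsDecTotalOrder _≈_ _≤_
    +-monoˡ-≤       : ∀ z {x y} → x ≤ y → x + z ≤ y + z
    *-nonneg        : ∀ {x y} → 0# ≤ x → 0# ≤ y → 0# ≤ x * y
    1≉0             : ¬ 1# ≈ 0#
    _⁻¹             : Carrier → Carrier
    ⁻¹-cong         : ∀ {x y} → x ≈ y → x ⁻¹ ≈ y ⁻¹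
    ⁻¹-inverseʳ     : ∀ x → ¬ x ≈ 0# → x * x ⁻¹ ≈ 1#

  open Mult semiring public using () renaming (_×_ to _·_)
  open Exp semiring public using (_^_)

  fromℕ : ℕ → Carrier
  fromℕ n = n · 1#

  field
    archimedean     : ∀ x → ∃[ n ] x ≤ fromℕ n
    complete        : (P : Carrier → Set) → ∃ P → (∃[ u ] (∀ x → P x → x ≤ u)) →
                      ∃[ s ] ((∀ x → P x → x ≤ s) ×
                              (∀ u → (∀ x → P x → x ≤ u) → s ≤ u))

  open IsDecTotalOrder isDecTotalOrder public
    using (_≤?_; isTotalOrder; total; antisym; ≤-resp-≈)
    renaming (refl to ≤-refl; reflexive to ≤-reflexive; trans to ≤-trans)

  totalOrder : TotalOrder 0ℓ 0ℓ 0ℓ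
  totalOrder = record { isTotalOrder = isTotalOrder }

module RealPower (F : CompleteOrderedField) where
  open CompleteOrderedField F
  open RingProperties ring using (-‿distribʳ-*; -‿distribˡ-*; -‿involutive)
  open Exp semiring using (^-congˡ)
  open Mult semiring using (×-homo-+; ×1-homo-*)
  open SetoidReasoning setoid

  ≤-resp₂ : ∀ {x x′ y y′} → x ≈ x′ → y ≈ y′ → x ≤ y → x′ ≤ y′
  ≤-resp₂ p q r = ≤-trans (≤-reflexive (sym p)) (≤-trans r (≤-reflexive q))

  +-monoʳ-≤ : ∀ z {x y} → x ≤ y → z + x ≤ z + y
  +-monoʳ-≤ z r = ≤-resp₂ (+-comm _ z) (+-comm _ z) (+-monoˡ-≤ z r)

  +-mono-≤ : ∀ {x y u v} → x ≤ y → u ≤ v → x + u ≤ y + v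
  +-mono-≤ r s = ≤-trans (+-monoˡ-≤ _ r) (+-monoʳ-≤ _ s)

  x-y+y≈x : ∀ x y → (x - y) + y ≈ x
  x-y+y≈x x y = trans (+-assoc x (- y) y) (trans (+-congˡ (-‿inverseˡ y)) (+-identityʳ x))

  x+y-y≈x : ∀ x y → (x + y) - y ≈ x
  x+y-y≈x x y = trans (+-assoc x y (- y)) (trans (+-congˡ (-‿inverseʳ y)) (+-identityʳ x))

  +-cancelʳ-≤ : ∀ z {x y} → x + z ≤ y + z → x ≤ y
  +-cancelʳ-≤ z r = ≤-resp₂ (x+y-y≈x _ z) (x+y-y≈x _ z) (+-monoˡ-≤ (- z) r)

  x≤y⇒0≤y-x : ∀ {x y} → x ≤ y → 0# ≤ y - x
  x≤y⇒0≤y-x {x} r = ≤-resp₂ (-‿inverseʳ x) refl (+-monoˡ-≤ (- x) r)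

  *-monoʳ-≤ : ∀ {z x y} → 0# ≤ z → x ≤ y → z * x ≤ z * y
  *-monoʳ-≤ {z} {x} {y} 0≤z r =
    ≤-resp₂ (+-identityˡ _) eq (+-monoˡ-≤ (z * x) (*-nonneg 0≤z (x≤y⇒0≤y-x r)))
    where
    eq : z * (y - x) + z * x ≈ z * y
    eq = trans (sym (distribˡ z (y - x) x)) (*-congˡ (x-y+y≈x y x))

  *-monoˡ-≤ : ∀ {z x y} → 0# ≤ z → x ≤ y → x * z ≤ y * z
  *-monoˡ-≤ 0≤z r = ≤-resp₂ (*-comm _ _) (*-comm _ _) (*-monoʳ-≤ 0≤z r)

  0≤1 : 0# ≤ 1#
  0≤1 with total 0# 1#
  ... | inj₁ r = r
  ... | inj₂ r = ≤-resp₂ refl eq (*-nonneg 0≤-1 0≤-1)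
    where
    0≤-1 : 0# ≤ - 1#
    0≤-1 = ≤-resp₂ (-‿inverseʳ 1#) (+-identityˡ (- 1#)) (+-monoˡ-≤ (- 1#) r)
    eq : - 1# * - 1# ≈ 1#
    eq = begin
      - 1# * - 1#     ≈⟨ -‿distribˡ-* 1# (- 1#) ⟨
      - (1# * - 1#)   ≈⟨ -‿cong (*-identityˡ (- 1#)) ⟩
      - - 1#          ≈⟨ -‿involutive 1# ⟩
      1#              ∎

  0≤fromℕ : ∀ n → 0# ≤ fromℕ n
  0≤fromℕ zero    = ≤-refl
  0≤fromℕ (suc n) = ≤-resp₂ (+-identityʳ 0#) refl (+-mono-≤ 0≤1 (0≤fromℕ n))

  fromℕ-mono-≤ : ∀ {m n} → m ℕ.≤ n → fromℕ m ≤ fromℕ n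
  fromℕ-mono-≤ {n = n} ℕ.z≤n = 0≤fromℕ n
  fromℕ-mono-≤ (ℕ.s≤s r)     = +-monoʳ-≤ 1# (fromℕ-mono-≤ r)

  fromℕ-cancel-≤ : ∀ {m n} → fromℕ m ≤ fromℕ n → m ℕ.≤ n
  fromℕ-cancel-≤ {m} {n} r with m ℕ.≤? n
  ... | yes m≤n = m≤n
  ... | no  m≰n = ⊥-elim (1≉0 (antisym 1≤0 0≤1))
    where
    1≤0 : 1# ≤ 0#
    1≤0 = +-cancelʳ-≤ (fromℕ n)
      (≤-trans (fromℕ-mono-≤ (ℕ.≰⇒> m≰n)) (≤-resp₂ refl (sym (+-identityˡ _)) r))

  fromℕ-^ : ∀ m k → fromℕ (m ℕ.^ k) ≈ fromℕ m ^ k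
  fromℕ-^ m zero    = +-identityʳ 1#
  fromℕ-^ m (suc k) = trans (×1-homo-* m (m ℕ.^ k)) (*-congˡ (fromℕ-^ m k))

  1≤^ : ∀ {x} → 1# ≤ x → ∀ k → 1# ≤ x ^ k
  1≤^ 1≤x zero    = ≤-refl
  1≤^ 1≤x (suc k) = ≤-trans 1≤x (≤-resp₂ (*-identityʳ _) refl
    (*-monoʳ-≤ (≤-trans 0≤1 1≤x) (1≤^ 1≤x k)))

  ^-growth : ∀ {x y} → 1# ≤ x → x ≤ y → ∀ k → (y - x) + x ^ suc k ≤ y ^ suc k
  ^-growth {x} {y} 1≤x x≤y zero = ≤-reflexive
    (trans (+-congˡ (*-identityʳ x)) (trans (x-y+y≈x y x) (sym (*-identityʳ y))))
  ^-growth {x} {y} 1≤x x≤y (suc k) =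
    ≤-trans (+-mono-≤ p q) (≤-resp₂ (distribˡ y (y - x) (x ^ suc k)) refl
      (*-monoʳ-≤ 0≤y (^-growth 1≤x x≤y k)))
    where
    1≤y = ≤-trans 1≤x x≤y
    0≤y = ≤-trans 0≤1 1≤y
    p : y - x ≤ y * (y - x)
    p = ≤-resp₂ (*-identityˡ _) refl (*-monoˡ-≤ (x≤y⇒0≤y-x x≤y) 1≤y)
    q : x * x ^ suc k ≤ y * x ^ suc k
    q = *-monoˡ-≤ (≤-trans 0≤1 (1≤^ 1≤x (suc k))) x≤y

  ^-cancel-≤ : ∀ {x y} → 1# ≤ x → ∀ k → y ^ suc k ≤ x ^ suc k → y ≤ x
  ^-cancel-≤ {x} {y} 1≤x k r with total y x
  ... | inj₁ y≤x = y≤x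
  ... | inj₂ x≤y = ≤-resp₂ (x-y+y≈x y x) (+-identityˡ x) (+-monoˡ-≤ x
    (+-cancelʳ-≤ (x ^ suc k) (≤-trans (^-growth 1≤x x≤y k)
      (≤-resp₂ refl (sym (+-identityˡ _)) r))))

  -- For α ≥ 0 and n ≥ 1, the non-negative y with y ≤ n ^ (p / q) for some
  -- p / q ≤ α (so q = suc k).
  RationalPower : ℕ → Carrier → Carrier → Set
  RationalPower n α y = y ≈ 0# ⊎
    (0# ≤ y × ∃[ p ] ∃[ k ] (fromℕ p ≤ fromℕ (suc k) * α × y ^ suc k ≤ fromℕ (n ℕ.^ p)))

  RationalPower-bounded : ∀ n α → ∃[ u ] (∀ y → RationalPower n α y → y ≤ u)
  RationalPower-bounded n α with archimedean α
  ... | N , α≤N = B , bound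
    where
    b = suc n ℕ.^ N
    B = fromℕ b

    1≤B : 1# ≤ B
    1≤B = ≤-resp₂ (+-identityʳ 1#) refl (fromℕ-mono-≤ (ℕ.m^n>0 (suc n) N))

    bound : ∀ y → RationalPower n α y → y ≤ B
    bound y (inj₁ y≈0) = ≤-resp₂ (sym y≈0) refl (0≤fromℕ b)
    bound y (inj₂ (_ , p , k , p≤qα , y^q≤n^p)) =
      ^-cancel-≤ 1≤B k (≤-trans y^q≤n^p (≤-resp₂ refl (fromℕ-^ b (suc k)) (fromℕ-mono-≤ n^p≤b^q)))
      where
      p≤Nq : p ℕ.≤ N ℕ.* suc k
      p≤Nq = ≡.subst (p ℕ.≤_) (ℕ.*-comm (suc k) N) (fromℕ-cancel-≤
        (≤-trans p≤qα (≤-resp₂ refl (sym (×1-homo-* (suc k) N))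
          (*-monoʳ-≤ (0≤fromℕ (suc k)) α≤N))))
      n^p≤b^q : n ℕ.^ p ℕ.≤ b ℕ.^ suc k
      n^p≤b^q = ℕ.≤-trans (ℕ.^-monoˡ-≤ p (ℕ.n≤1+n n))
        (ℕ.≤-trans (ℕ.^-monoʳ-≤ (suc n) p≤Nq)
          (ℕ.≤-reflexive (≡.sym (ℕ.^-*-assoc (suc n) N (suc k)))))

  infixr 8 _^ᴿ_

  -- n to the real power α, meaningful for n ≥ 1 and α ≥ 0; it is 0# for
  -- α < 0, where neither n ^ α nor 0# can bound a running time.
  _^ᴿ_ : ℕ → Carrier → Carrier
  n ^ᴿ α = proj₁ (complete (RationalPower n α) (0# , inj₁ refl) (RationalPower-bounded n α))

------------------------------------------------------------------------
-- The model of computation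

-- A random access machine with words of O(log n) bits and with real cells
-- that can only be copied and compared, among themselves, with finitely many
-- real constants and with quotients of words.  There is deliberately no real
-- arithmetic: at unit cost it would allow unboundedly much data to be packed
-- into one cell.  The constants give the program access to the real
-- parameters of an algorithm, to the precision of a word.
module Machine (F : CompleteOrderedField) where
  open CompleteOrderedField F

  Array : Set → Set
  Array X = ℕ → ℕ → X

  -- Memory consists of two-dimensional arrays of either kind, named by
  -- natural numbers; a scalar variable is a fixed cell of an array.
  record State : Set where
    constructor mkState
    field
      words : ℕ → Array ℕ
      reals : ℕ → Array Carrier

  open State public

  infixl 7 _⊗_ _⊘_
  infixl 6 _⊕_ _⊖_

  data WordExp : Set where
    lit             : ℕ → WordExp
    word            : ℕ → WordExp → WordExp → WordExp
    _⊕_ _⊖_ _⊗_ _⊘_ : WordExp → WordExp → WordExp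

  data RealExp : Set where
    const : Carrier → RealExp
    real  : ℕ → WordExp → WordExp → RealExp
    ratio : WordExp → WordExp → RealExp

  infix 4 _≤ʷ_ _≤ʳ_

  data Test : Set where
    _≤ʷ_   : WordExp → WordExp → Test
    _≤ʳ_   : RealExp → RealExp → Test
    negate : Test → Test

  infixr 3 _⨾_

  data Program : Set where
    skip       : Program
    setWord    : ℕ → WordExp → WordExp → WordExp → Program
    setReal    : ℕ → WordExp → WordExp → RealExp → Program
    _⨾_        : Program → Program → Program
    ifThenElse : Test → Program → Program → Program
    while      : Test → Program → Program

  infixl 7 _div_

  _div_ : ℕ → ℕ → ℕ
  m div zero  = 0
  m div suc d = m ℕ./ suc d

  evalWord : State → WordExp → ℕ
  evalWord s (lit c)      = c
  evalWord s (word a i j) = words s a (evalWord s i) (evalWord s j)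
  evalWord s (e ⊕ f)      = evalWord s e ℕ.+ evalWord s f
  evalWord s (e ⊖ f)      = evalWord s e ℕ.∸ evalWord s f
  evalWord s (e ⊗ f)      = evalWord s e ℕ.* evalWord s f
  evalWord s (e ⊘ f)      = evalWord s e div evalWord s f

  evalReal : State → RealExp → Carrier
  evalReal s (const x)    = x
  evalReal s (real a i j) = reals s a (evalWord s i) (evalWord s j)
  evalReal s (ratio e f)  = fromℕ (evalWord s e) * fromℕ (evalWord s f) ⁻¹

  evalTest : State → Test → Bool
  evalTest s (e ≤ʷ f)   = does (evalWord s e ℕ.≤? evalWord s f)
  evalTest s (x ≤ʳ y)   = does (evalReal s x ≤? evalReal s y)
  evalTest s (negate b) = not (evalTest s b)

  -- Evaluation succeeds on words of value at most M: no overflow and no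
  -- division by zero.
  ValidWord : ℕ → State → WordExp → Set
  ValidWord M s (lit c)      = c ℕ.≤ M
  ValidWord M s (word a i j) = ValidWord M s i × ValidWord M s j × evalWord s (word a i j) ℕ.≤ M
  ValidWord M s (e ⊕ f)      = ValidWord M s e × ValidWord M s f × evalWord s (e ⊕ f) ℕ.≤ M
  ValidWord M s (e ⊖ f)      = ValidWord M s e × ValidWord M s f
  ValidWord M s (e ⊗ f)      = ValidWord M s e × ValidWord M s f × evalWord s (e ⊗ f) ℕ.≤ M
  ValidWord M s (e ⊘ f)      = ValidWord M s e × ValidWord M s f × evalWord s f ≢ 0

  ValidReal : ℕ → State → RealExp → Set
  ValidReal M s (const x)    = ⊤
  ValidReal M s (real a i j) = ValidWord M s i × ValidWord M s j
  ValidReal M s (ratio e f)  = ValidWord M s e × ValidWord M s f × evalWord s f ≢ 0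

  ValidTest : ℕ → State → Test → Set
  ValidTest M s (e ≤ʷ f)   = ValidWord M s e × ValidWord M s f
  ValidTest M s (x ≤ʳ y)   = ValidReal M s x × ValidReal M s y
  ValidTest M s (negate b) = ValidTest M s b

  update : {X : Set} → (ℕ → Array X) → ℕ → ℕ → ℕ → X → ℕ → Array X
  update m a i j x a′ i′ j′ =
    if does (a ℕ.≟ a′) ∧ does (i ℕ.≟ i′) ∧ does (j ℕ.≟ j′) then x else m a′ i′ j′

  infix 4 _⊢_,_⇓_⟨_⟩

  -- M ⊢ P , s ⇓ s′ ⟨ τ ⟩: with words of value at most M, program P started in
  -- s halts in s′ after τ steps.  Each assignment and each test is one step;
  -- the size of an expression is a constant of the program.  A program that
  -- evaluates an invalid expression is stuck.
  data _⊢_,_⇓_⟨_⟩ (M : ℕ) : Program → State → State → ℕ → Set where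
    skip : ∀ {s} → M ⊢ skip , s ⇓ s ⟨ 1 ⟩
    setWord : ∀ {s a i j e} →
      ValidWord M s i → ValidWord M s j → ValidWord M s e →
      M ⊢ setWord a i j e , s ⇓
        mkState (update (words s) a (evalWord s i) (evalWord s j) (evalWord s e)) (reals s) ⟨ 1 ⟩
    setReal : ∀ {s a i j x} →
      ValidWord M s i → ValidWord M s j → ValidReal M s x →
      M ⊢ setReal a i j x , s ⇓
        mkState (words s) (update (reals s) a (evalWord s i) (evalWord s j) (evalReal s x)) ⟨ 1 ⟩
    seq : ∀ {P Q s s′ s″ τ τ′} →
      M ⊢ P , s ⇓ s′ ⟨ τ ⟩ → M ⊢ Q , s′ ⇓ s″ ⟨ τ′ ⟩ →
      M ⊢ P ⨾ Q , s ⇓ s″ ⟨ τ ℕ.+ τ′ ⟩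
    ifTrue : ∀ {b P Q s s′ τ} →
      ValidTest M s b → evalTest s b ≡ true → M ⊢ P , s ⇓ s′ ⟨ τ ⟩ →
      M ⊢ ifThenElse b P Q , s ⇓ s′ ⟨ suc τ ⟩
    ifFalse : ∀ {b P Q s s′ τ} →
      ValidTest M s b → evalTest s b ≡ false → M ⊢ Q , s ⇓ s′ ⟨ τ ⟩ →
      M ⊢ ifThenElse b P Q , s ⇓ s′ ⟨ suc τ ⟩
    whileTrue : ∀ {b P s s′ s″ τ τ′} →
      ValidTest M s b → evalTest s b ≡ true →
      M ⊢ P , s ⇓ s′ ⟨ τ ⟩ → M ⊢ while b P , s′ ⇓ s″ ⟨ τ′ ⟩ →
      M ⊢ while b P , s ⇓ s″ ⟨ suc (τ ℕ.+ τ′) ⟩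
    whileFalse : ∀ {b P s} →
      ValidTest M s b → evalTest s b ≡ false →
      M ⊢ while b P , s ⇓ s ⟨ 1 ⟩

  Matrix : Set → ℕ → ℕ → Set
  Matrix X m n = Fin m → Fin n → X

  HoldsWords : ∀ {m n} → Array ℕ → Matrix ℕ m n → Set
  HoldsWords a X = ∀ i j → a (toℕ i) (toℕ j) ≡ X i j

  HoldsReals : ∀ {m n} → Array Carrier → Matrix Carrier m n → Set
  HoldsReals a X = ∀ i j → a (toℕ i) (toℕ j) ≈ X i j

  signBit : Sign → ℕ
  signBit Sign.+ = 0
  signBit Sign.- = 1

  -- Integers are stored as magnitude and sign.
  HoldsIntegers : ∀ {m n} → Array ℕ → Array ℕ → Matrix ℤ m n → Set
  HoldsIntegers a b X = HoldsWords a (λ i j → ∣ X i j ∣) ×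
                  HoldsWords b (λ i j → signBit (ℤ.sign (X i j)))

------------------------------------------------------------------------
-- The exponent of rectangular matrix multiplication

module MatrixMultiplication (F : CompleteOrderedField) where
  open CompleteOrderedField F
  open RealPower F
  open Machine F

  _⊠_ : ∀ {p q r} → Matrix ℤ p q → Matrix ℤ q r → Matrix ℤ p r
  (X ⊠ Y) i j = sum ℤ.+-0-rawMonoid (λ k → X i k ℤ.* Y k j)

  record MultiplicationInput {p q r} (X : Matrix ℤ p q) (Y : Matrix ℤ q r) (s : State) : Set where
    field
      rows   : words s 0 0 0 ≡ p
      inner  : words s 0 0 1 ≡ q
      cols   : words s 0 0 2 ≡ r
      left   : HoldsIntegers (words s 1) (words s 2) X
      right  : HoldsIntegers (words s 3) (words s 4) Y

  MultiplicationOutput : ∀ {p r} → Matrix ℤ p r → State → Set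
  MultiplicationOutput Z s = HoldsIntegers (words s 5) (words s 6) Z

  -- An n^a × n^b matrix and an n^b × n^c matrix can be multiplied in
  -- O(n^w) time, where the entries are integers of O(log n) bits (at most
  -- n ^ κ in absolute value, for any constant κ).  As n ^ a etc. need not be
  -- integers, the dimensions range over those that do not exceed them.
  -- Memory outside the input is uninitialised.
  MultipliesIn : (a b c w : Carrier) → Set
  MultipliesIn a b c w =
    ∀ (κ : ℕ) → ∃[ P ] ∃[ ℓ ] ∃[ K ]
    ∀ (n : ℕ) → 1 ℕ.≤ n →
    ∀ p q r → fromℕ p ≤ n ^ᴿ a → fromℕ q ≤ n ^ᴿ b → fromℕ r ≤ n ^ᴿ c →
    ∀ (X : Matrix ℤ p q) (Y : Matrix ℤ q r) →
    (∀ i j → ∣ X i j ∣ ℕ.≤ n ℕ.^ κ) → (∀ i j → ∣ Y i j ∣ ℕ.≤ n ℕ.^ κ) →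
    ∀ s → MultiplicationInput X Y s →
    ∃[ s′ ] ∃[ τ ] (suc n ℕ.^ ℓ ⊢ P , s ⇓ s′ ⟨ τ ⟩ ×
                    MultiplicationOutput (X ⊠ Y) s′ ×
                    fromℕ τ ≤ fromℕ K * n ^ᴿ w)

  -- w is ω(a,b,c), under the convention that O(n^ω(a,b,c)) time is attained.
  record Isω (a b c w : Carrier) : Set where
    field
      attained : MultipliesIn a b c w
      least    : ∀ w′ → MultipliesIn a b c w′ → w ≤ w′

------------------------------------------------------------------------
-- The restricted target-(min,max)-product problem

module TargetProduct (F : CompleteOrderedField) where
  open CompleteOrderedField F
  open Machine F
  open AddExtremaEquality _≈_ public using (_≈±_)
  open AddExtrema _≤_ public using (_≤±_; ≤±-isTotalOrder)

  extendedOrder : TotalOrder 0ℓ 0ℓ 0ℓ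
  extendedOrder = record { isTotalOrder = ≤±-isTotalOrder isTotalOrder }

  open Max extendedOrder public using (_⊔_)
  open Min extendedOrder public using (_⊓_)

  data Infinity : Set where
    -∞ +∞ : Infinity

  extended : Infinity → Carrier ±
  extended -∞ = ⊥±
  extended +∞ = ⊤±

  -- The minimum over k of max(aᵢₖ, bₖⱼ); for n ≥ 1 the initial value ⊤± of
  -- the fold is immaterial.
  minMax : ∀ {n} → Matrix Carrier n n → Matrix Infinity n n → Matrix (Carrier ±) n n
  minMax A B i j = foldr _⊓_ ⊤± (λ k → [ A i k ] ⊔ extended (B k j))

  Restricted : ∀ {n} → Matrix Carrier n n → Matrix Infinity n n → Matrix Carrier n n → Set
  Restricted A B T = ∀ i j → [ T i j ] ≤± minMax A B i j

  IsTargetProduct : ∀ {n} → Matrix Carrier n n → Matrix Infinity n n → Matrix Carrier n n →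
                    Matrix (Fin 2) n n → Set
  IsTargetProduct A B T C = ∀ i j → C i j ≡ suc zero ⇔ [ T i j ] ≈± minMax A B i j

  infinityBit : Infinity → ℕ
  infinityBit -∞ = 0
  infinityBit +∞ = 1

  record TargetInput {n} (A : Matrix Carrier n n) (B : Matrix Infinity n n)
                     (T : Matrix Carrier n n) (s : State) : Set where
    field
      size   : words s 0 0 0 ≡ n
      left   : HoldsReals (reals s 0) A
      right  : HoldsWords (words s 1) (λ i j → infinityBit (B i j))
      target : HoldsReals (reals s 1) T

  TargetOutput : ∀ {n} → Matrix (Fin 2) n n → State → Set
  TargetOutput C s = HoldsWords (words s 2) (λ i j → toℕ (C i j))

  -- P solves the problem in Õ(f(n)) time.
  SolvesInÕ : Program → (ℕ → Carrier) → Set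
  SolvesInÕ P f =
    ∃[ ℓ ] ∃[ K ] ∃[ d ]
    ∀ (n : ℕ) → 1 ℕ.≤ n →
    ∀ (A : Matrix Carrier n n) (B : Matrix Infinity n n) (T : Matrix Carrier n n) →
    Restricted A B T →
    ∀ s → TargetInput A B T s →
    ∃[ s′ ] ∃[ τ ] (suc n ℕ.^ ℓ ⊢ P , s ⇓ s′ ⟨ τ ⟩ ×
                    (∃[ C ] (IsTargetProduct A B T C × TargetOutput C s′)) ×
                    fromℕ τ ≤ fromℕ (K ℕ.* suc ⌊log₂ n ⌋ ℕ.^ d) * f n)

{-# OPTIONS --safe #-}

-- Let s be a power of two with s = Θ(n^t). Sort every row of A and cut the sorted row into buckets
-- of s elements, G = ⌊n/s⌋ of them full. A single product of an nG × n and an n × n matrix of bits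
-- tells for all i, j and g whether one of the buckets 0, …, g of row i contains an element a i k
-- with b k j = -∞. The minimum of these elements is in the first bucket for which the answer is
-- yes (or in the incomplete last bucket), and scanning this bucket decides whether t i j is
-- attained. The scans take O(n²s) = O(n^(2+t)) time. As s is rounded so that nG ≤ n^(2-t), the
-- product takes O(n^ω) time; so does everything else that is linear in its size n²G, because a
-- program that multiplies has to write all n²G entries of its result.

module Submission where

open import Data.Product.Base using (∃-syntax)
open import Defs

-- The restriction on T is what makes the scan of a bucket decisive. As `t i j` never exceeds the
-- minimum and is finite, it is attained if and only if some k has b k j = -∞ and a i k ≤ t i j. The
-- machine cannot compute n^t: it can only compare t with quotients of words. With Q the bit length
-- of n and m the least number such that t ≤ m/Q, the choice s = 2^m satisfies both requirements.
-- From n < 2^Q follows nG ≤ n^(2-t) without a constant factor, as the hypothesis on the dimensions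
-- of the product demands; from 2^(Q-1) ≤ n follows n²s ≤ 4n^(2+t), where the constant absorbs the
-- rounding. Of the multiplication program only the specification is known. It therefore runs on
-- renamed arrays, and its text alone shows that the arrays of the caller survive. The logarithmic
-- factor of the running time comes from sorting. A tournament is used because inserting or removing
-- an element replays at most Q matches, and a loop that halves an index is easy to express and to
-- bound.

-- A module of its own, because the theorem uses the names of the arithmetic of ℕ for that of ℝ.
module Development where
  open import Algebra.Definitions.RawMonoid using (sum)
  import Algebra.Construct.NaturalChoice.Max as Max
  import Algebra.Construct.NaturalChoice.Min as Min
  import Algebra.Properties.Semiring.Mult as Mult
  open import Data.Bool.Base using (Bool; true; false; not; _∨_; _∧_)
  open import Data.Empty using (⊥; ⊥-elim)
  open import Data.Fin.Base as Fin using (Fin; zero; suc; toℕ; fromℕ<; combine; remQuot)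
  open import Data.Fin.Properties using (toℕ<n; toℕ-fromℕ<; toℕ-injective; fromℕ<-injective;
    pigeonhole; injective⇒≤; combine-remQuot)
  open import Data.Integer.Base as ℤ using (ℤ; ∣_∣)
  import Data.Integer.Properties as ℤ
  open import Data.List.Base using (List; []; _∷_; _++_; length; lookup)
  open import Data.List.Membership.Propositional using (_∈_)
  open import Data.List.Membership.Propositional.Properties using (∈-++⁺ˡ; ∈-++⁺ʳ)
  open import Data.List.Properties using (length-++)
  open import Data.List.Relation.Unary.Any using (here; index)
  open import Data.List.Relation.Unary.Any.Properties using (lookup-index)
  open import Data.Nat.Base hiding (_⊓_; _⊔_)
  open import Data.Nat.DivMod hiding (_div_)
  open import Data.Nat.Induction using (<-wellFounded)
  open import Data.Nat.Logarithm using (⌊log₂_⌋; ⌊log₂⌋-mono-≤; ⌊log₂[2^n]⌋≡n)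
  open import Data.Nat.Properties
  open import Data.Nat.Tactic.RingSolver using (solve-∀)
  open import Data.Product.Base using (∃-syntax; _×_; _,_; proj₁; proj₂)
  open import Data.Sum.Base using (_⊎_; inj₁; inj₂)
  open import Data.Unit.Base using (tt)
  open import Data.Vec.Functional using (foldr)
  open import Function.Bundles using (_⇔_; mk⇔; Equivalence)
  open import Induction.WellFounded using (Acc; acc)
  open import Relation.Binary.Bundles using (TotalOrder)
  open import Relation.Binary.PropositionalEquality hiding ([_])
  open import Relation.Nullary.Construct.Add.Extrema using (_±; ⊥±; ⊤±; [_])
  open import Relation.Nullary.Decidable using (does; yes; no; dec-true; dec-false)
  open import Relation.Nullary.Negation.Core using (¬_)

  ∨-falseˡ : ∀ {b c} → b ∨ c ≡ false → b ≡ false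
  ∨-falseˡ {false} _ = refl

  ∨-falseʳ : ∀ {b c} → b ∨ c ≡ false → c ≡ false
  ∨-falseʳ {false} e = e

  -- What an execution changes in memory, and execution under renamed arrays

  module Execution (F : CompleteOrderedField) where
    open Machine F

    -- A syntactic over-approximation that does not separate word arrays from real arrays of the
    -- same name. Being a Boolean, it computes on concrete programs, so that most frame conditions
    -- are proved by `refl`.
    touches : Program → ℕ → Bool
    touches skip               x = false
    touches (setWord a _ _ _)  x = a ≡ᵇ x
    touches (setReal a _ _ _)  x = a ≡ᵇ x
    touches (P ⨾ Q)            x = touches P x ∨ touches Q x
    touches (ifThenElse _ P Q) x = touches P x ∨ touches Q x
    touches (while _ P)        x = touches P x

    Agree : Program → State → State → Set
    Agree P s s′ = ∀ x → touches P x ≡ false → words s′ x ≡ words s x × reals s′ x ≡ reals s x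

    agree-refl : ∀ {P s} → Agree P s s
    agree-refl _ _ = refl , refl

    agree-trans : ∀ {P Q s s′ s″} → (∀ x → touches Q x ≡ false → touches P x ≡ false) →
                  Agree Q s s′ → Agree P s′ s″ → Agree Q s s″
    agree-trans P⊆Q f g x e =
      trans (proj₁ (g x (P⊆Q x e))) (proj₁ (f x e)) , trans (proj₂ (g x (P⊆Q x e))) (proj₂ (f x e))

    update-other : ∀ {X : Set} (m : ℕ → Array X) a i j v {x} → (a ≡ᵇ x) ≡ false →
                   update m a i j v x ≡ m x
    update-other m a i j v e rewrite e = refl

    update-same : ∀ {X : Set} (m : ℕ → Array X) a i j v → update m a i j v a i j ≡ v
    update-same m a i j v
      rewrite dec-true (a ≟ a) refl | dec-true (i ≟ i) refl | dec-true (j ≟ j) refl = refl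

    update-cell : ∀ {X : Set} (m : ℕ → Array X) a i j v i′ j′ → ¬ (i ≡ i′ × j ≡ j′) →
                  update m a i j v a i′ j′ ≡ m a i′ j′
    update-cell m a i j v i′ j′ ne rewrite dec-true (a ≟ a) refl with i ≟ i′
    ... | no  p rewrite dec-false (i ≟ i′) p = refl
    ... | yes p rewrite dec-true (i ≟ i′) p | dec-false (j ≟ j′) (λ q → ne (p , q)) = refl

    frame : ∀ {M P s s′ τ} → M ⊢ P , s ⇓ s′ ⟨ τ ⟩ → Agree P s s′
    frame skip _ _ = refl , refl
    frame {s = s} (setWord {a = a} {i} {j} {e} _ _ _) x n =
      update-other (words s) a (evalWord s i) (evalWord s j) (evalWord s e) n , refl
    frame {s = s} (setReal {a = a} {i} {j} {e} _ _ _) x n =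
      refl , update-other (reals s) a (evalWord s i) (evalWord s j) (evalReal s e) n
    frame (seq {P} {Q} d e) =
      agree-trans {Q} {P ⨾ Q} (λ x → ∨-falseʳ {touches P x})
        (λ x n → frame d x (∨-falseˡ n)) (frame e)
    frame (ifTrue _ _ d)  x n = frame d x (∨-falseˡ n)
    frame (ifFalse {P = P} _ _ d) x n = frame d x (∨-falseʳ {touches P x} n)
    frame (whileTrue {P = P} _ _ d e) =
      agree-trans {P} {P} (λ _ n → n) (frame d) (frame e)
    frame (whileFalse _ _) _ _ = refl , refl

    -- A list instead of a count, possibly with repetitions, so that it can be concatenated along an
    -- execution. Any set of changed cells injects into its positions, which turns the number of
    -- cells that must change into a lower bound on the time.
    record Written (a : ℕ) (s s′ : State) (τ : ℕ) : Set where
      constructor written-at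
      field
        cells   : List (ℕ × ℕ)
        length≤ : length cells ≤ τ
        covers  : ∀ i j → words s′ a i j ≢ words s a i j → (i , j) ∈ cells

    written-none : ∀ {a s s′ τ} → words s′ a ≡ words s a → Written a s s′ τ
    written-none e = written-at [] z≤n λ i j ne → ⊥-elim (ne (cong (λ f → f i j) e))

    written-suc : ∀ {a s s′ τ} → Written a s s′ τ → Written a s s′ (suc τ)
    written-suc (written-at cs l f) = written-at cs (m≤n⇒m≤1+n l) f

    written-++ : ∀ {a s s′ s″ τ τ′} → Written a s s′ τ → Written a s′ s″ τ′ →
      Written a s s″ (τ + τ′)
    written-++ {a} {s} {s′} {s″} (written-at cs l f) (written-at ds m g) =
      written-at (cs ++ ds) (≤-trans (≤-reflexive (length-++ cs)) (+-mono-≤ l m)) covers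
      where
      covers : ∀ i j → words s″ a i j ≢ words s a i j → (i , j) ∈ cs ++ ds
      covers i j ne with words s′ a i j ≟ words s a i j
      ... | no p  = ∈-++⁺ˡ (f i j p)
      ... | yes p = ∈-++⁺ʳ cs (g i j (λ q → ne (trans q p)))

    written : ∀ {M P s s′ τ} a → M ⊢ P , s ⇓ s′ ⟨ τ ⟩ → Written a s s′ τ
    written a skip = written-none refl
    written {s = s} a (setWord {a = b} {i} {j} {e} _ _ _) with b ≟ a
    ... | no p = written-none
          (update-other (words s) b (evalWord s i) (evalWord s j) (evalWord s e)
            (dec-false (b ≟ a) p))
    ... | yes refl = written-at ((evalWord s i , evalWord s j) ∷ []) ≤-refl covers
      where
      covers : ∀ i′ j′ → update (words s) b (evalWord s i) (evalWord s j) (evalWord s e) b i′ j′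
                 ≢ words s b i′ j′ → (i′ , j′) ∈ (evalWord s i , evalWord s j) ∷ []
      covers i′ j′ ne with evalWord s i ≟ i′ | evalWord s j ≟ j′
      ... | yes refl | yes refl = here refl
      ... | no p | _ =
        ⊥-elim (ne (update-cell (words s) b (evalWord s i) (evalWord s j) (evalWord s e) i′ j′
          (λ q → p (proj₁ q))))
      ... | _ | no p =
        ⊥-elim (ne (update-cell (words s) b (evalWord s i) (evalWord s j) (evalWord s e) i′ j′
          (λ q → p (proj₂ q))))
    written a (setReal _ _ _)     = written-none refl
    written a (seq d e)           = written-++ (written a d) (written a e)
    written a (ifTrue _ _ d)      = written-suc (written a d)
    written a (ifFalse _ _ d)     = written-suc (written a d)
    written a (whileTrue _ _ d e) = written-suc (written-++ (written a d) (written a e))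
    written a (whileFalse _ _)    = written-none refl

    -- The arrays of a given program are renamed from a to offset + a, which leaves the names below
    -- the offset to the program that calls it.
    offset : ℕ
    offset = 20

    shiftWord : WordExp → WordExp
    shiftWord (lit c)      = lit c
    shiftWord (word a i j) = word (offset + a) (shiftWord i) (shiftWord j)
    shiftWord (e ⊕ f)      = shiftWord e ⊕ shiftWord f
    shiftWord (e ⊖ f)      = shiftWord e ⊖ shiftWord f
    shiftWord (e ⊗ f)      = shiftWord e ⊗ shiftWord f
    shiftWord (e ⊘ f)      = shiftWord e ⊘ shiftWord f

    shiftReal : RealExp → RealExp
    shiftReal (const x)    = const x
    shiftReal (real a i j) = real (offset + a) (shiftWord i) (shiftWord j)
    shiftReal (ratio e f)  = ratio (shiftWord e) (shiftWord f)

    shiftTest : Test → Test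
    shiftTest (e ≤ʷ f)   = shiftWord e ≤ʷ shiftWord f
    shiftTest (x ≤ʳ y)   = shiftReal x ≤ʳ shiftReal y
    shiftTest (negate b) = negate (shiftTest b)

    shift : Program → Program
    shift skip               = skip
    shift (setWord a i j e)  = setWord (offset + a) (shiftWord i) (shiftWord j) (shiftWord e)
    shift (setReal a i j x)  = setReal (offset + a) (shiftWord i) (shiftWord j) (shiftReal x)
    shift (P ⨾ Q)            = shift P ⨾ shift Q
    shift (ifThenElse b P Q) = ifThenElse (shiftTest b) (shift P) (shift Q)
    shift (while b P)        = while (shiftTest b) (shift P)

    shift-touches : ∀ P x → x < offset → touches (shift P) x ≡ false
    shift-touches skip               x l = refl
    shift-touches (setWord a _ _ _)  x l =
      dec-false (offset + a ≟ x) (λ e → <⇒≱ l (subst (offset ≤_) e (m≤m+n offset a)))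
    shift-touches (setReal a _ _ _)  x l =
      dec-false (offset + a ≟ x) (λ e → <⇒≱ l (subst (offset ≤_) e (m≤m+n offset a)))
    shift-touches (P ⨾ Q)            x l rewrite shift-touches P x l = shift-touches Q x l
    shift-touches (ifThenElse _ P Q) x l rewrite shift-touches P x l = shift-touches Q x l
    shift-touches (while _ P)        x l = shift-touches P x l

    -- The arrays of `u` from `offset` on are the memory of `s`; those below are unconstrained and
    -- belong to the caller.
    record _≈ₛ_ (u s : State) : Set where
      field
        words-eq : ∀ x i j → words u (offset + x) i j ≡ words s x i j
        reals-eq : ∀ x i j → reals u (offset + x) i j ≡ reals s x i j
    open _≈ₛ_

    module _ {u s : State} (r : u ≈ₛ s) where
      shift-evalWord : ∀ e → evalWord u (shiftWord e) ≡ evalWord s e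
      shift-evalWord (lit c) = refl
      shift-evalWord (word a i j)
        rewrite shift-evalWord i | shift-evalWord j = words-eq r a (evalWord s i) (evalWord s j)
      shift-evalWord (e ⊕ f) = cong₂ _+_ (shift-evalWord e) (shift-evalWord f)
      shift-evalWord (e ⊖ f) = cong₂ _∸_ (shift-evalWord e) (shift-evalWord f)
      shift-evalWord (e ⊗ f) = cong₂ _*_ (shift-evalWord e) (shift-evalWord f)
      shift-evalWord (e ⊘ f) = cong₂ _div_ (shift-evalWord e) (shift-evalWord f)

      shift-evalReal : ∀ x → evalReal u (shiftReal x) ≡ evalReal s x
      shift-evalReal (const x) = refl
      shift-evalReal (real a i j)
        rewrite shift-evalWord i | shift-evalWord j = reals-eq r a (evalWord s i) (evalWord s j)
      shift-evalReal (ratio e f) rewrite shift-evalWord e | shift-evalWord f = refl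

      shift-evalTest : ∀ b → evalTest u (shiftTest b) ≡ evalTest s b
      shift-evalTest (e ≤ʷ f) rewrite shift-evalWord e | shift-evalWord f = refl
      shift-evalTest (x ≤ʳ y) rewrite shift-evalReal x | shift-evalReal y = refl
      shift-evalTest (negate b) = cong not (shift-evalTest b)

      module _ {M M′ : ℕ} (M≤M′ : M ≤ M′) where
        private
          fits : ∀ {e} → evalWord s e ≤ M → evalWord u (shiftWord e) ≤ M′
          fits {e} l = ≤-trans (≤-reflexive (shift-evalWord e)) (≤-trans l M≤M′)

        shift-validWord : ∀ e → ValidWord M s e → ValidWord M′ u (shiftWord e)
        shift-validWord (lit c)      l           = ≤-trans l M≤M′
        shift-validWord (word a i j) (p , q , l) =
          shift-validWord i p , shift-validWord j q , fits {word a i j} l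
        shift-validWord (e ⊕ f) (p , q , l) =
          shift-validWord e p , shift-validWord f q , fits {e ⊕ f} l
        shift-validWord (e ⊖ f) (p , q)     = shift-validWord e p , shift-validWord f q
        shift-validWord (e ⊗ f) (p , q , l) =
          shift-validWord e p , shift-validWord f q , fits {e ⊗ f} l
        shift-validWord (e ⊘ f) (p , q , n) =
          shift-validWord e p , shift-validWord f q , λ z → n (trans (sym (shift-evalWord f)) z)

        shift-validReal : ∀ x → ValidReal M s x → ValidReal M′ u (shiftReal x)
        shift-validReal (const x)    _       = tt
        shift-validReal (real a i j) (p , q) = shift-validWord i p , shift-validWord j q
        shift-validReal (ratio e f)  (p , q , n) =
          shift-validWord e p , shift-validWord f q , λ z → n (trans (sym (shift-evalWord f)) z)

        shift-validTest : ∀ b → ValidTest M s b → ValidTest M′ u (shiftTest b)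
        shift-validTest (e ≤ʷ f)   (p , q) = shift-validWord e p , shift-validWord f q
        shift-validTest (x ≤ʳ y)   (p , q) = shift-validReal x p , shift-validReal y q
        shift-validTest (negate b) v       = shift-validTest b v

    update-cong : ∀ {X : Set} (m m′ : ℕ → Array X) a {i i′ j j′ v v′} →
                  (∀ x k l → m′ (offset + x) k l ≡ m x k l) →
                  i′ ≡ i → j′ ≡ j → v′ ≡ v → ∀ x k l →
                  update m′ (offset + a) i′ j′ v′ (offset + x) k l ≡ update m a i j v x k l
    -- `offset` is a numeral, so `offset + a ≟ offset + x` computes to the same Boolean as `a ≟ x`,
    -- and one case distinction settles both updates.
    update-cong m m′ a {i} {j = j} h refl refl refl x k l
      with does (a ≟ x) ∧ does (i ≟ k) ∧ does (j ≟ l)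
    ... | true  = refl
    ... | false = h x k l

    -- A step-by-step simulation, hence with the same running time. The word bound may grow because
    -- validity is monotone in it; the caller works with larger words than the given program asks
    -- for.
    shift-exec : ∀ {M M′ P s s′ τ u} → M ≤ M′ → u ≈ₛ s → M ⊢ P , s ⇓ s′ ⟨ τ ⟩ →
                 ∃[ u′ ] (M′ ⊢ shift P , u ⇓ u′ ⟨ τ ⟩ × u′ ≈ₛ s′)
    shift-exec l r skip = _ , skip , r
    shift-exec {s = s} {u = u} l r (setWord {a = a} {i} {j} {e} p q v) =
      _ , setWord (shift-validWord r l i p) (shift-validWord r l j q) (shift-validWord r l e v) ,
        record
        { words-eq = update-cong (words s) (words u) a (words-eq r)
                       (shift-evalWord r i) (shift-evalWord r j) (shift-evalWord r e)
        ; reals-eq = reals-eq r }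
    shift-exec {s = s} {u = u} l r (setReal {a = a} {i} {j} {e} p q v) =
      _ , setReal (shift-validWord r l i p) (shift-validWord r l j q) (shift-validReal r l e v) ,
        record
        { words-eq = words-eq r
        ; reals-eq = update-cong (reals s) (reals u) a (reals-eq r)
                       (shift-evalWord r i) (shift-evalWord r j) (shift-evalReal r e) }
    shift-exec l r (seq d e) with shift-exec l r d
    ... | _ , d′ , r′ with shift-exec l r′ e
    ... | _ , e′ , r″ = _ , seq d′ e′ , r″
    shift-exec l r (ifTrue {b} v t d) with shift-exec l r d
    ... | _ , d′ , r′ = _ , ifTrue (shift-validTest r l b v) (trans (shift-evalTest r b) t) d′ , r′
    shift-exec l r (ifFalse {b} v t d) with shift-exec l r d
    ... | _ , d′ , r′ = _ , ifFalse (shift-validTest r l b v) (trans (shift-evalTest r b) t) d′ , r′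
    shift-exec l r (whileTrue {b} v t d e) with shift-exec l r d
    ... | _ , d′ , r′ with shift-exec l r′ e
    ... | _ , e′ , r″ =
      _ , whileTrue (shift-validTest r l b v) (trans (shift-evalTest r b) t) d′ e′ , r″
    shift-exec l r (whileFalse {b} v t) =
      _ , whileFalse (shift-validTest r l b v) (trans (shift-evalTest r b) t) , r

  -- The algorithm as a program of the machine

  module Algorithm (F : CompleteOrderedField) where
    open CompleteOrderedField F using (Carrier)
    open Machine F
    open Execution F using (shift)

    var : ℕ → WordExp
    var x = word x (lit 0) (lit 0)

    forLoop : ℕ → WordExp → Program → Program
    forLoop x e P = setWord x (lit 0) (lit 0) (lit 0) ⨾
      while (var x ⊕ lit 1 ≤ʷ e) (P ⨾ setWord x (lit 0) (lit 0) (var x ⊕ lit 1))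

    grid : WordExp → WordExp → Program → Program
    grid eR eC P = forLoop 9 eR (forLoop 10 eC P)

    -- Word arrays 0, 1 and 2 and real arrays 0 and 1 are those of TargetInput and TargetOutput; the
    -- arrays from 20 on are those of the multiplication program. The others hold
    --    3  the bucket size s           9, 10, 11  loop counters
    --    4  the number G = ⌊n/s⌋        12  the current match, or the index k during a scan
    --    6  Q with 2^(Q-1) ≤ n < 2^Q    13  a tournament, in which match v is between 2v and 2v+1
    --    7  m with s = 2^m              14, 15  the sorted order of each row and its inverse
    --    8  a power of two              16  a leaf, or the bucket to be scanned
    --                                   18  the bit to be output
    findQ : Program
    findQ = setWord 6 (lit 0) (lit 0) (lit 0) ⨾ setWord 8 (lit 0) (lit 0) (lit 1) ⨾
      while (var 8 ≤ʷ var 0)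
        (setWord 8 (lit 0) (lit 0) (var 8 ⊕ var 8) ⨾ setWord 6 (lit 0) (lit 0) (var 6 ⊕ lit 1))

    findM : Carrier → Program
    findM t = setWord 7 (lit 0) (lit 0) (lit 0) ⨾ setWord 3 (lit 0) (lit 0) (lit 1) ⨾
      while (negate (const t ≤ʳ ratio (var 7) (var 6)))
        (setWord 3 (lit 0) (lit 0) (var 3 ⊕ var 3) ⨾ setWord 7 (lit 0) (lit 0) (var 7 ⊕ lit 1))

    setup : Carrier → Program
    setup t = findQ ⨾ findM t ⨾ setWord 4 (lit 0) (lit 0) (var 0 ⊘ var 3)

    leftChild rightChild : WordExp
    leftChild  = word 13 (lit 0) (lit 2 ⊗ var 12)
    rightChild = word 13 (lit 0) (lit 1 ⊕ lit 2 ⊗ var 12)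

    play replay : Program
    play = ifThenElse (var 0 ≤ʷ rightChild) (setWord 13 (lit 0) (var 12) leftChild)
      (ifThenElse (var 0 ≤ʷ leftChild) (setWord 13 (lit 0) (var 12) rightChild)
        (ifThenElse (real 0 (var 9) leftChild ≤ʳ real 0 (var 9) rightChild)
          (setWord 13 (lit 0) (var 12) leftChild)
          (setWord 13 (lit 0) (var 12) rightChild)))
    replay = while (lit 1 ≤ʷ var 12) (play ⨾ setWord 12 (lit 0) (lit 0) (var 12 ⊘ lit 2))

    root : WordExp
    root = word 13 (lit 0) (lit 1)

    insertStep extractStep clear insert extract sortRow sortRows : Program
    insertStep =
      setWord 13 (lit 0) (var 0 ⊕ var 10) (var 10) ⨾
      setWord 12 (lit 0) (lit 0) ((var 0 ⊕ var 10) ⊘ lit 2) ⨾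
      replay
    extractStep =
      setWord 14 (var 9) (var 10) root ⨾
      setWord 15 (var 9) root (var 10) ⨾
      setWord 16 (lit 0) (lit 0) (var 0 ⊕ root) ⨾
      setWord 13 (lit 0) (var 16) (var 0) ⨾
      setWord 12 (lit 0) (lit 0) (var 16 ⊘ lit 2) ⨾
      replay
    clear    = forLoop 10 (lit 2 ⊗ var 0) (setWord 13 (lit 0) (var 10) (var 0))
    insert   = forLoop 10 (var 0) insertStep
    extract  = forLoop 10 (var 0) extractStep
    sortRow  = clear ⨾ insert ⨾ extract
    sortRows = forLoop 9 (var 0) sortRow

    -- A comparison without a branch: 1 ∸ (x ∸ g) is 1 exactly if x ≤ g. Here x is the bucket of
    -- column k in row i, and g is the remainder of the row index i * G + g modulo G, obtained by
    -- division, multiplication and subtraction.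
    markExp : WordExp
    markExp = lit 1 ⊖ (word 15 (var 9 ⊘ var 4) (var 10) ⊘ var 3 ⊖ (var 9 ⊖ var 9 ⊘ var 4 ⊗ var 4))

    fillXs fillYs dims build : Program
    dims = setWord 20 (lit 0) (lit 0) (var 0 ⊗ var 4) ⨾ setWord 20 (lit 0) (lit 1) (var 0) ⨾
           setWord 20 (lit 0) (lit 2) (var 0)
    fillXs = grid (var 0 ⊗ var 4) (var 0) (setWord 21 (var 9) (var 10) markExp) ⨾
             grid (var 0 ⊗ var 4) (var 0) (setWord 22 (var 9) (var 10) (lit 0))
    fillYs = grid (var 0) (var 0) (setWord 23 (var 9) (var 10) (lit 1 ⊖ word 1 (var 9) (var 10))) ⨾
             grid (var 0) (var 0) (setWord 24 (var 9) (var 10) (lit 0))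
    build = fillXs ⨾ fillYs ⨾ dims

    cellIndex position : WordExp
    cellIndex = var 9 ⊗ var 4 ⊕ var 11
    position  = var 16 ⊗ var 3 ⊕ var 11

    findStep scanStep findFirst scan cell query : Program
    -- The test succeeds if bucket g = (cell 11) is the first candidate and its product entry is 0.
    findStep  = ifThenElse (var 11 ⊕ word 25 cellIndex (var 10) ≤ʷ var 16)
                  (setWord 16 (lit 0) (lit 0) (var 16 ⊕ lit 1)) skip
    findFirst = setWord 16 (lit 0) (lit 0) (lit 0) ⨾ forLoop 11 (var 4) findStep
    scanStep  = ifThenElse (position ⊕ lit 1 ≤ʷ var 0)
      (setWord 12 (lit 0) (lit 0) (word 14 (var 9) position) ⨾
       ifThenElse (word 1 (var 12) (var 10) ≤ʷ lit 0)
         (ifThenElse (real 0 (var 9) (var 12) ≤ʳ real 1 (var 9) (var 10))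
           (setWord 18 (lit 0) (lit 0) (lit 1)) skip)
         skip)
      skip
    scan  = setWord 18 (lit 0) (lit 0) (lit 0) ⨾ forLoop 11 (var 3) scanStep
    cell  = findFirst ⨾ scan ⨾ setWord 2 (var 9) (var 10) (var 18)
    query = grid (var 0) (var 0) cell

    targetProduct : Carrier → Program → Program
    targetProduct t P = setup t ⨾ sortRows ⨾ build ⨾ shift P ⨾ query

  -- A program logic for total correctness with time bounds

  module Hoare (F : CompleteOrderedField) (M : ℕ) where
    open CompleteOrderedField F using (Carrier) renaming (_≤_ to _≤ᶠ_; _≤?_ to _≤ᶠ?_)
    open Machine F
    open Execution F
    open Algorithm F

    record Ev (s : State) (e : WordExp) (v : ℕ) : Set where
      constructor ev
      field
        valid : ValidWord M s e
        value : evalWord s e ≡ v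

    ev-lit : ∀ {s c} → c ≤ M → Ev s (lit c) c
    ev-lit l = ev l refl

    ev-word : ∀ {s x i j k l v} → Ev s i k → Ev s j l → words s x k l ≡ v → v ≤ M →
      Ev s (word x i j) v
    ev-word (ev p refl) (ev q refl) refl l = ev (p , q , l) refl

    ev-var : ∀ {s x v} → words s x 0 0 ≡ v → v ≤ M → Ev s (var x) v
    ev-var = ev-word (ev-lit z≤n) (ev-lit z≤n)

    ev-⊕ : ∀ {s e f a b} → Ev s e a → Ev s f b → a + b ≤ M → Ev s (e ⊕ f) (a + b)
    ev-⊕ (ev p refl) (ev q refl) l = ev (p , q , l) refl

    ev-⊖ : ∀ {s e f a b} → Ev s e a → Ev s f b → Ev s (e ⊖ f) (a ∸ b)
    ev-⊖ (ev p refl) (ev q refl) = ev (p , q) refl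

    ev-⊗ : ∀ {s e f a b} → Ev s e a → Ev s f b → a * b ≤ M → Ev s (e ⊗ f) (a * b)
    ev-⊗ (ev p refl) (ev q refl) l = ev (p , q , l) refl

    ev-⊘ : ∀ {s e f a b} .{{_ : NonZero b}} → Ev s e a → Ev s f b → Ev s (e ⊘ f) (a / b)
    ev-⊘ {b = suc b} (ev p refl) (ev q eq) = ev (p , q , λ z → 1+n≢0 (trans (sym eq) z))
      (cong (_ div_) eq)

    -- The precondition is replaced by a fixed initial state, to which the postcondition may refer.
    -- The execution is kept as a witness: it gives termination and, through `frame`, all that is
    -- unchanged.
    record Run (P : Program) (s : State) (c : ℕ) (Q : State → Set) : Set where
      constructor run
      field
        {final} : State
        {steps} : ℕ
        exec    : M ⊢ P , s ⇓ final ⟨ steps ⟩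
        bound   : steps ≤ c
        post    : Q final

    weaken : ∀ {P s c d Q} → c ≤ d → Run P s c Q → Run P s d Q
    weaken l (run e b p) = run e (≤-trans b l) p

    conseq : ∀ {P s c} {Q R : State → Set} → (∀ s′ → Agree P s s′ → Q s′ → R s′) → Run P s c Q →
      Run P s c R
    conseq f (run e b p) = run e b (f _ (frame e) p)

    put : State → ℕ → ℕ → ℕ → ℕ → State
    put s x i j v = mkState (update (words s) x i j v) (reals s)

    run-skip : ∀ {s Q} → Q s → Run skip s 1 Q
    run-skip q = run skip ≤-refl q

    run-set : ∀ {s x i j e k l v Q} → Ev s i k → Ev s j l → Ev s e v → Q (put s x k l v) →
              Run (setWord x i j e) s 1 Q
    run-set (ev p refl) (ev q refl) (ev r refl) z = run (setWord p q r) ≤-refl z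

    infixr 3 _>>>_
    _>>>_ : ∀ {P P′ s c d Q R} → Run P s c Q → (∀ s′ → Agree P s s′ → Q s′ → Run P′ s′ d R) →
            Run (P ⨾ P′) s (c + d) R
    run e b p >>> f with f _ (frame e) p
    ... | run e′ b′ p′ = run (seq e e′) (+-mono-≤ b b′) p′

    run-set⨾ : ∀ {P s x i j e k l v d R} → Ev s i k → Ev s j l → Ev s e v →
               Run P (put s x k l v) d R → Run (setWord x i j e ⨾ P) s (1 + d) R
    run-set⨾ (ev p refl) (ev q refl) (ev r refl) (run e b z) = run (seq (setWord p q r) e) (s≤s b) z

    run-if : ∀ {b P P′ s c Q} → ValidTest M s b →
             (evalTest s b ≡ true → Run P s c Q) → (evalTest s b ≡ false → Run P′ s c Q) →
             Run (ifThenElse b P P′) s (suc c) Q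
    run-if {b} {s = s} v f g with evalTest s b in eq
    ... | true  with f refl
    ...   | run e l q = run (ifTrue v eq e) (s≤s l) q
    run-if {b} {s = s} v f g | false with g refl
    ...   | run e l q = run (ifFalse v eq e) (s≤s l) q

    does-true : ∀ {a b} → does (a ≤? b) ≡ true → a ≤ b
    does-true {a} {b} e with a ≤? b
    ... | yes p = p
    ... | no p with trans (sym e) (dec-false (a ≤? b) p)
    ...   | ()

    does-false : ∀ {a b} → does (a ≤? b) ≡ false → b < a
    does-false {a} {b} e with a ≤? b
    ... | no p = ≰⇒> p
    ... | yes p with trans (sym e) (dec-true (a ≤? b) p)
    ...   | ()

    run-if≤ : ∀ {e f a b P P′ s c Q} → Ev s e a → Ev s f b →
              (a ≤ b → Run P s c Q) → (b < a → Run P′ s c Q) →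
              Run (ifThenElse (e ≤ʷ f) P P′) s (suc c) Q
    run-if≤ (ev p refl) (ev q refl) f g =
      run-if (p , q) (λ t → f (does-true t)) (λ t → g (does-false t))

    -- The index of the invariant bounds the number of rounds still to come and is the measure of
    -- the recursion. Each round may assume `Agree P s₀ s` with the state before the loop, so
    -- invariants need not mention the arrays that the loop leaves alone.
    run-while : ∀ {b P c T} (I : ℕ → State → Set) (s₀ : State) →
      (∀ k s → Agree P s₀ s → I k s →
        ValidTest M s b ×
        ((evalTest s b ≡ false × T s) ⊎
         (evalTest s b ≡ true × ∃[ k′ ] (k ≡ suc k′ × Run P s c (I k′))))) →
      ∀ k → I k s₀ → Run (while b P) s₀ (suc (k * suc c)) T
    run-while {b} {P} {c} {T} I s₀ step k i = go k s₀ (agree-refl {P}) i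
      where
      go : ∀ k s → Agree P s₀ s → I k s → Run (while b P) s (suc (k * suc c)) T
      go k s ag i with step k s ag i
      ... | v , inj₁ (f , t) = run (whileFalse v f) (s≤s z≤n) t
      ... | v , inj₂ (t , k′ , refl , run {s′} e l q)
        with go k′ s′ (agree-trans {P} {P} (λ _ n → n) ag (frame e)) q
      ...   | run e′ l′ q′ = run (whileTrue v t e e′)
              (s≤s (≤-trans (+-mono-≤ l l′) (≤-reflexive (+-suc c (k′ * suc c))))) q′

    forCost : ℕ → ℕ → ℕ
    forCost N c = 2 + N * (2 + c)

    -- `N < M` is strict because the last test still evaluates the counter plus one, that is
    -- `N + 1`. The invariant has to survive any assignment to the counter, since the counter is set
    -- to 0 before the first round and incremented after each.
    run-for : ∀ {x e P N c} (I : ℕ → State → Set) (s₀ : State) →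
      N < M → touches P x ≡ false →
      (∀ i s v → I i s → I i (put s x 0 0 v)) →
      (∀ i s → Agree (forLoop x e P) s₀ s → I i s → Ev s e N) →
      (∀ i s → i < N → Agree (forLoop x e P) s₀ s → words s x 0 0 ≡ i → I i s →
        Run P s c (I (suc i))) →
      I 0 s₀ → Run (forLoop x e P) s₀ (forCost N c) (I N)
    run-for {x} {e} {P} {N} {c} I s₀ N<M nt stable evE body i₀ =
      weaken (≤-reflexive (cong (λ z → suc (suc (N * suc z))) (+-comm c 1)))
        (run-set⨾ (ev-lit z≤n) (ev-lit z≤n) (ev-lit z≤n)
          (run-while Inv s₁ step N
            (0 , refl , update-same (words s₀) x 0 0 0 , stable 0 s₀ 0 i₀)))
      where
      L = forLoop x e P
      W = P ⨾ setWord x (lit 0) (lit 0) (var x ⊕ lit 1)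
      s₁ = put s₀ x 0 0 0
      Inv : ℕ → State → Set
      Inv k s = ∃[ i ] (i + k ≡ N × words s x 0 0 ≡ i × I i s)
      outer : ∀ {s} → Agree W s₁ s → Agree L s₀ s
      outer ag y n = trans (proj₁ (ag y (∨-falseʳ {x ≡ᵇ y} n)))
        (update-other (words s₀) x 0 0 0 (∨-falseˡ n)) ,
                     proj₂ (ag y (∨-falseʳ {x ≡ᵇ y} n))
      step : ∀ k s → Agree W s₁ s → Inv k s → _
      step k s ag (i , eq , xi , inv) with evE i s (outer ag) inv
      ... | ev p q =
        ((((z≤n , z≤n , ≤-trans (≤-reflexive xi) i≤M) , 1≤M , ≤-trans (≤-reflexive x+1≡) i<M) , p))
          ,
        split k eq
        where
        i≤N = ≤-trans (m≤m+n i k) (≤-reflexive eq)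
        i<M = ≤-<-trans i≤N N<M
        i≤M = <⇒≤ i<M
        1≤M = ≤-trans (s≤s z≤n) N<M
        x+1≡ = trans (cong (_+ 1) xi) (+-comm i 1)
        test≡ : evalTest s (var x ⊕ lit 1 ≤ʷ e) ≡ does (suc i ≤? N)
        test≡ = cong₂ (λ a b → does (a ≤? b)) x+1≡ q
        split : ∀ k → i + k ≡ N →
          (evalTest s (var x ⊕ lit 1 ≤ʷ e) ≡ false × I N s) ⊎
          (evalTest s (var x ⊕ lit 1 ≤ʷ e) ≡ true × ∃[ k′ ] (k ≡ suc k′ × Run W s (c + 1) (Inv k′)))
        split zero eq = inj₁ (trans test≡ (dec-false (suc i ≤? N) (≤⇒≯ (≤-reflexive N≡i))) ,
                              subst (λ z → I z s) (sym N≡i) inv)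
          where N≡i = trans (sym eq) (+-identityʳ i)
        split (suc k) eq = inj₂ (trans test≡ (dec-true (suc i ≤? N) i<N) , k , refl ,
          (body i s i<N (outer ag) xi inv >>> λ s′ ag′ inv′ →
            run-set (ev-lit z≤n) (ev-lit z≤n)
              (ev-⊕ (ev-var (trans (cong (λ f → f 0 0) (proj₁ (ag′ x nt))) xi) i≤M) (ev-lit 1≤M)
                (≤-trans (≤-reflexive (+-comm i 1)) i<M))
              (suc i , trans (sym (+-suc i k)) eq ,
               trans (update-same (words s′) x 0 0 (i + 1)) (+-comm i 1) ,
                 stable (suc i) s′ (i + 1) inv′)))
          where
          i<N : i < N
          i<N = ≤-trans (s≤s (m≤m+n i k)) (≤-reflexive (trans (sym (+-suc i k)) eq))

    keep : ∀ {P s s′ v} → Agree P s s′ → ∀ x → touches P x ≡ false → ∀ {i j} →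
           words s x i j ≡ v → words s′ x i j ≡ v
    keep ag x nt {i} {j} e = trans (cong (λ f → f i j) (proj₁ (ag x nt))) e

    record EvR (s : State) (e : RealExp) (v : Carrier) : Set where
      constructor evR
      field
        valid : ValidReal M s e
        value : evalReal s e ≡ v

    ev-real : ∀ {s x i j k l v} → Ev s i k → Ev s j l → reals s x k l ≡ v → EvR s (real x i j) v
    ev-real (ev p refl) (ev q refl) e = evR (p , q) e

    does-trueᶠ : ∀ {a b} → does (a ≤ᶠ? b) ≡ true → a ≤ᶠ b
    does-trueᶠ {a} {b} e with a ≤ᶠ? b
    does-trueᶠ e  | yes p = p
    does-trueᶠ () | no p

    does-falseᶠ : ∀ {a b} → does (a ≤ᶠ? b) ≡ false → ¬ a ≤ᶠ b
    does-falseᶠ {a} {b} e with a ≤ᶠ? b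
    does-falseᶠ e  | no p = p
    does-falseᶠ () | yes p

    run-ifᶠ : ∀ {e f a b P P′ s c Q} → EvR s e a → EvR s f b →
              (a ≤ᶠ b → Run P s c Q) → (¬ a ≤ᶠ b → Run P′ s c Q) →
              Run (ifThenElse (e ≤ʳ f) P P′) s (suc c) Q
    run-ifᶠ (evR p refl) (evR q refl) f g =
      run-if (p , q) (λ t → f (does-trueᶠ t)) (λ t → g (does-falseᶠ t))

  -- Tournaments stored as implicit binary trees

  half-cases : ∀ v → v ≡ 2 * (v / 2) ⊎ v ≡ suc (2 * (v / 2))
  half-cases v with v % 2 | m≡m%n+[m/n]*n v 2 | m%n<n v 2
  ... | 0 | e | _ = inj₁ (trans e (*-comm (v / 2) 2))
  ... | 1 | e | _ = inj₂ (trans e (cong suc (*-comm (v / 2) 2)))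
  ... | suc (suc _) | _ | s≤s (s≤s ())

  half-even : ∀ u → 2 * u / 2 ≡ u
  half-even u = trans (cong (_/ 2) (*-comm 2 u)) (m*n/n≡m u 2)

  half-odd : ∀ u → suc (2 * u) / 2 ≡ u
  half-odd u = trans (cong (λ x → suc x / 2) (*-comm 2 u))
    (trans (+-distrib-/ 1 (u * 2) (subst (λ z → 1 + z < 2) (sym (m*n%n≡0 u 2)) (s≤s (s≤s z≤n))))
      (m*n/n≡m u 2))

  half< : ∀ {v m} → v < 2 * m → v / 2 < m
  half< {v} {m} l = m<n*o⇒m/o<n (≤-trans l (≤-reflexive (*-comm 2 m)))

  half≥1 : ∀ {v} → 2 ≤ v → 1 ≤ v / 2
  half≥1 l = /-monoˡ-≤ 2 l

  half<self : ∀ {v} → 1 ≤ v → v / 2 < v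
  half<self {suc v} l = m/n<m (suc v) 2 (s≤s (s≤s z≤n))

  odd<double : ∀ {u m} → u < m → suc (2 * u) < 2 * m
  odd<double {u} {m} l = ≤-trans (≤-reflexive (sym (*-suc 2 u))) (*-monoʳ-≤ 2 l)

  even<double : ∀ {u m} → u < m → 2 * u < 2 * m
  even<double {u} l = <-trans (n<1+n _) (odd<double l)

  u<2u : ∀ {u} → 1 ≤ u → u < 2 * u
  u<2u {u} l = ≤-trans (+-monoˡ-≤ u l) (≤-reflexive (cong (u +_) (sym (+-identityʳ u))))

  2n≡n+n : ∀ n → 2 * n ≡ n + n
  2n≡n+n n = cong (n +_) (+-identityʳ n)

  module Tournament (F : CompleteOrderedField) (n : ℕ) (key : ℕ → CompleteOrderedField.Carrier F)
    where
    open CompleteOrderedField F using () renaming (_≤_ to _≤ᶠ_; ≤-refl to ≤ᶠ-refl;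
      ≤-trans to ≤ᶠ-trans)

    -- The index n stands for an absent player, which loses against everybody.
    _≼_ : ℕ → ℕ → Set
    x ≼ y = n ≤ y ⊎ (x < n × key x ≤ᶠ key y)

    ≼-refl : ∀ x → x ≼ x
    ≼-refl x with n ≤? x
    ... | yes l = inj₁ l
    ... | no  l = inj₂ (≰⇒> l , ≤ᶠ-refl)

    ≼-trans : ∀ {x y z} → x ≼ y → y ≼ z → x ≼ z
    ≼-trans _ (inj₁ l) = inj₁ l
    ≼-trans (inj₁ l) (inj₂ (m , _)) = ⊥-elim (<⇒≱ m l)
    ≼-trans (inj₂ (l , p)) (inj₂ (_ , q)) = inj₂ (l , ≤ᶠ-trans p q)

    -- A relation, because among equal keys either player may win.
    Winner : ℕ → ℕ → ℕ → Set
    Winner w x y = (w ≡ x ⊎ w ≡ y) × w ≼ x × w ≼ y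

    -- Nodes 1 to n - 1 are matches and nodes n to 2n - 1 are leaves. This layout works for every n
    -- ≥ 1, not only for powers of two; for n = 1 the root is the only leaf and there is no match.
    Local : (ℕ → ℕ) → ℕ → Set
    Local tr u = Winner (tr u) (tr (2 * u)) (tr (suc (2 * u)))

    -- A tournament in which only the match at v may be stale (0 is not a match).
    AllBut : ℕ → (ℕ → ℕ) → Set
    AllBut v tr = ∀ u → 1 ≤ u → u < n → u ≢ v → Local tr u

    Changed : ℕ → (ℕ → ℕ) → (ℕ → ℕ) → Set
    Changed w tr tr′ = ∀ y → y ≢ w → tr′ y ≡ tr y

    -- A node takes part in two matches at most, its own and that of its parent `w / 2`.
    local-changed : ∀ {w tr tr′ u} → Changed w tr tr′ → u ≢ w → u ≢ w / 2 → Local tr u → Local tr′ u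
    local-changed {w} {tr} {tr′} {u} ch p q l
      rewrite ch u p
            | ch (2 * u) (λ e → q (trans (sym (half-even u)) (cong (_/ 2) e)))
            | ch (suc (2 * u)) (λ e → q (trans (sym (half-odd u)) (cong (_/ 2) e))) = l

    leaf-changed : ∀ {x tr tr′} → n ≤ x → Changed x tr tr′ → AllBut 0 tr → AllBut (x / 2) tr′
    leaf-changed {x} l ch h u 1≤u u<n ne =
      local-changed ch (λ e → <⇒≱ u<n (subst (n ≤_) (sym e) l)) ne
        (h u 1≤u u<n (λ e → <⇒≱ 1≤u (≤-reflexive e)))

    -- Repairing a match can spoil only the one above it, so the defect climbs to the parent. From
    -- the root it climbs to `1 / 2`, which is 0 and not a match: the tournament is then sound.
    match-replayed : ∀ {v tr tr′} → 1 ≤ v → Changed v tr tr′ →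
      Winner (tr′ v) (tr (2 * v)) (tr (suc (2 * v))) →
                     AllBut v tr → AllBut (v / 2) tr′
    match-replayed {v} {tr} {tr′} 1≤v ch w h u 1≤u u<n ne with u ≟ v
    ... | no p = local-changed ch p ne (h u 1≤u u<n p)
    ... | yes refl
      rewrite ch (2 * v) (λ e → <⇒≢ (u<2u 1≤v) (sym e))
            | ch (suc (2 * v)) (λ e → <⇒≢ (m<n⇒m<1+n (u<2u 1≤v)) (sym e)) = w

    module _ {tr : ℕ → ℕ} (h : AllBut 0 tr) where
      root-≼ : ∀ v → 1 ≤ v → v < 2 * n → tr 1 ≼ tr v
      root-≼ v = go v (<-wellFounded v)
        where
        go : ∀ v → Acc _<_ v → 1 ≤ v → v < 2 * n → tr 1 ≼ tr v
        go 0 _ ()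
        go 1 _ _ _ = ≼-refl (tr 1)
        go v@(suc (suc w)) (acc rs) 1≤v l =
          ≼-trans (go u (rs (half<self {v} 1≤v)) 1≤u (≤-trans u<n (m≤m+n n _))) up
          where
          u = v / 2
          1≤u = half≥1 {v} (s≤s (s≤s z≤n))
          u<n = half< {v} l
          loc = h u 1≤u u<n (λ e → <⇒≱ 1≤u (≤-reflexive e))
          up : tr u ≼ tr v
          up with half-cases v
          ... | inj₁ e = subst (λ z → tr u ≼ tr z) (sym e) (proj₁ (proj₂ loc))
          ... | inj₂ e = subst (λ z → tr u ≼ tr z) (sym e) (proj₂ (proj₂ loc))

      -- The winner of a match is the entry of one of its children. Following it downwards increases
      -- the node, so the distance to 2n is the measure.
      winner-leaf : ∀ u → 1 ≤ u → u < 2 * n → ∃[ k ] (k < n × tr u ≡ tr (n + k))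
      winner-leaf u = go u (<-wellFounded (2 * n ∸ u))
        where
        go : ∀ u → Acc _<_ (2 * n ∸ u) → 1 ≤ u → u < 2 * n → ∃[ k ] (k < n × tr u ≡ tr (n + k))
        go u (acc rs) 1≤u l with n ≤? u
        ... | yes n≤u = u ∸ n ,
                +-cancelˡ-< n (u ∸ n) n (≤-trans (≤-reflexive (cong suc (m+[n∸m]≡n n≤u)))
                  (≤-trans l (≤-reflexive (2n≡n+n n)))) ,
                cong tr (sym (m+[n∸m]≡n n≤u))
        ... | no n≰u with h u 1≤u (≰⇒> n≰u) (λ e → <⇒≱ 1≤u (≤-reflexive e))
        ...   | inj₁ e , _ with go (2 * u) (rs (∸-monoʳ-< (u<2u 1≤u) (<⇒≤ (even<double (≰⇒> n≰u)))))
          (≤-trans 1≤u (<⇒≤ (u<2u 1≤u))) (even<double (≰⇒> n≰u))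
        ...     | k , k<n , e′ = k , k<n , trans e e′
        go u (acc rs) 1≤u l | no n≰u | inj₂ e , _ with go (suc (2 * u))
          (rs (∸-monoʳ-< (m<n⇒m<1+n (u<2u 1≤u)) (<⇒≤ (odd<double (≰⇒> n≰u))))) (s≤s z≤n)
          (odd<double (≰⇒> n≰u))
        ...     | k , k<n , e′ = k , k<n , trans e e′

    -- Buckets are not stored. The scans walk through positions and need `ord`; the marking asks for
    -- the bucket of a column, which is its `rank` divided by the bucket size.
    record Order (ord rank : ℕ → ℕ) : Set where
      field
        ord<     : ∀ {q} → q < n → ord q < n
        rank<    : ∀ {k} → k < n → rank k < n
        ord-rank : ∀ {k} → k < n → ord (rank k) ≡ k
        mono     : ∀ {q r} → q ≤ r → r < n → key (ord q) ≤ᶠ key (ord r)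

    -- The state of the sort after pos players have been removed; removed players have leaf n.
    record Sorted (pos : ℕ) (tr ord rank : ℕ → ℕ) : Set where
      field
        tournament : AllBut 0 tr
        leaves     : ∀ {k} → k < n → tr (n + k) ≡ k ⊎
          (tr (n + k) ≡ n × rank k < pos × ord (rank k) ≡ k)
        ord<       : ∀ {q} → q < pos → ord q < n
        rank-ord   : ∀ {q} → q < pos → rank (ord q) ≡ q
        removed    : ∀ {q} → q < pos → tr (n + ord q) ≡ n
        mono       : ∀ {q r} → q ≤ r → r < pos → key (ord q) ≤ᶠ key (ord r)
        below      : ∀ {q k} → q < pos → k < n → tr (n + k) ≡ k → key (ord q) ≤ᶠ key k

    module _ {pos tr ord rank} (S : Sorted pos tr ord rank) where
      open Sorted S

      -- If the root were absent, no leaf could hold a player, since the root does not lose against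
      -- any leaf. All n players would then have ranks below `pos < n`, and these are distinct
      -- because `ord` recovers the player from its rank.
      root-present : pos < n → tr 1 < n × tr (n + tr 1) ≡ tr 1
      root-present pos<n with winner-leaf tournament 1 ≤-refl
        (≤-trans (s≤s (s≤s z≤n)) (≤-trans (*-monoʳ-≤ 2 (≤-trans (s≤s z≤n) pos<n)) ≤-refl))
      ... | k , k<n , e with leaves k<n
      ...   | inj₁ p = subst (_< n) (sym e′) k<n ,
        trans (cong (λ z → tr (n + z)) e′) (trans p (sym e′))
        where e′ = trans e p
      ...   | inj₂ (p , _) = ⊥-elim (clash (pigeonhole pos<n f))
        where
        absent : ∀ {k} → k < n → rank k < pos × ord (rank k) ≡ k
        absent {k} l with leaves l
        ... | inj₂ (_ , q) = q
        ... | inj₁ q with root-≼ tournament (n + k) (≤-trans (≤-trans (s≤s z≤n) l) (m≤m+n n k))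
                           (≤-trans (+-monoʳ-< n l) (≤-reflexive (sym (2n≡n+n n))))
        ...   | inj₁ g = ⊥-elim (<⇒≱ l (subst (n ≤_) q g))
        ...   | inj₂ (g , _) = ⊥-elim (<⇒≢ g (trans e p))
        f : Fin n → Fin pos
        f x = fromℕ< (proj₁ (absent (toℕ<n x)))
        clash : (∃[ x ] ∃[ y ] (x Fin.< y × f x ≡ f y)) → ⊥
        clash (x , y , x<y , eq) = <⇒≢ x<y
          (trans (sym (proj₂ (absent (toℕ<n x))))
            (trans (cong ord (fromℕ<-injective _ _ _ _ eq)) (proj₂ (absent (toℕ<n y)))))

    -- A player still present would, together with the n removed ones, give n + 1 distinct numbers
    -- below n.
    sorted-order : ∀ {tr ord rank} → Sorted n tr ord rank → Order ord rank
    sorted-order {tr} {ord} {rank} S = record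
      { ord< = ord< ; rank< = λ l → proj₁ (absent l) ; ord-rank = λ l → proj₂ (absent l) ; mono =
        mono }
      where
      open Sorted S
      absent : ∀ {k} → k < n → rank k < n × ord (rank k) ≡ k
      absent {k} l with leaves l
      ... | inj₂ (_ , q) = q
      ... | inj₁ p = ⊥-elim (clash (pigeonhole ≤-refl f))
        where
        f : Fin (suc n) → Fin n
        f zero    = fromℕ< l
        f (suc x) = fromℕ< (ord< (toℕ<n x))
        clash : (∃[ x ] ∃[ y ] (x Fin.< y × f x ≡ f y)) → ⊥
        clash (zero , suc y , _ , eq) = <⇒≢ l (trans (sym p)
          (trans (cong (λ z → tr (n + z)) (fromℕ<-injective _ _ _ _ eq)) (removed (toℕ<n y))))
        clash (suc x , suc y , s≤s x<y , eq) = <⇒≢ x<y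
          (trans (sym (rank-ord (toℕ<n x)))
            (trans (cong rank (fromℕ<-injective _ _ _ _ eq)) (rank-ord (toℕ<n y))))

    -- The root does not exceed any player still present, and by `below` it is not smaller than any
    -- removed player; so appending it keeps the order. The new arrays are given by equations only,
    -- which keeps program states out of this argument.
    sorted-step : ∀ {pos tr ord rank tr′ ord′ rank′} → Sorted pos tr ord rank → pos < n →
      AllBut 0 tr′ → tr′ (n + tr 1) ≡ n → (∀ {k} → k ≢ tr 1 → tr′ (n + k) ≡ tr (n + k)) →
      ord′ pos ≡ tr 1 → (∀ {q} → q ≢ pos → ord′ q ≡ ord q) →
      rank′ (tr 1) ≡ pos → (∀ {k} → k ≢ tr 1 → rank′ k ≡ rank k) →
      Sorted (suc pos) tr′ ord′ rank′
    sorted-step {pos} {tr} {ord} {rank} {tr′} {ord′} {rank′} S pos<n tour trr tro ordp ordo rankr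
      ranko = record
      { tournament = tour
      ; leaves     = leaves′
      ; ord<       = λ {q} l → ord-case (λ z → z < n) l (proj₁ present) ord<
      ; rank-ord   = rank-ord′
      ; removed    = λ {q} l → ord-case (λ z → tr′ (n + z) ≡ n) l trr
        (λ m → trans (tro (ord≢ m)) (removed m))
      ; mono       = mono′
      ; below      = below′
      }
      where
      open Sorted S
      r = tr 1
      present = root-present S pos<n
      old : ∀ {q} → q < pos → ord′ q ≡ ord q
      old l = ordo (<⇒≢ l)
      ord≢ : ∀ {q} → q < pos → ord q ≢ r
      ord≢ l e = <⇒≢ (proj₁ present)
        (trans (sym (proj₂ present)) (trans (cong (λ z → tr (n + z)) (sym e)) (removed l)))
      ord-case : ∀ {q} (C : ℕ → Set) → q < suc pos → C r → (q < pos → C (ord q)) → C (ord′ q)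
      ord-case {q} C (s≤s l) a b with m≤n⇒m<n∨m≡n l
      ... | inj₁ m    = subst C (sym (old m)) (b m)
      ... | inj₂ refl = subst C (sym ordp) a
      rank-ord′ : ∀ {q} → q < suc pos → rank′ (ord′ q) ≡ q
      rank-ord′ {q} (s≤s l) with m≤n⇒m<n∨m≡n l
      ... | inj₁ m    = trans (cong rank′ (old m)) (trans (ranko (ord≢ m)) (rank-ord m))
      ... | inj₂ refl = trans (cong rank′ ordp) rankr
      leaves′ : ∀ {k} → k < n → tr′ (n + k) ≡ k ⊎
        (tr′ (n + k) ≡ n × rank′ k < suc pos × ord′ (rank′ k) ≡ k)
      leaves′ {k} l with k ≟ r
      ... | yes refl = inj₂ (trr , s≤s (≤-reflexive rankr) , trans (cong ord′ rankr) ordp)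
      ... | no ne with leaves l
      ...   | inj₁ p = inj₁ (trans (tro ne) p)
      ...   | inj₂ (p , q , s) =
        inj₂ (trans (tro ne) p , subst (_< suc pos) (sym (ranko ne)) (m<n⇒m<1+n q) ,
                trans (cong ord′ (ranko ne)) (trans (old q) s))
      present′ : ∀ {k} → k < n → tr′ (n + k) ≡ k → tr (n + k) ≡ k
      present′ {k} l p with k ≟ r
      ... | yes refl = ⊥-elim (<⇒≢ l (trans (sym p) trr))
      ... | no ne = trans (sym (tro ne)) p
      r≤ : ∀ {k} → k < n → tr (n + k) ≡ k → key r ≤ᶠ key k
      r≤ {k} l p with root-≼ tournament (n + k) (≤-trans (≤-trans (s≤s z≤n) l) (m≤m+n n k))
                           (≤-trans (+-monoʳ-< n l) (≤-reflexive (sym (2n≡n+n n))))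
      ... | inj₁ g = ⊥-elim (<⇒≱ l (subst (n ≤_) p g))
      ... | inj₂ (_ , g) = subst (λ z → key r ≤ᶠ key z) p g
      below′ : ∀ {q k} → q < suc pos → k < n → tr′ (n + k) ≡ k → key (ord′ q) ≤ᶠ key k
      below′ {q} {k} l k<n p = ord-case (λ z → key z ≤ᶠ key k) l (r≤ k<n (present′ k<n p))
        (λ m → below m k<n (present′ k<n p))
      mono′ : ∀ {q s} → q ≤ s → s < suc pos → key (ord′ q) ≤ᶠ key (ord′ s)
      mono′ {q} {s} q≤s (s≤s l) with m≤n⇒m<n∨m≡n l
      ... | inj₁ m = subst₂ (λ a b → key a ≤ᶠ key b) (sym (old (≤-<-trans q≤s m))) (sym (old m))
        (mono q≤s m)
      ... | inj₂ refl = subst (λ b → key (ord′ q) ≤ᶠ key b) (sym ordp)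
              (ord-case (λ a → key a ≤ᶠ key r) (s≤s q≤s) ≤ᶠ-refl
                (λ m → below m (proj₁ present) (proj₂ present)))

  -- Sorting the rows

  module Sort (F : CompleteOrderedField) (M n : ℕ) (1≤n : 1 ≤ n) (fits : 4 * (suc n * suc n) ≤ M)
              (A : ℕ → ℕ → CompleteOrderedField.Carrier F) where
    open CompleteOrderedField F using (total) renaming (_≤_ to _≤ᶠ_)
    open Machine F
    open Execution F
    open Algorithm F
    open Hoare F M
    open Tournament F n

    4n≤M : ∀ {x} → x ≤ 4 * suc n → x ≤ M
    4n≤M l = ≤-trans l (≤-trans (*-monoʳ-≤ 4 (m≤m+n (suc n) _)) fits)

    n≤M : ∀ {x} → x ≤ n → x ≤ M
    n≤M l = 4n≤M (≤-trans l (≤-trans (n≤1+n n) (m≤m+n (suc n) _)))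

    2n≤M : ∀ {x} → x ≤ 2 * suc n → x ≤ M
    2n≤M l = 4n≤M (≤-trans l (*-monoˡ-≤ (suc n) {2} {4} (s≤s (s≤s z≤n))))

    2n<M : ∀ {x} → x ≤ 2 * n → x < M
    2n<M {x} l = 2n≤M (≤-trans (s≤s l) (≤-trans (n≤1+n _) (≤-reflexive (sym (*-suc 2 n)))))

    Small : (ℕ → ℕ) → Set
    Small tr = ∀ v → v < 2 * n → tr v ≤ n

    -- Base and Env below are predicates on the relevant arrays rather than on states, so that they are
    -- definitionally invariant under assignments to other arrays.
    record Base (i : ℕ) (size row : ℕ → ℕ → ℕ) (keys : ℕ → ℕ → CompleteOrderedField.Carrier F) : Set
      where
      constructor base
      field
        size≡ : size 0 0 ≡ n
        row≡  : row 0 0 ≡ i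
        row≤  : i ≤ n
        keys≡ : keys ≡ A

    BaseOf : ℕ → State → Set
    BaseOf i s = Base i (words s 0) (words s 9) (reals s 0)

    base-agree : ∀ {i P s s′} → Agree P s s′ → touches P 0 ≡ false → touches P 9 ≡ false →
      BaseOf i s → BaseOf i s′
    base-agree {P = P} ag p q (base a b c d) = base (keep {P} ag 0 p a) (keep {P} ag 9 q b) c
      (trans (proj₂ (ag 0 p)) d)

    module _ (i : ℕ) where
      run-play : ∀ s v → BaseOf i s → words s 12 0 0 ≡ v → v < n → Small (words s 13 0) →
        Run play s 4 (λ s′ → ∃[ w ]
          (Winner (A i) w (words s 13 0 (2 * v)) (words s 13 0 (suc (2 * v))) ×
                                s′ ≡ put s 13 0 v w))
      run-play s v (base size≡ row≡ row≤ refl) v≡ v<n small =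
        run-if≤ evN evR′
          (λ l → weaken (s≤s z≤n) (run-set ev0 evV evL
            (_ , ((inj₁ refl , ≼-refl (A i) _ , inj₁ l)) , refl)))
          (λ r<n → run-if≤ evN evL
            (λ l → weaken (s≤s z≤n) (run-set ev0 evV evR′
              (_ , (inj₂ refl , inj₁ l , ≼-refl (A i) _) , refl)))
            (λ l<n → run-ifᶠ (ev-real evI evL refl) (ev-real evI evR′ refl)
              (λ p → run-set ev0 evV evL (_ , (inj₁ refl , ≼-refl (A i) _ , inj₂ (l<n , p)) , refl))
              (λ p → run-set ev0 evV evR′ (_ , (inj₂ refl , inj₂ (r<n , flip p) , ≼-refl (A i) _) ,
                refl))))
        where
        flip : ∀ {a b} → ¬ a ≤ᶠ b → b ≤ᶠ a
        flip {a} {b} p with total a b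
        ... | inj₁ q = ⊥-elim (p q)
        ... | inj₂ q = q
        ev0 : Ev s (lit 0) 0
        ev0 = ev-lit z≤n
        evN : Ev s (var 0) n
        evN = ev-var size≡ (n≤M ≤-refl)
        evI : Ev s (var 9) i
        evI = ev-var row≡ (n≤M row≤)
        evV : Ev s (var 12) v
        evV = ev-var v≡ (n≤M (<⇒≤ v<n))
        ev2v : Ev s (lit 2 ⊗ var 12) (2 * v)
        ev2v = ev-⊗ (ev-lit (2n≤M (*-monoʳ-≤ 2 (s≤s (z≤n {n}))))) evV
          (2n≤M (*-monoʳ-≤ 2 (<⇒≤ (m<n⇒m<1+n v<n))))
        evL : Ev s leftChild (words s 13 0 (2 * v))
        evL = ev-word ev0 ev2v refl (n≤M (small _ (even<double v<n)))
        evR′ : Ev s rightChild (words s 13 0 (suc (2 * v)))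
        evR′ = ev-word ev0 (ev-⊕ (ev-lit (n≤M 1≤n)) ev2v (<⇒≤ (2n<M (<⇒≤ (odd<double v<n))))) refl
          (n≤M (small _ (odd<double v<n)))

      Replayed : State → State → Set
      Replayed s s′ = AllBut (A i) 0 (words s′ 13 0) × Small (words s′ 13 0) ×
                      (∀ x → n ≤ x → words s′ 13 0 x ≡ words s 13 0 x)

      -- Each round halves the index of the stale match, so k rounds reach 0. A round costs 6: the
      -- test, at most 4 steps for the match, and the halving. Only nodes below n are rewritten,
      -- hence the leaves are kept.
      run-replay : ∀ k v s → BaseOf i s → words s 12 0 0 ≡ v → v < n → v < 2 ^ k →
        Small (words s 13 0) → AllBut (A i) v (words s 13 0) →
        Run replay s (suc (k * 6)) (Replayed s)
      run-replay k v s₀ b v≡ v<n v<2^k small₀ all₀ =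
        run-while I s₀ step k (v , v≡ , v<n , v<2^k , small₀ , all₀ , λ _ _ → refl)
        where
        W = play ⨾ setWord 12 (lit 0) (lit 0) (var 12 ⊘ lit 2)
        I : ℕ → State → Set
        I k s = ∃[ v ] (words s 12 0 0 ≡ v × v < n × v < 2 ^ k × Small (words s 13 0) ×
                        AllBut (A i) v (words s 13 0) ×
                          (∀ x → n ≤ x → words s 13 0 x ≡ words s₀ 13 0 x))
        next : ∀ k s v w → v ≢ 0 → v < n → v < 2 ^ suc k → Small (words s 13 0) →
          AllBut (A i) v (words s 13 0) →
          (∀ x → n ≤ x → words s 13 0 x ≡ words s₀ 13 0 x) →
          Winner (A i) w (words s 13 0 (2 * v)) (words s 13 0 (suc (2 * v))) →
          I k (put (put s 13 0 v w) 12 0 0 (v / 2))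
        next k s v w v≢0 v<n v<2^k small all same win =
          v / 2 , refl , <-trans (half<self 1≤v) v<n , half< {v} v<2^k , small′ ,
          match-replayed (A i) 1≤v changed (subst (λ z → Winner (A i) z _ _) (sym new) win) all ,
          λ x l → trans (changed x (λ e → <⇒≱ v<n (subst (n ≤_) e l))) (same x l)
          where
          1≤v = n≢0⇒n>0 v≢0
          tr′ = words (put s 13 0 v w) 13 0
          new : tr′ v ≡ w
          new = update-same (words s) 13 0 v w
          changed : Changed (A i) v (words s 13 0) tr′
          changed y ne = update-cell (words s) 13 0 v w 0 y (λ q → ne (sym (proj₂ q)))
          winner≤n : w ≡ words s 13 0 (2 * v) ⊎ w ≡ words s 13 0 (suc (2 * v)) → w ≤ n
          winner≤n (inj₁ e) = ≤-trans (≤-reflexive e) (small _ (even<double v<n))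
          winner≤n (inj₂ e) = ≤-trans (≤-reflexive e) (small _ (odd<double v<n))
          small′ : Small tr′
          small′ y l with y ≟ v
          ... | no ne = ≤-trans (≤-reflexive (changed y ne)) (small y l)
          ... | yes refl = ≤-trans (≤-reflexive new) (winner≤n (proj₁ win))
        step : ∀ k s → Agree W s₀ s → I k s →
          ValidTest M s (lit 1 ≤ʷ var 12) ×
          ((evalTest s (lit 1 ≤ʷ var 12) ≡ false × Replayed s₀ s) ⊎
           (evalTest s (lit 1 ≤ʷ var 12) ≡ true × ∃[ k′ ] (k ≡ suc k′ × Run W s 5 (I k′))))
        step k s ag (v , v≡ , v<n , v<2^k , small , all , same) =
          (n≤M 1≤n , z≤n , z≤n , ≤-trans (≤-reflexive v≡) (n≤M (<⇒≤ v<n))) ,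
            cases v k v≡ v<n v<2^k all
          where
          test≡ : ∀ {v} → words s 12 0 0 ≡ v → evalTest s (lit 1 ≤ʷ var 12) ≡ does (1 ≤? v)
          test≡ = cong (λ z → does (1 ≤? z))
          cases : ∀ v k → words s 12 0 0 ≡ v → v < n → v < 2 ^ k → AllBut (A i) v (words s 13 0) →
            (evalTest s (lit 1 ≤ʷ var 12) ≡ false × Replayed s₀ s) ⊎
            (evalTest s (lit 1 ≤ʷ var 12) ≡ true × ∃[ k′ ] (k ≡ suc k′ × Run W s 5 (I k′)))
          cases zero    k       e _ _ all = inj₁ (test≡ e , all , small , same)
          cases (suc v) zero    e _ (s≤s ()) _
          cases (suc v) (suc k) e l m all =
            inj₂ (test≡ e , k , refl ,
              (run-play s (suc v) (base-agree {P = W} ag refl refl b) e l small >>>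
                λ { s′ _ (w , win , refl) →
                run-set (ev-lit z≤n) (ev-lit z≤n)
                  (ev-⊘ (ev-var e (n≤M (<⇒≤ l))) (ev-lit (2n≤M (*-monoʳ-≤ 2 (s≤s (z≤n {n}))))))
                  (next k s (suc v) w (λ ()) l m small all same win) }))

    order-cong : ∀ {key ord rank ord′ rank′} → (∀ q → ord′ q ≡ ord q) → (∀ k → rank′ k ≡ rank k) →
                 Order key ord rank → Order key ord′ rank′
    order-cong {key} {ord} {rank} {ord′} {rank′} f g o = record
      { ord<     = λ {q} l → subst (_< n) (sym (f q)) (Order.ord< o l)
      ; rank<    = λ {k} l → subst (_< n) (sym (g k)) (Order.rank< o l)
      ; ord-rank = λ {k} l → trans (f (rank′ k)) (trans (cong ord (g k)) (Order.ord-rank o l))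
      ; mono     = λ {q} {r} l m → subst₂ (λ a b → key a ≤ᶠ key b) (sym (f q)) (sym (f r))
        (Order.mono o l m)
      }

    module _ (Q : ℕ) (n<2^Q : n < 2 ^ Q) where
      ev-n : ∀ {i s} → BaseOf i s → Ev s (var 0) n
      ev-n b = ev-var (Base.size≡ b) (n≤M ≤-refl)

      ev-2n : ∀ {i s} → BaseOf i s → Ev s (lit 2 ⊗ var 0) (2 * n)
      ev-2n b = ev-⊗ (ev-lit (2n≤M (*-monoʳ-≤ 2 (s≤s (z≤n {n}))))) (ev-n b) (<⇒≤ (2n<M ≤-refl))

      n+x<2n : ∀ {x} → x < n → n + x < 2 * n
      n+x<2n l = ≤-trans (+-monoʳ-< n l) (≤-reflexive (sym (2n≡n+n n)))

      n+x≤M : ∀ {x} → x < n → n + x ≤ M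
      n+x≤M l = <⇒≤ (2n<M (<⇒≤ (n+x<2n l)))

      leaf-parent : ∀ {x} → x < n → (n + x) / 2 < n
      leaf-parent l = half< (n+x<2n l)

      n<M : n < M
      n<M = 2n<M (m≤m+n n _)

      ev-leaf-parent : ∀ {s e x} → Ev s e (n + x) → Ev s (e ⊘ lit 2) ((n + x) / 2)
      ev-leaf-parent e = ev-⊘ e (ev-lit (2n≤M (*-monoʳ-≤ 2 (s≤s (z≤n {n})))))

      run-clear : ∀ i s → BaseOf i s → Run clear s (forCost (2 * n) 1)
        (λ s′ → ∀ v → v < 2 * n → words s′ 13 0 v ≡ n)
      run-clear i s₀ b = run-for (λ x s → ∀ v → v < x → words s 13 0 v ≡ n) s₀ (2n<M ≤-refl) refl
        (λ _ _ _ h → h) (λ x s ag _ → ev-2n (base-agree {P = clear} ag refl refl b))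
        (λ x s x<2n ag x≡ h → run-set (ev-lit z≤n) (ev-var x≡ (<⇒≤ (2n<M (<⇒≤ x<2n))))
          (ev-n (base-agree {P = clear} ag refl refl b))
          (next x s h))
        (λ _ ())
        where
        next : ∀ x s → (∀ v → v < x → words s 13 0 v ≡ n) → ∀ v → v < suc x →
          words (put s 13 0 x n) 13 0 v ≡ n
        next x s h v (s≤s l) with v ≟ x
        ... | yes refl = update-same (words s) 13 0 v n
        ... | no  ne   = trans (update-cell (words s) 13 0 x n 0 v (λ q → ne (sym (proj₂ q))))
          (h v (≤∧≢⇒< l ne))

      record Inserted (i x : ℕ) (tr : ℕ → ℕ) : Set where
        constructor inserted
        field
          tournament : AllBut (A i) 0 tr
          small      : Small tr
          present    : ∀ k → k < x → tr (n + k) ≡ k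
          absent     : ∀ k → x ≤ k → k < n → tr (n + k) ≡ n

      -- The cleared tree is already a sound tournament, one among absent players. So an insertion
      -- is treated like a removal: change a leaf, then replay from its parent.
      run-insert : ∀ i s → BaseOf i s → (∀ v → v < 2 * n → words s 13 0 v ≡ n) →
        Run insert s (forCost n (3 + Q * 6)) (λ s′ → Inserted i n (words s′ 13 0))
      run-insert i s₀ b h = run-for (λ x s → Inserted i x (words s 13 0)) s₀ n<M refl
        (λ _ _ _ h → h)
        (λ x s ag _ → ev-n (base-agree {P = insert} ag refl refl b))
        body
        (inserted
          (λ u _ u<n _ → allWin u u<n)
          (λ v l → ≤-reflexive (h v l)) (λ _ ()) (λ k _ l → h (n + k) (n+x<2n l)))
        where
        allWin : ∀ u → u < n → Local (A i) (words s₀ 13 0) u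
        allWin u u<n rewrite h u (≤-trans u<n (m≤m+n n _)) | h (2 * u) (even<double u<n) | h
          (suc (2 * u)) (odd<double u<n) =
          inj₁ refl , inj₁ ≤-refl , inj₁ ≤-refl
        body : ∀ x s → x < n → Agree insert s₀ s → words s 10 0 0 ≡ x →
          Inserted i x (words s 13 0) →
          Run insertStep s (3 + Q * 6) (λ s′ → Inserted i (suc x) (words s′ 13 0))
        body x s x<n ag x≡ (inserted tour small pres abs) =
          run-set⨾ (ev-lit z≤n) evLeaf evX
            (run-set⨾ (ev-lit z≤n) (ev-lit z≤n)
              (ev-leaf-parent (ev-⊕ (ev-var {x = 0} (Base.size≡ bs) (n≤M ≤-refl))
                (ev-var {x = 10} x≡ (<⇒≤ (<-trans x<n n<M))) (n+x≤M x<n)))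
              (conseq post (run-replay i Q ((n + x) / 2) s₂ bs₂ refl (leaf-parent x<n)
                (<-trans (leaf-parent x<n) n<2^Q) small₁
                (leaf-changed (A i) (m≤m+n n x) changed tour))))
          where
          bs = base-agree {P = insert} ag refl refl b
          s₂ = put (put s 13 0 (n + x) x) 12 0 0 ((n + x) / 2)
          bs₂ : BaseOf i s₂
          bs₂ = base (Base.size≡ bs) (Base.row≡ bs) (Base.row≤ bs) (Base.keys≡ bs)
          evX : Ev s (var 10) x
          evX = ev-var x≡ (<⇒≤ (<-trans x<n n<M))
          evLeaf : Ev s (var 0 ⊕ var 10) (n + x)
          evLeaf = ev-⊕ (ev-n bs) evX (n+x≤M x<n)
          changed : Changed (A i) (n + x) (words s 13 0) (words s₂ 13 0)
          changed y ne = update-cell (words s) 13 0 (n + x) x 0 y (λ q → ne (sym (proj₂ q)))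
          new : words s₂ 13 0 (n + x) ≡ x
          new = update-same (words s) 13 0 (n + x) x
          small₁ : Small (words s₂ 13 0)
          small₁ v l with v ≟ n + x
          ... | yes refl = ≤-trans (≤-reflexive new) (<⇒≤ x<n)
          ... | no ne = ≤-trans (≤-reflexive (changed v ne)) (small v l)
          post : ∀ s′ → Agree replay s₂ s′ → Replayed i s₂ s′ → Inserted i (suc x) (words s′ 13 0)
          post s′ _ (all , sm , same) = inserted all sm pres′ abs′
            where
            pres′ : ∀ k → k < suc x → words s′ 13 0 (n + k) ≡ k
            pres′ k (s≤s l) with k ≟ x
            ... | yes refl = trans (same (n + k) (m≤m+n n k)) new
            ... | no ne = trans (same (n + k) (m≤m+n n k))
              (trans (changed (n + k) (λ e → ne (+-cancelˡ-≡ n _ _ e))) (pres k (≤∧≢⇒< l ne)))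
            abs′ : ∀ k → suc x ≤ k → k < n → words s′ 13 0 (n + k) ≡ n
            abs′ k l m = trans (same (n + k) (m≤m+n n k))
              (trans (changed (n + k) (λ e → <⇒≢ l (sym (+-cancelˡ-≡ n _ _ e)))) (abs k (<⇒≤ l) m))

      -- All rows share arrays 14 and 15, so `Agree`, which speaks of whole arrays, cannot protect
      -- the orders of the rows sorted before.
      OtherRows : ℕ → State → State → Set
      OtherRows i s s′ = ∀ j → j ≢ i → (∀ q → words s′ 14 j q ≡ words s 14 j q) ×
        (∀ k → words s′ 15 j k ≡ words s 15 j k)

      run-extract : ∀ i s → i < n → BaseOf i s → Inserted i n (words s 13 0) →
        Run extract s (forCost n (6 + Q * 6)) (λ s′ → Order (A i) (words s′ 14 i) (words s′ 15 i) ×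
          OtherRows i s s′)
      run-extract i s₀ i<n b (inserted tour₀ small₀ pres₀ _) =
        conseq (λ s′ _ (S , _ , o) → sorted-order (A i) S , o)
          (run-for I s₀ n<M refl (λ _ _ _ h → h)
            (λ x s ag _ → ev-n (base-agree {P = extract} ag refl refl b)) body
            (record
              { tournament = tour₀ ; leaves = λ {k} l → inj₁ (pres₀ k l) ; ord< =
                λ () ; rank-ord = λ ()
              ; removed = λ () ; mono = λ _ () ; below = λ () } ,
             small₀ , λ _ _ → (λ _ → refl) , (λ _ → refl)))
        where
        I : ℕ → State → Set
        I x s = Sorted (A i) x (words s 13 0) (words s 14 i) (words s 15 i) × Small (words s 13 0) ×
          OtherRows i s₀ s
        body : ∀ x s → x < n → Agree extract s₀ s → words s 10 0 0 ≡ x → I x s →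
          Run extractStep s (6 + Q * 6) (I (suc x))
        body x s x<n ag x≡ (S , small , others) =
          run-set⨾ evI evX evRoot
            (run-set⨾ (ev-var (Base.row≡ bs) (n≤M (<⇒≤ i<n)))
              (ev-word (ev-lit z≤n) (ev-lit (n≤M 1≤n)) refl r≤M) (ev-var {x = 10} x≡ x≤M)
            (run-set⨾ (ev-lit z≤n) (ev-lit z≤n)
              (ev-⊕ (ev-var {x = 0} (Base.size≡ bs) (n≤M ≤-refl))
                (ev-word (ev-lit z≤n) (ev-lit (n≤M 1≤n)) refl r≤M) (n+x≤M r<n))
            (run-set⨾ (ev-lit z≤n) (ev-var {x = 16} refl (n+x≤M r<n))
              (ev-var {x = 0} (Base.size≡ bs) (n≤M ≤-refl))
            (run-set⨾ (ev-lit z≤n) (ev-lit z≤n) (ev-leaf-parent (ev-var {x = 16} refl (n+x≤M r<n)))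
            (conseq post (run-replay i Q ((n + r) / 2) s₅ bs₅ refl (leaf-parent r<n)
              (<-trans (leaf-parent r<n) n<2^Q) small₁
                (leaf-changed (A i) (m≤m+n n r) changed (Sorted.tournament S))))))))
          where
          bs = base-agree {P = extract} ag refl refl b
          r = words s 13 0 1
          r<n = proj₁ (root-present (A i) S x<n)
          r≤M = n≤M (<⇒≤ r<n)
          x≤M = n≤M (<⇒≤ x<n)
          evI : Ev s (var 9) i
          evI = ev-var (Base.row≡ bs) (n≤M (<⇒≤ i<n))
          evX : Ev s (var 10) x
          evX = ev-var x≡ x≤M
          evRoot : Ev s root r
          evRoot = ev-word (ev-lit z≤n) (ev-lit (n≤M 1≤n)) refl r≤M
          s₂ = put (put s 14 i x r) 15 i r x
          s₄ = put (put s₂ 16 0 0 (n + r)) 13 0 (n + r) n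
          s₅ = put s₄ 12 0 0 ((n + r) / 2)
          bs₅ : BaseOf i s₅
          bs₅ = base (Base.size≡ bs) (Base.row≡ bs) (Base.row≤ bs) (Base.keys≡ bs)
          changed : Changed (A i) (n + r) (words s 13 0) (words s₅ 13 0)
          changed y ne = update-cell (words s) 13 0 (n + r) n 0 y (λ q → ne (sym (proj₂ q)))
          new : words s₅ 13 0 (n + r) ≡ n
          new = update-same (words s) 13 0 (n + r) n
          small₁ : Small (words s₅ 13 0)
          small₁ v l with v ≟ n + r
          ... | yes refl = ≤-reflexive new
          ... | no ne = ≤-trans (≤-reflexive (changed v ne)) (small v l)
          post : ∀ s′ → Agree replay s₅ s′ → Replayed i s₅ s′ → I (suc x) s′
          post s′ ag′ (all , sm , same) rewrite proj₁ (ag′ 14 refl) | proj₁ (ag′ 15 refl) =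
            sorted-step (A i) S x<n all (trans (same (n + r) (m≤m+n n r)) new)
              (λ {k} ne → trans (same (n + k) (m≤m+n n k))
                (changed (n + k) (λ e → ne (+-cancelˡ-≡ n _ _ e))))
              (update-same (words s) 14 i x r)
                (λ {q} ne → update-cell (words s) 14 i x r i q (λ p → ne (sym (proj₂ p))))
              (update-same (words s) 15 i r x)
                (λ {k} ne → update-cell (words s) 15 i r x i k (λ p → ne (sym (proj₂ p)))) ,
            sm ,
            λ j ne → (λ q → trans (update-cell (words s) 14 i x r j q (λ p → ne (sym (proj₁ p))))
              (proj₁ (others j ne) q)) ,
                     (λ k → trans (update-cell (words s) 15 i r x j k (λ p → ne (sym (proj₁ p))))
                       (proj₂ (others j ne) k))

      rowCost : ℕ
      rowCost = forCost (2 * n) 1 + (forCost n (3 + Q * 6) + forCost n (6 + Q * 6))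

      run-sortRows : ∀ s → words s 0 0 0 ≡ n → reals s 0 ≡ A →
        Run sortRows s (forCost n rowCost) (λ s′ → ∀ i → i < n →
          Order (A i) (words s′ 14 i) (words s′ 15 i))
      run-sortRows s₀ n≡ A≡ =
        run-for (λ x s → ∀ i → i < x → Order (A i) (words s 14 i) (words s 15 i)) s₀ n<M refl
          (λ _ _ _ h → h)
          (λ i s ag _ → ev-var (keep {sortRows} ag 0 refl n≡) (n≤M ≤-refl)) body (λ _ ())
        where
        body : ∀ x s → x < n → Agree sortRows s₀ s → words s 9 0 0 ≡ x →
          (∀ i → i < x → Order (A i) (words s 14 i) (words s 15 i)) →
          Run sortRow s rowCost (λ s′ → ∀ i → i < suc x →
            Order (A i) (words s′ 14 i) (words s′ 15 i))
        body x s x<n ag x≡ h =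
          run-clear x s b >>> λ s₁ ag₁ h₁ →
          run-insert x s₁ (base-agree {P = clear} ag₁ refl refl b) h₁ >>> λ s₂ ag₂ h₂ →
          conseq (λ s′ _ (o , others) i l → post s₁ s₂ s′ ag₁ ag₂ o others i l)
            (run-extract x s₂ x<n (base-agree {P = insert} ag₂ refl refl
              (base-agree {P = clear} ag₁ refl refl b)) h₂)
          where
          b : BaseOf x s
          b = base (keep {sortRows} ag 0 refl n≡) x≡ (<⇒≤ x<n) (trans (proj₂ (ag 0 refl)) A≡)
          post : ∀ s₁ s₂ s′ → Agree clear s s₁ → Agree insert s₁ s₂ →
            Order (A x) (words s′ 14 x) (words s′ 15 x) →
            OtherRows x s₂ s′ → ∀ i → i < suc x → Order (A i) (words s′ 14 i) (words s′ 15 i)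
          post s₁ s₂ s′ ag₁ ag₂ o others i (s≤s l) with i ≟ x
          ... | yes refl = o
          ... | no ne = order-cong
            (λ q → trans (proj₁ (others i ne) q)
              (cong (λ f → f i q) (trans (proj₁ (ag₂ 14 refl)) (proj₁ (ag₁ 14 refl)))))
            (λ k → trans (proj₂ (others i ne) k)
              (cong (λ f → f i k) (trans (proj₁ (ag₂ 15 refl)) (proj₁ (ag₁ 15 refl)))))
            (h i (≤∧≢⇒< l ne))

  -- Computing the bucket size

  n<2^n : ∀ n → n < 2 ^ n
  n<2^n zero    = s≤s z≤n
  n<2^n (suc n) = ≤-trans (s≤s (n<2^n n))
    (≤-trans (+-monoˡ-≤ (2 ^ n) (m^n>0 2 n)) (≤-reflexive (sym (2n≡n+n (2 ^ n)))))

  module OrderedField (F : CompleteOrderedField) where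
    private module R = CompleteOrderedField F
    open R using (_≈_; 0#; fromℕ; _⁻¹; total; *-congˡ)
      renaming (_≤_ to _≤ᶠ_; _*_ to _*ᶠ_; trans to ≈-trans; sym to ≈-sym; refl to ≈-refl)
    open RealPower F using (≤-resp₂; 0≤fromℕ; fromℕ-cancel-≤)
      renaming (*-monoˡ-≤ to *ᶠ-monoˡ-≤)

    fromℕ≉0 : ∀ {q} → 1 ≤ q → ¬ fromℕ q ≈ 0#
    fromℕ≉0 l e = <⇒≱ l (fromℕ-cancel-≤ (≤-resp₂ (≈-sym e) ≈-refl R.≤-refl))

    x*y⁻¹*y : ∀ {q} → 1 ≤ q → ∀ x → (x *ᶠ fromℕ q ⁻¹) *ᶠ fromℕ q ≈ x
    x*y⁻¹*y {q} l x = ≈-trans (R.*-assoc x _ _)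
      (≈-trans (*-congˡ (≈-trans (R.*-comm _ _) (R.⁻¹-inverseʳ (fromℕ q) (fromℕ≉0 l))))
        (R.*-identityʳ x))

    ≤-ratio : ∀ {q t x} → 1 ≤ q → t ≤ᶠ x *ᶠ fromℕ q ⁻¹ → t *ᶠ fromℕ q ≤ᶠ x
    ≤-ratio {q} l h = ≤-resp₂ ≈-refl (x*y⁻¹*y l _) (*ᶠ-monoˡ-≤ (0≤fromℕ q) h)

    ≰-ratio : ∀ {q t x} → 1 ≤ q → ¬ t ≤ᶠ x *ᶠ fromℕ q ⁻¹ → x ≤ᶠ t *ᶠ fromℕ q
    ≰-ratio {q} {t} {x} l h with total t (x *ᶠ fromℕ q ⁻¹)
    ... | inj₁ g = ⊥-elim (h g)
    ... | inj₂ g = ≤-resp₂ (x*y⁻¹*y l x) ≈-refl (*ᶠ-monoˡ-≤ (0≤fromℕ q) g)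

  module Setup (F : CompleteOrderedField) (t : CompleteOrderedField.Carrier F)
               (M n : ℕ) (1≤n : 1 ≤ n) (fits : 4 * (suc n * suc n) ≤ M) where
    open CompleteOrderedField F using (0#; 1#; zeroˡ; fromℕ; _⁻¹; ⁻¹-inverseʳ)
      renaming (_≤_ to _≤ᶠ_; _*_ to _*ᶠ_; _≤?_ to _≤ᶠ?_; sym to ≈-sym; refl to ≈-refl)
    open RealPower F using (≤-resp₂; 0≤fromℕ) renaming (*-monoˡ-≤ to *ᶠ-monoˡ-≤)
    open OrderedField F
    open Machine F
    open Execution F
    open Algorithm F
    open Hoare F M
    open Sort F M n 1≤n fits (λ _ _ → t) using (n≤M; 2n<M)

    -- The bucket size will be 2 ^ m, where m is the least number with t ≤ m / Q.
    record Params (Q m : ℕ) : Set where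
      field
        {L}   : ℕ
        Q≡    : Q ≡ suc L
        2^L≤n : 2 ^ L ≤ n
        n<2^Q : n < 2 ^ Q
        m≤Q   : m ≤ Q
        lower : t *ᶠ fromℕ Q ≤ᶠ fromℕ m
        upper : fromℕ (pred m) ≤ᶠ t *ᶠ fromℕ Q

    private
      1≤M : 1 ≤ M
      1≤M = n≤M 1≤n
      0∈ : ∀ {s} → Ev s (lit 0) 0
      0∈ = ev-lit z≤n
      1∈ : ∀ {s} → Ev s (lit 1) 1
      1∈ = ev-lit 1≤M

    -- The bound of n rounds, from q < 2^q ≤ n, is crude but far within the budget. The invariant
    -- `2 ^ q ≤ 2 * n` ensures that the last doubling does not overflow.
    run-findQ : ∀ s → words s 0 0 0 ≡ n → Run findQ s (3 + n * 3)
      (λ s′ → ∃[ L ] (words s′ 6 0 0 ≡ suc L × 2 ^ L ≤ n × n < 2 ^ suc L))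
    run-findQ s₀ n≡ =
      run-set⨾ 0∈ 0∈ 0∈ (run-set⨾ 0∈ 0∈ 1∈
        (run-while I s₁ step n (0 , refl , refl , refl , ≤-trans 1≤n (m≤m+n n _) , λ ())))
      where
      s₁ = put (put s₀ 6 0 0 0) 8 0 0 1
      W = setWord 8 (lit 0) (lit 0) (var 8 ⊕ var 8) ⨾ setWord 6 (lit 0) (lit 0) (var 6 ⊕ lit 1)
      I : ℕ → State → Set
      I k s = ∃[ q ] (q + k ≡ n × words s 6 0 0 ≡ q × words s 8 0 0 ≡ 2 ^ q × 2 ^ q ≤ 2 * n ×
                      (∀ {l} → q ≡ suc l → 2 ^ l ≤ n))
      step : ∀ k s → Agree W s₁ s → I k s → _
      step k s ag (q , eq , q≡ , w≡ , w≤ , low) with Ev.valid evW | keep {W} ag 0 refl n≡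
        where
        evW : Ev s (var 8) (2 ^ q)
        evW = ev-var w≡ (<⇒≤ (2n<M w≤))
      ... | v | n≡′ = (v , z≤n , z≤n , ≤-trans (≤-reflexive n≡′) (n≤M ≤-refl)) ,
        cases k eq (2 ^ q ≤? n)
        where
        test≡ : evalTest s (var 8 ≤ʷ var 0) ≡ does (2 ^ q ≤? n)
        test≡ = cong₂ (λ a b → does (a ≤? b)) w≡ n≡′
        exit : ∀ q → words s 6 0 0 ≡ q → n < 2 ^ q → (∀ {l} → q ≡ suc l → 2 ^ l ≤ n) →
               ∃[ L ] (words s 6 0 0 ≡ suc L × 2 ^ L ≤ n × n < 2 ^ suc L)
        exit zero    e l _   = ⊥-elim (<⇒≱ l 1≤n)
        exit (suc q) e l low = q , e , low refl , l
        cases : ∀ k → q + k ≡ n → _ →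
          (evalTest s (var 8 ≤ʷ var 0) ≡ false ×
            ∃[ L ] (words s 6 0 0 ≡ suc L × 2 ^ L ≤ n × n < 2 ^ suc L)) ⊎
          (evalTest s (var 8 ≤ʷ var 0) ≡ true × ∃[ k′ ] (k ≡ suc k′ × Run W s 2 (I k′)))
        cases k eq (no p) = inj₁ (trans test≡ (dec-false (2 ^ q ≤? n) p) , exit q q≡ (≰⇒> p) low)
        cases zero eq (yes p) = ⊥-elim
          (<⇒≱ (n<2^n q) (≤-trans p (≤-reflexive (trans (sym eq) (+-identityʳ q)))))
        cases (suc k) eq (yes p) = inj₂ (trans test≡ (dec-true (2 ^ q ≤? n) p) , k , refl ,
          run-set⨾ 0∈ 0∈ (ev-⊕ (ev-var w≡ (n≤M p)) (ev-var w≡ (n≤M p))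
            (≤-trans (≤-reflexive (sym (2n≡n+n (2 ^ q)))) (<⇒≤ (2n<M double))))
            (run-set 0∈ 0∈ (ev-⊕ (ev-var {x = 6} q≡ (n≤M (<⇒≤ q<n))) 1∈
              (n≤M (≤-trans (≤-reflexive (+-comm q 1)) q<n)))
              (suc q , trans (sym (+-suc q k)) eq , +-comm q 1 , sym (2n≡n+n (2 ^ q)) , double ,
                λ { refl → p })))
          where
          double = *-monoʳ-≤ 2 p
          q<n = <-≤-trans (n<2^n q) p

    -- Success of the final test gives `lower`, and failure of the test before it gives `upper`. If
    -- the first test succeeds, then m = 0 and `upper` follows from 0 ≤ t, as `pred 0` is 0.
    run-findM : 0# ≤ᶠ t → t ≤ᶠ 1# → ∀ L s → 2 ^ L ≤ n → n < 2 ^ suc L → words s 6 0 0 ≡ suc L →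
      Run (findM t) s (3 + (2 * n) * 3) (λ s′ → ∃[ m ] (words s′ 3 0 0 ≡ 2 ^ m × Params (suc L) m))
    run-findM 0≤t t≤1 L s₀ 2^L≤n n<2^Q Q≡ =
      weaken (+-monoʳ-≤ 3 (*-monoˡ-≤ 3 Q≤2n)) (run-set⨾ 0∈ 0∈ 0∈ (run-set⨾ 0∈ 0∈ 1∈
        (run-while I s₁ step Q (0 , refl , refl , refl ,
          ≤-resp₂ (zeroˡ _) ≈-refl (*ᶠ-monoˡ-≤ (0≤fromℕ Q) 0≤t)))))
      where
      Q = suc L
      s₁ = put (put s₀ 7 0 0 0) 3 0 0 1
      W = setWord 3 (lit 0) (lit 0) (var 3 ⊕ var 3) ⨾ setWord 7 (lit 0) (lit 0) (var 7 ⊕ lit 1)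
      b = negate (const t ≤ʳ ratio (var 7) (var 6))
      I : ℕ → State → Set
      I k s = ∃[ m ] (m + k ≡ Q × words s 7 0 0 ≡ m × words s 3 0 0 ≡ 2 ^ m ×
        fromℕ (pred m) ≤ᶠ t *ᶠ fromℕ Q)
      Q≤2n : Q ≤ 2 * n
      Q≤2n = ≤-trans (<⇒≤ (n<2^n Q)) (*-monoʳ-≤ 2 2^L≤n)
      Q≤M = <⇒≤ (2n<M Q≤2n)
      step : ∀ k s → Agree W s₁ s → I k s →
        ValidTest M s b × ((evalTest s b ≡ false × ∃[ m ] (words s 3 0 0 ≡ 2 ^ m × Params Q m)) ⊎
                           (evalTest s b ≡ true × ∃[ k′ ] (k ≡ suc k′ × Run W s 2 (I k′))))
      step k s ag (m , eq , m≡ , w≡ , up) =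
        (tt , (z≤n , z≤n , ≤-trans (≤-reflexive m≡) (≤-trans m≤Q Q≤M)) ,
          (z≤n , z≤n , ≤-trans (≤-reflexive Q≡′) Q≤M) , λ z → 1+n≢0 (trans (sym Q≡′) z)) ,
        cases k eq (t ≤ᶠ? fromℕ m *ᶠ fromℕ Q ⁻¹)
        where
        Q≡′ = keep {W} ag 6 refl Q≡
        m≤Q = ≤-trans (m≤m+n m k) (≤-reflexive eq)
        test≡ : evalTest s b ≡ not (does (t ≤ᶠ? fromℕ m *ᶠ fromℕ Q ⁻¹))
        test≡ = cong₂ (λ x y → not (does (t ≤ᶠ? fromℕ x *ᶠ fromℕ y ⁻¹))) m≡ Q≡′
        cases : ∀ k → m + k ≡ Q → _ →
          (evalTest s b ≡ false × ∃[ m ] (words s 3 0 0 ≡ 2 ^ m × Params Q m)) ⊎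
          (evalTest s b ≡ true × ∃[ k′ ] (k ≡ suc k′ × Run W s 2 (I k′)))
        cases k eq (yes p) = inj₁ (trans test≡ (cong not (dec-true (t ≤ᶠ? _) p)) , m , w≡ , record
          { Q≡ = refl ; 2^L≤n = 2^L≤n ; n<2^Q = n<2^Q ; m≤Q = m≤Q ; lower =
            ≤-ratio {Q} (s≤s z≤n) p ; upper = up })
        -- At m = Q the quotient is 1, so t ≤ 1 forces the loop to stop.
        cases zero eq (no p) with trans (sym (+-identityʳ m)) eq
        ... | refl = ⊥-elim (p (≤-resp₂ ≈-refl
          (≈-sym (⁻¹-inverseʳ (fromℕ Q) (fromℕ≉0 {Q} (s≤s z≤n)))) t≤1))
        cases (suc k) eq (no p) = inj₂ (trans test≡ (cong not (dec-false (t ≤ᶠ? _) p)) , k , refl ,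
          run-set⨾ 0∈ 0∈ (ev-⊕ ev3 ev3
            (≤-trans (≤-reflexive (sym (2n≡n+n (2 ^ m)))) (<⇒≤ (2n<M 2^Sm≤))))
            (run-set 0∈ 0∈ (ev-⊕ (ev-var {x = 7} m≡ (≤-trans m≤Q Q≤M)) 1∈
              (≤-trans (≤-reflexive (+-comm m 1)) (≤-trans m<Q Q≤M)))
              (suc m , trans (sym (+-suc m k)) eq , +-comm m 1 , sym (2n≡n+n (2 ^ m)) ,
                ≰-ratio {Q} (s≤s z≤n) p)))
          where
          m<Q : m < Q
          m<Q = ≤-trans (s≤s (m≤m+n m k)) (≤-reflexive (trans (sym (+-suc m k)) eq))
          2^Sm≤ : 2 ^ suc m ≤ 2 * n
          2^Sm≤ = ≤-trans (^-monoʳ-≤ 2 m<Q) (*-monoʳ-≤ 2 2^L≤n)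
          ev3 : Ev s (var 3) (2 ^ m)
          ev3 = ev-var w≡ (≤-trans (m≤m+n (2 ^ m) _) (<⇒≤ (2n<M 2^Sm≤)))

    run-setup : 0# ≤ᶠ t → t ≤ᶠ 1# → ∀ s → words s 0 0 0 ≡ n →
      Run (setup t) s (3 + n * 3 + (3 + (2 * n) * 3 + 1))
        (λ s′ → ∃[ Q ] ∃[ m ] (Params Q m × words s′ 3 0 0 ≡ 2 ^ m ×
                                    words s′ 4 0 0 ≡ _/_ n (2 ^ m) {{m^n≢0 2 m}}))
    run-setup 0≤t t≤1 s n≡ =
      run-findQ s n≡ >>> λ { s₁ ag₁ (L , Q≡ , lo , hi) →
       run-findM 0≤t t≤1 L s₁ lo hi Q≡ >>> λ { s₂ ag₂ (m , sz≡ , ps) →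
       run-set 0∈ 0∈ (ev-⊘ {{m^n≢0 2 m}}
         (ev-var (keep {findM t} ag₂ 0 refl (keep {findQ} ag₁ 0 refl n≡)) (n≤M ≤-refl))
                       (ev-var sz≡ (≤-trans (^-monoʳ-≤ 2 (Params.m≤Q ps))
                         (<⇒≤ (2n<M (*-monoʳ-≤ 2 lo))))))
         (suc L , m , ps , sz≡ , refl) } }

  -- From powers of two to real powers of n

  ^-distribʳ-* : ∀ k a b → (a * b) ^ k ≡ a ^ k * b ^ k
  ^-distribʳ-* zero    a b = refl
  ^-distribʳ-* (suc k) a b = trans (cong (a * b *_) (^-distribʳ-* k a b))
    ([m*n]*[o*p]≡[m*o]*[n*p] a b (a ^ k) (b ^ k))

  n^2k : ∀ n k → (n * n) ^ k ≡ n ^ (2 * k)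
  n^2k n k = trans (cong (λ x → (n * x) ^ k) (sym (*-identityʳ n))) (^-*-assoc n 2 k)

  swap-powers : ∀ a b c → (a ^ b) ^ c ≡ (a ^ c) ^ b
  swap-powers a b c = trans (^-*-assoc a b c)
    (trans (cong (a ^_) (*-comm b c)) (sym (^-*-assoc a c b)))

  -- The integer form of nG ≤ n^(2 - m/Q). After multiplication by n^m it follows from n^m ≤ (2^m)^Q
  -- and G * 2^m ≤ n.
  rows-power : ∀ {n Q m} → 1 ≤ n → n < 2 ^ Q → m ≤ Q →
               (n * (_/_ n (2 ^ m) {{m^n≢0 2 m}})) ^ Q ≤ n ^ (2 * Q ∸ m)
  rows-power {n} {Q} {m} 1≤n n<2^Q m≤Q = *-cancelʳ-≤ _ _ (n ^ m) {{m^n≢0 n m {{>-nonZero 1≤n}}}}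
    (begin
    (n * g) ^ Q * n ^ m        ≤⟨ *-monoʳ-≤ ((n * g) ^ Q) (^-monoˡ-≤ m (<⇒≤ n<2^Q)) ⟩
    (n * g) ^ Q * (2 ^ Q) ^ m  ≡⟨ cong ((n * g) ^ Q *_) (swap-powers 2 Q m) ⟩
    (n * g) ^ Q * (2 ^ m) ^ Q  ≡⟨ ^-distribʳ-* Q (n * g) (2 ^ m) ⟨
    (n * g * 2 ^ m) ^ Q        ≡⟨ cong (_^ Q) (*-assoc n g (2 ^ m)) ⟩
    (n * (g * 2 ^ m)) ^ Q      ≤⟨ ^-monoˡ-≤ Q (*-monoʳ-≤ n (m/n*n≤m n (2 ^ m) {{m^n≢0 2 m}})) ⟩
    (n * n) ^ Q                ≡⟨ n^2k n Q ⟩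
    n ^ (2 * Q)                ≡⟨ cong (n ^_) (m∸n+n≡m (≤-trans m≤Q (m≤m+n Q _))) ⟨
    n ^ (2 * Q ∸ m + m)        ≡⟨ ^-distribˡ-+-* n (2 * Q ∸ m) m ⟩
    n ^ (2 * Q ∸ m) * n ^ m    ∎)
    where
    open ≤-Reasoning
    g = _/_ n (2 ^ m) {{m^n≢0 2 m}}

  -- The integer form of n² 2^d ≤ n^(2 + d/L). Here a lower bound on n is needed, hence the exponent
  -- L = Q - 1 instead of Q.
  scan-power : ∀ {n} L d → 2 ^ L ≤ n → (n * n * 2 ^ d) ^ L ≤ n ^ (2 * L + d)
  scan-power {n} L d 2^L≤n = begin
    (n * n * 2 ^ d) ^ L        ≡⟨ ^-distribʳ-* L (n * n) (2 ^ d) ⟩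
    (n * n) ^ L * (2 ^ d) ^ L  ≡⟨ cong₂ _*_ (n^2k n L) (swap-powers 2 d L) ⟩
    n ^ (2 * L) * (2 ^ L) ^ d  ≤⟨ *-monoʳ-≤ (n ^ (2 * L)) (^-monoˡ-≤ d 2^L≤n) ⟩
    n ^ (2 * L) * n ^ d        ≡⟨ ^-distribˡ-+-* n (2 * L) d ⟨
    n ^ (2 * L + d)            ∎
    where open ≤-Reasoning

  2^m≤4*2^[m∸2] : ∀ m → 2 ^ m ≤ 4 * 2 ^ (m ∸ 2)
  2^m≤4*2^[m∸2] 0             = s≤s z≤n
  2^m≤4*2^[m∸2] 1             = s≤s (s≤s z≤n)
  2^m≤4*2^[m∸2] (suc (suc m)) = ≤-reflexive (sym (*-assoc 2 2 (2 ^ m)))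

  module Bounds (F : CompleteOrderedField) (t : CompleteOrderedField.Carrier F)
                (0≤t : CompleteOrderedField._≤_ F (CompleteOrderedField.0# F) t)
                (t≤1 : CompleteOrderedField._≤_ F t (CompleteOrderedField.1# F)) where
    private module R = CompleteOrderedField F
    open R using (_≈_; 0#; 1#; fromℕ; _-_; semiring)
      renaming (_≤_ to _≤ᶠ_; _*_ to _*ᶠ_; _+_ to _+ᶠ_; trans to ≈-trans; sym to ≈-sym;
        refl to ≈-refl)
    open RealPower F using (≤-resp₂; 0≤fromℕ; fromℕ-mono-≤; fromℕ-^; x-y+y≈x; RationalPower;
      RationalPower-bounded; _^ᴿ_)
      renaming (*-monoʳ-≤ to *ᶠ-monoʳ-≤; +-cancelʳ-≤ to +ᶠ-cancelʳ-≤; +-mono-≤ to +ᶠ-mono-≤;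
        +-monoʳ-≤ to +ᶠ-monoʳ-≤)
    open Mult semiring using (×-homo-+; ×1-homo-*)

    -- The power is a supremum over rational exponents, so one exponent p/(k + 1) ≤ α suffices, and
    -- the bound becomes an inequality between natural numbers.
    rational≤power : ∀ n {α} x p k → fromℕ p ≤ᶠ fromℕ (suc k) *ᶠ α → x ^ suc k ≤ n ^ p →
      fromℕ x ≤ᶠ n ^ᴿ α
    rational≤power n {α} x p k l h =
      proj₁ (proj₂ (R.complete (RationalPower n α) (0# , inj₁ ≈-refl) (RationalPower-bounded n α)))
        (fromℕ x)
        (inj₂ (0≤fromℕ x , p , k , l , ≤-resp₂ (fromℕ-^ x (suc k)) ≈-refl (fromℕ-mono-≤ h)))

    n≤n^1 : ∀ n → fromℕ n ≤ᶠ n ^ᴿ 1#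
    n≤n^1 n = rational≤power n n 1 0
      (≤-resp₂ (≈-sym (R.+-identityʳ 1#)) (≈-sym (≈-trans (R.*-identityʳ _) (R.+-identityʳ 1#)))
      R.≤-refl) ≤-refl

    module _ {M n} (1≤n : 1 ≤ n) (fits : 4 * (suc n * suc n) ≤ M) {Q m}
      (ps : Setup.Params F t M n 1≤n fits Q m) where
      open Setup F t M n 1≤n fits
      open Params ps

      rows-bound : fromℕ (n * (_/_ n (2 ^ m) {{m^n≢0 2 m}})) ≤ᶠ n ^ᴿ (fromℕ 2 - t)
      rows-bound = rational≤power n (n * (_/_ n (2 ^ m) {{m^n≢0 2 m}})) (2 * Q ∸ m) L
        (subst (λ q → fromℕ (2 * Q ∸ m) ≤ᶠ fromℕ q *ᶠ (fromℕ 2 - t)) Q≡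
          (+ᶠ-cancelʳ-≤ (t *ᶠ fromℕ Q)
            (≤-resp₂ ≈-refl total≈ (+ᶠ-monoʳ-≤ (fromℕ (2 * Q ∸ m)) lower))))
        (subst (λ q → (n * _) ^ q ≤ n ^ (2 * Q ∸ m)) Q≡ (rows-power 1≤n n<2^Q m≤Q))
        where
        total≈ : fromℕ (2 * Q ∸ m) +ᶠ fromℕ m ≈ fromℕ Q *ᶠ (fromℕ 2 - t) +ᶠ t *ᶠ fromℕ Q
        total≈ = ≈-trans (≈-sym (×-homo-+ 1# (2 * Q ∸ m) m))
          (≈-trans (R.reflexive (cong fromℕ (m∸n+n≡m (≤-trans m≤Q (m≤m+n Q _)))))
          (≈-trans (×1-homo-* 2 Q)
          (≈-trans (R.*-comm _ _)
          (≈-trans (R.*-congˡ (≈-sym (x-y+y≈x (fromℕ 2) t)))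
          (≈-trans (R.distribˡ _ _ _) (R.+-congˡ (R.*-comm _ _)))))))

      -- The first 1 is lost because m is rounded up, the second because Q is replaced by L: from m
      -- - 1 ≤ t(L + 1) and t ≤ 1 follows m - 2 ≤ tL. This is the origin of the factor 4 = 2² in
      -- `scan-bound`.
      m∸2≤tL : fromℕ (m ∸ 2) ≤ᶠ t *ᶠ fromℕ L
      m∸2≤tL = go m (subst (λ q → fromℕ (pred m) ≤ᶠ t *ᶠ fromℕ q) Q≡ upper)
        where
        0≤tL : 0# ≤ᶠ t *ᶠ fromℕ L
        0≤tL = R.*-nonneg 0≤t (0≤fromℕ L)
        go : ∀ m → fromℕ (pred m) ≤ᶠ t *ᶠ fromℕ (suc L) → fromℕ (m ∸ 2) ≤ᶠ t *ᶠ fromℕ L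
        go 0 _ = 0≤tL
        go 1 _ = 0≤tL
        go (suc (suc m)) h = +ᶠ-cancelʳ-≤ 1#
          (R.≤-trans (≤-resp₂ (R.+-comm _ _)
          (≈-trans (R.distribˡ _ _ _) (R.+-congʳ (R.*-identityʳ t))) h)
          (≤-resp₂ ≈-refl (R.+-comm _ _) (+ᶠ-mono-≤ t≤1 R.≤-refl)))

      scan-bound : fromℕ (n * n * 2 ^ m) ≤ᶠ fromℕ 4 *ᶠ n ^ᴿ (fromℕ 2 +ᶠ t)
      scan-bound = R.≤-trans (fromℕ-mono-≤ nat)
        (≤-resp₂ (≈-sym (×1-homo-* 4 y)) ≈-refl (*ᶠ-monoʳ-≤ (0≤fromℕ 4) (y≤ L Q≡ 2^L≤n m∸2≤tL)))
        where
        y = n * n * 2 ^ (m ∸ 2)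
        nat : n * n * 2 ^ m ≤ 4 * y
        nat = ≤-trans (*-monoʳ-≤ (n * n) (2^m≤4*2^[m∸2] m))
          (≤-reflexive (trans (sym (*-assoc (n * n) 4 _))
            (trans (cong (_* 2 ^ (m ∸ 2)) (*-comm (n * n) 4)) (*-assoc 4 (n * n) _))))
        y≤ : ∀ L → Q ≡ suc L → 2 ^ L ≤ n → fromℕ (m ∸ 2) ≤ᶠ t *ᶠ fromℕ L →
          fromℕ y ≤ᶠ n ^ᴿ (fromℕ 2 +ᶠ t)
        -- With L = 0 the exponent d/L is undefined; but then n = 1 and m ≤ 1, so y = 1 = n^0.
        y≤ zero e _ _ = rational≤power n y 0 0
          (R.*-nonneg (0≤fromℕ 1) (≤-resp₂ (R.+-identityʳ _) ≈-refl (+ᶠ-mono-≤ (0≤fromℕ 2) 0≤t)))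
          (≤-reflexive (cong₂ (λ a b → (a * a * 2 ^ b) ^ 1) n≡1
            (m≤n⇒m∸n≡0 (≤-trans m≤Q (≤-trans (≤-reflexive e) (s≤s z≤n))))))
          where
          n≡1 : n ≡ 1
          n≡1 = ≤-antisym (s≤s⁻¹ (subst (λ q → n < 2 ^ q) e n<2^Q)) 1≤n
        y≤ (suc L) e l h = rational≤power n y (2 * suc L + (m ∸ 2)) L
          (≤-resp₂ (≈-sym (×-homo-+ 1# (2 * suc L) (m ∸ 2))) (≈-sym (R.distribˡ _ _ _))
            (+ᶠ-mono-≤ (≤-resp₂ (≈-trans (R.*-comm _ _) (≈-sym (×1-homo-* 2 (suc L)))) ≈-refl
              R.≤-refl) (≤-resp₂ ≈-refl (R.*-comm _ _) h)))
          (scan-power (suc L) (m ∸ 2) l)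

  -- Loops over the cells of a matrix

  module Grid (F : CompleteOrderedField) (M : ℕ) where
    open Machine F
    open Execution F
    open Algorithm F
    open Hoare F M

    OtherCells : ℕ → ℕ → ℕ → State → State → Set
    OtherCells a i j s s′ = ∀ i′ j′ → ¬ (i ≡ i′ × j ≡ j′) → words s′ a i′ j′ ≡ words s a i′ j′

    gridCost : ℕ → ℕ → ℕ → ℕ
    gridCost R C c = forCost R (forCost C c)

    -- The invariant covers the cells that precede (i, j) lexicographically; it persists because the
    -- body keeps all other cells of array `a`. `Φ` is a predicate on the content so that the rule
    -- also serves the answers, which are characterised and not given by a formula.
    run-grid : ∀ {eR eC P R C c} a (Φ : ℕ → ℕ → ℕ → Set) (s₀ : State) →
      R < M → C < M → touches P 9 ≡ false → touches P 10 ≡ false →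
      (9 ≡ᵇ a) ≡ false → (10 ≡ᵇ a) ≡ false →
      (∀ s → Agree (grid eR eC P) s₀ s → Ev s eR R × Ev s eC C) →
      (∀ i j s → i < R → j < C → Agree (grid eR eC P) s₀ s → words s 9 0 0 ≡ i →
        words s 10 0 0 ≡ j →
        Run P s c (λ s′ → Φ i j (words s′ a i j) × OtherCells a i j s s′)) →
      Run (grid eR eC P) s₀ (gridCost R C c) (λ s → ∀ i j → i < R → j < C → Φ i j (words s a i j))
    run-grid {eR} {eC} {P} {R} {C} {c} a Φ s₀ R<M C<M nt9 nt10 9≢a 10≢a bounds body =
      conseq (λ s _ d i j l m → d i j (inj₁ (l , m)))
        (run-for (λ i s → Done i 0 (words s a)) s₀ R<M (cong (_∨ false) nt9)
          (λ i s v d → subst (Done i 0) (sym (update-other (words s) 9 0 0 v 9≢a)) d)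
          (λ _ s ag _ → proj₁ (bounds s ag)) outer
          (λ { _ _ (inj₁ (() , _)) ; _ _ (inj₂ (_ , ())) }))
      where
      G = grid eR eC P
      L = forLoop 10 eC P
      Done : ℕ → ℕ → (ℕ → ℕ → ℕ) → Set
      Done i j w = ∀ i′ j′ → (i′ < i × j′ < C) ⊎ (i′ ≡ i × j′ < j) → Φ i′ j′ (w i′ j′)
      untouched : ∀ x → touches G x ≡ false → touches L x ≡ false
      untouched x e = ∨-falseˡ {touches L x} (∨-falseʳ {9 ≡ᵇ x} e)
      outer : ∀ i s → i < R → Agree G s₀ s → words s 9 0 0 ≡ i → Done i 0 (words s a) →
              Run L s (forCost C c) (λ s′ → Done (suc i) 0 (words s′ a))
      outer i s₁ i<R ag₁ i≡ d = conseq (λ s′ _ d′ → next (words s′ a) d′)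
        (run-for (λ j s → Done i j (words s a)) s₁ C<M nt10
          (λ j s v d → subst (Done i j) (sym (update-other (words s) 10 0 0 v 10≢a)) d)
          (λ _ s ag _ → proj₂ (bounds s (both ag))) inner d)
        where
        both : ∀ {s} → Agree L s₁ s → Agree G s₀ s
        both = agree-trans {L} {G} untouched ag₁
        next : ∀ w → Done i C w → Done (suc i) 0 w
        next w d i′ j′ (inj₁ (s≤s l , m)) with m≤n⇒m<n∨m≡n l
        ... | inj₁ l′ = d i′ j′ (inj₁ (l′ , m))
        ... | inj₂ e  = d i′ j′ (inj₂ (e , m))
        inner : ∀ j s → j < C → Agree L s₁ s → words s 10 0 0 ≡ j → Done i j (words s a) →
                Run P s c (λ s′ → Done i (suc j) (words s′ a))
        inner j s j<C ag j≡ d = conseq (λ s′ _ (φ , others) → step s′ φ others)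
          (body i j s i<R j<C (both ag) (keep {L} ag 9 (cong (_∨ false) nt9) i≡) j≡)
          where
          step : ∀ s′ → Φ i j (words s′ a i j) → OtherCells a i j s s′ → Done i (suc j) (words s′ a)
          step s′ φ others i′ j′ (inj₁ (l , m)) =
            subst (Φ i′ j′) (sym (others i′ j′ (λ e → <⇒≢ l (sym (proj₁ e)))))
              (d i′ j′ (inj₁ (l , m)))
          step s′ φ others i′ j′ (inj₂ (refl , s≤s m)) with m≤n⇒m<n∨m≡n m
          ... | inj₂ refl = φ
          ... | inj₁ l = subst (Φ i′ j′) (sym (others i′ j′ (λ e → <⇒≢ l (sym (proj₂ e)))))
            (d i′ j′ (inj₂ (refl , l)))

    run-fill : ∀ {eR eC e R C} a (val : ℕ → ℕ → ℕ) (s₀ : State) →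
      R < M → C < M → (a ≡ᵇ 9) ≡ false → (a ≡ᵇ 10) ≡ false → (9 ≡ᵇ a) ≡ false → (10 ≡ᵇ a) ≡ false →
      (∀ s → Agree (grid eR eC (setWord a (var 9) (var 10) e)) s₀ s → Ev s eR R × Ev s eC C) →
      (∀ i j s → i < R → j < C → Agree (grid eR eC (setWord a (var 9) (var 10) e)) s₀ s →
        words s 9 0 0 ≡ i → words s 10 0 0 ≡ j → Ev s e (val i j)) →
      Run (grid eR eC (setWord a (var 9) (var 10) e)) s₀ (gridCost R C 1)
        (λ s → ∀ i j → i < R → j < C → words s a i j ≡ val i j)
    run-fill a val s₀ R<M C<M a≢9 a≢10 9≢a 10≢a bounds value =
      run-grid a (λ i j v → v ≡ val i j) s₀ R<M C<M a≢9 a≢10 9≢a 10≢a bounds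
        (λ i j s i<R j<C ag i≡ j≡ →
          run-set (ev-var i≡ (<⇒≤ (<-trans i<R R<M))) (ev-var j≡ (<⇒≤ (<-trans j<C C<M)))
            (value i j s i<R j<C ag i≡ j≡)
            (update-same (words s) a i j (val i j) , λ i′ j′ ne →
              update-cell (words s) a i j (val i j) i′ j′ ne))

  -- Products of matrices of bits, and the size of the output as a lower bound on time

  natSum : ∀ {q} → (Fin q → ℕ) → ℕ
  natSum = sum +-0-rawMonoid

  natSum-bounded : ∀ {q} (g : Fin q → ℕ) → (∀ k → g k ≤ 1) → natSum g ≤ q
  natSum-bounded {zero}  g h = z≤n
  natSum-bounded {suc q} g h =
    +-mono-≤ (h zero) (natSum-bounded (λ k → g (suc k)) (λ k → h (suc k)))

  natSum-zero : ∀ {q} (g : Fin q → ℕ) → natSum g ≡ 0 → ∀ k → g k ≡ 0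
  natSum-zero g e zero    = m+n≡0⇒m≡0 (g zero) e
  natSum-zero g e (suc k) = natSum-zero (λ k → g (suc k)) (m+n≡0⇒n≡0 (g zero) e) k

  natSum-nonzero : ∀ {q} (g : Fin q → ℕ) → natSum g ≢ 0 → ∃[ k ] g k ≢ 0
  natSum-nonzero {zero}  g ne = ⊥-elim (ne refl)
  natSum-nonzero {suc q} g ne with g zero ≟ 0
  ... | no p = zero , p
  ... | yes p with natSum-nonzero (λ k → g (suc k)) (λ e → ne (cong₂ _+_ p e))
  ...   | k , h = suc k , h

  module Multiplication (F : CompleteOrderedField) where
    open CompleteOrderedField F using (Carrier; fromℕ) renaming (_≤_ to _≤ᶠ_; _*_ to _*ᶠ_)
    open RealPower F using (_^ᴿ_; fromℕ-mono-≤)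
    open Machine F
    open Execution F
    open MatrixMultiplication F

    product-nonneg : ∀ {p q r} (X : Matrix ℤ p q) (Y : Matrix ℤ q r) (x : Matrix ℕ p q) (y : Matrix ℕ q r) →
      (∀ i k → X i k ≡ ℤ.+ x i k) → (∀ k j → Y k j ≡ ℤ.+ y k j) →
      ∀ i j → (X ⊠ Y) i j ≡ ℤ.+ natSum (λ k → x i k * y k j)
    product-nonneg X Y x y hx hy i j = go (λ k → X i k ℤ.* Y k j) (λ k → x i k * y k j)
      (λ k → trans (cong₂ ℤ._*_ (hx i k) (hy k j)) (sym (ℤ.pos-* (x i k) (y k j))))
      where
      go : ∀ {q} (f : Fin q → ℤ) (g : Fin q → ℕ) → (∀ k → f k ≡ ℤ.+ g k) →
        sum ℤ.+-0-rawMonoid f ≡ ℤ.+ natSum g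
      go {zero}  f g h = refl
      go {suc q} f g h = trans (cong₂ ℤ._+_ (h zero)
        (go (λ k → f (suc k)) (λ k → g (suc k)) (λ k → h (suc k))))
                           (sym (ℤ.pos-+ (g zero) (natSum (λ k → g (suc k)))))

    -- MultipliesIn at a fixed n and with κ = 0.
    Multiplies : Program → ℕ → ℕ → ℕ → Carrier → Carrier → Set
    Multiplies P ℓ K n a w =
      ∀ p → fromℕ p ≤ᶠ n ^ᴿ a → ∀ (X : Matrix ℤ p n) (Y : Matrix ℤ n n) →
      (∀ i j → ∣ X i j ∣ ≤ 1) → (∀ i j → ∣ Y i j ∣ ≤ 1) →
      ∀ s → MultiplicationInput X Y s →
      ∃[ s′ ] ∃[ τ ] (suc n ^ ℓ ⊢ P , s ⇓ s′ ⟨ τ ⟩ × MultiplicationOutput (X ⊠ Y) s′ ×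
                      fromℕ τ ≤ᶠ fromℕ K *ᶠ n ^ᴿ w)

    -- If the output cells initially hold values that are too large for a product of 0/1 matrices,
    -- then every one of them has to be overwritten.
    output-size : ∀ {P ℓ K n a w} → Multiplies P ℓ K n a w → ∀ p → fromℕ p ≤ᶠ n ^ᴿ a →
                  fromℕ (p * n) ≤ᶠ fromℕ K *ᶠ n ^ᴿ w
    output-size {n = n} mult p p≤ with mult p p≤ (λ _ _ → ℤ.+ 0) (λ _ _ → ℤ.+ 0) (λ _ _ → z≤n)
      (λ _ _ → z≤n) s₀
        (record { rows = refl ; inner = refl ; cols = refl
                ; left = (λ _ _ → refl) , (λ _ _ → refl) ; right = (λ _ _ → refl) ,
                  (λ _ _ → refl) })
      where
      junk : ℕ → ℕ → ℕ → ℕ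
      junk 0 0 0 = p
      junk 0 0 1 = n
      junk 0 0 2 = n
      junk 5 _ _ = suc n
      junk _ _ _ = 0
      s₀ : State
      s₀ = mkState junk (λ _ _ _ → CompleteOrderedField.0# F)
    ... | s′ , τ , exec , out , τ≤ with written 5 exec
    ... | written-at cs length≤ cells =
      CompleteOrderedField.≤-trans F (fromℕ-mono-≤ (≤-trans (injective⇒≤ inj) length≤)) τ≤
      where
      entry≤ : ∀ (i : Fin p) (j : Fin n) → words s′ 5 (toℕ i) (toℕ j) ≤ n
      entry≤ i j = ≤-trans (≤-reflexive (trans (proj₁ out i j)
          (cong ∣_∣ (product-nonneg {p} {n} {n} (λ _ _ → ℤ.+ 0) (λ _ _ → ℤ.+ 0) (λ _ _ → 0)
            (λ _ _ → 0) (λ _ _ → refl) (λ _ _ → refl) i j))))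
        (natSum-bounded {n} (λ _ → 0) (λ _ → z≤n))
      cell∈ : ∀ (x : Fin (p * n)) → _
      cell∈ x = cells (toℕ (proj₁ (remQuot {p} n x))) (toℕ (proj₂ (remQuot {p} n x)))
        (λ e → <⇒≱ ≤-refl (≤-trans (≤-reflexive (sym e))
          (entry≤ (proj₁ (remQuot {p} n x)) (proj₂ (remQuot {p} n x)))))
      -- Equal positions in the list of written cells hold equal pairs, and a pair determines the
      -- flat index.
      inj : ∀ {x y} → index (cell∈ x) ≡ index (cell∈ y) → x ≡ y
      inj {x} {y} e = trans (sym (combine-remQuot {p} n x))
        (trans (cong₂ combine (toℕ-injective (cong proj₁ same)) (toℕ-injective (cong proj₂ same)))
          (combine-remQuot {p} n y))
        where
        same = trans (lookup-index (cell∈ x))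
          (trans (cong (lookup cs) e) (sym (lookup-index (cell∈ y))))

  -- The bucket matrices, their product, and the scans

  module Buckets (F : CompleteOrderedField) (M n : ℕ) (1≤n : 1 ≤ n) (fits : 4 * (suc n * suc n) ≤ M)
      (A T : ℕ → ℕ → CompleteOrderedField.Carrier F) (B : ℕ → ℕ → ℕ) (B≤1 : ∀ k j → k < n → j < n →
        B k j ≤ 1)
      (sz G : ℕ) (1≤sz : 1 ≤ sz) (sz≤2n : sz ≤ 2 * n) (G*sz≤n : G * sz ≤ n)
        (n<G*sz+sz : n < G * sz + sz)
      (ord rank : ℕ → ℕ → ℕ) (order : ∀ i → i < n → Tournament.Order F n (A i) (ord i) (rank i))
        where
    open CompleteOrderedField F using (Carrier; fromℕ) renaming (_≤_ to _≤ᶠ_; _*_ to _*ᶠ_)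
    open RealPower F using (_^ᴿ_)
    open Machine F
    open Execution F
    open Algorithm F
    open Hoare F M
    open Grid F M
    open Multiplication F
    open MatrixMultiplication F
    open Sort F M n 1≤n fits A using (n≤M; 2n≤M; 4n≤M; 2n<M)
    open Tournament F n using (module Order)

    record Env (w₀ w₁ w₃ w₄ w₁₄ w₁₅ : Array ℕ) (r₀ r₁ : Array Carrier) : Set where
      constructor env
      field
        n≡    : w₀ 0 0 ≡ n
        B≡    : w₁ ≡ B
        sz≡   : w₃ 0 0 ≡ sz
        G≡    : w₄ 0 0 ≡ G
        ord≡  : w₁₄ ≡ ord
        rank≡ : w₁₅ ≡ rank
        A≡    : r₀ ≡ A
        T≡    : r₁ ≡ T

    EnvOf : State → Set
    EnvOf s = Env (words s 0) (words s 1) (words s 3) (words s 4) (words s 14) (words s 15)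
      (reals s 0) (reals s 1)

    Preserves : Program → Set
    Preserves P = touches P 0 ≡ false × touches P 1 ≡ false × touches P 3 ≡ false ×
                  touches P 4 ≡ false × touches P 14 ≡ false × touches P 15 ≡ false

    env-agree : ∀ {P s s′} → Agree P s s′ → Preserves P → EnvOf s → EnvOf s′
    env-agree {P} ag (p₀ , p₁ , p₃ , p₄ , p₁₄ , p₁₅) e = record
      { n≡    = keep {P} ag 0 p₀ n≡
      ; B≡    = trans (proj₁ (ag 1 p₁)) B≡
      ; sz≡   = keep {P} ag 3 p₃ sz≡
      ; G≡    = keep {P} ag 4 p₄ G≡
      ; ord≡  = trans (proj₁ (ag 14 p₁₄)) ord≡
      ; rank≡ = trans (proj₁ (ag 15 p₁₅)) rank≡
      ; A≡    = trans (proj₂ (ag 0 p₀)) A≡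
      ; T≡    = trans (proj₂ (ag 1 p₁)) T≡ }
      where open Env e

    G≤n : G ≤ n
    G≤n = ≤-trans (m≤m*n G sz {{>-nonZero 1≤sz}}) G*sz≤n

    p : ℕ
    p = n * G

    n²≤ : n * n ≤ suc n * suc n
    n²≤ = *-mono-≤ (n≤1+n n) (n≤1+n n)

    n²≤M : ∀ {x} → x ≤ n * n → x < M
    n²≤M l = ≤-trans (s≤s (≤-trans l n²≤))
      (≤-trans (m<m+n (suc n * suc n) {3 * (suc n * suc n)} (s≤s z≤n)) fits)

    p<M : p < M
    p<M = n²≤M (*-monoʳ-≤ n G≤n)

    n<M : n < M
    n<M = 2n<M (m≤m+n n _)

    module _ {s} (e : EnvOf s) where
      open Env e
      evN : Ev s (var 0) n
      evN = ev-var n≡ (n≤M ≤-refl)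
      evSz : Ev s (var 3) sz
      evSz = ev-var sz≡ (<⇒≤ (2n<M sz≤2n))
      evG : Ev s (var 4) G
      evG = ev-var G≡ (n≤M G≤n)
      evP : Ev s (var 0 ⊗ var 4) p
      evP = ev-⊗ evN evG (<⇒≤ p<M)

    -- Row r = i * G + g of the left factor marks the columns k for which a i k is in one of the
    -- buckets 0 … g of row i.
    marked : ℕ → ℕ → ℕ
    marked r k = 1 ∸ (rank (r div G) k div sz ∸ (r ∸ r div G * G))

    div*≤ : ∀ a b → a div b * b ≤ a
    div*≤ a zero    = z≤n
    div*≤ a (suc b) = m/n*n≤m a (suc b)

    div< : ∀ {r} → r < p → r div G < n
    div< {r} l = go G l
      where
      go : ∀ G → r < n * G → r div G < n
      go zero    l = ⊥-elim (<⇒≱ l (≤-trans (≤-reflexive (*-zeroʳ n)) z≤n))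
      go (suc G) l = m<n*o⇒m/o<n l

    ev-div : ∀ {s e f a b} → 1 ≤ b → Ev s e a → Ev s f b → Ev s (e ⊘ f) (a div b)
    ev-div {b = suc b} l = ev-⊘

    ev-mark : ∀ r k s → r < p → k < n → EnvOf s → words s 9 0 0 ≡ r → words s 10 0 0 ≡ k →
      Ev s markExp (marked r k)
    ev-mark r k s r<p k<n e r≡ k≡ =
      ev-⊖ (ev-lit (n≤M 1≤n)) (ev-⊖ (ev-div 1≤sz evRank (evSz e))
        (ev-⊖ evIdx (ev-⊗ evRow (evG e) (≤-trans (div*≤ r G) r≤M))))
      where
      r≤M = <⇒≤ (<-trans r<p p<M)
      evIdx : Ev s (var 9) r
      evIdx = ev-var r≡ r≤M
      1≤G : 1 ≤ G
      1≤G = n≢0⇒n>0 λ z → <⇒≱ r<p (≤-trans (≤-reflexive (trans (cong (n *_) z) (*-zeroʳ n))) z≤n)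
      evRow : Ev s (var 9 ⊘ var 4) (r div G)
      evRow = ev-div 1≤G evIdx (evG e)
      evRank : Ev s (word 15 (var 9 ⊘ var 4) (var 10)) (rank (r div G) k)
      evRank = ev-word evRow (ev-var k≡ (<⇒≤ (<-trans k<n n<M)))
        (cong (λ f → f (r div G) k) (Env.rank≡ e))
                 (n≤M (<⇒≤ (Order.rank< (order (r div G) (div< r<p)) k<n)))

    Filled : ℕ → ℕ → (ℕ → ℕ → ℕ) → (ℕ → ℕ → ℕ) → Set
    Filled R C w val = ∀ i j → i < R → j < C → w i j ≡ val i j

    unmarked : ℕ → ℕ → ℕ
    unmarked k j = 1 ∸ B k j

    run-fillXs : ∀ s → EnvOf s → Run fillXs s (gridCost p n 1 + gridCost p n 1)
      (λ s′ → Filled p n (words s′ 21) marked × Filled p n (words s′ 22) (λ _ _ → 0))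
    run-fillXs s e =
      run-fill 21 marked s p<M n<M refl refl refl refl
        (λ s′ ag → let e′ = env-agree {X₁} ag (refl , refl , refl , refl , refl , refl) e in evP e′ , evN e′)
        (λ i j s′ i<p j<n ag i≡ j≡ →
          ev-mark i j s′ i<p j<n (env-agree {X₁} ag (refl , refl , refl , refl , refl , refl) e) i≡
          j≡)
      >>> λ s₁ ag₁ h → conseq (λ s₂ ag₂ h′ → (λ i j l m → keep {X₂} ag₂ 21 refl (h i j l m)) , h′)
        (run-fill 22 (λ _ _ → 0) s₁ p<M n<M refl refl refl refl
          (λ s′ ag → let e′ = env-agree {X₂} ag (refl , refl , refl , refl , refl , refl)
                                (env-agree {X₁} ag₁ (refl , refl , refl , refl , refl , refl) e)
                                  in evP e′ , evN e′)
          (λ i j s′ i<p j<n ag i≡ j≡ → ev-lit z≤n))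
      where
      X₁ = grid (var 0 ⊗ var 4) (var 0) (setWord 21 (var 9) (var 10) markExp)
      X₂ = grid (var 0 ⊗ var 4) (var 0) (setWord 22 (var 9) (var 10) (lit 0))

    run-fillYs : ∀ s → EnvOf s → Run fillYs s (gridCost n n 1 + gridCost n n 1)
      (λ s′ → Filled n n (words s′ 23) unmarked × Filled n n (words s′ 24) (λ _ _ → 0))
    run-fillYs s e =
      run-fill 23 unmarked s n<M n<M refl refl refl refl
        (λ s′ ag → let e′ = env-agree {Y₁} ag (refl , refl , refl , refl , refl , refl) e in evN e′ , evN e′)
        (λ i j s′ i<n j<n ag i≡ j≡ → ev-⊖ (ev-lit (n≤M 1≤n))
          (ev-word (ev-var i≡ (n≤M (<⇒≤ i<n))) (ev-var j≡ (n≤M (<⇒≤ j<n)))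
            (cong (λ f → f i j) (Env.B≡ (env-agree {Y₁} ag (refl , refl , refl , refl , refl , refl)
              e)))
            (n≤M (≤-trans (B≤1 i j i<n j<n) 1≤n))))
      >>> λ s₁ ag₁ h → conseq (λ s₂ ag₂ h′ → (λ i j l m → keep {Y₂} ag₂ 23 refl (h i j l m)) , h′)
        (run-fill 24 (λ _ _ → 0) s₁ n<M n<M refl refl refl refl
          (λ s′ ag → let e′ = env-agree {Y₂} ag (refl , refl , refl , refl , refl , refl)
                                (env-agree {Y₁} ag₁ (refl , refl , refl , refl , refl , refl) e)
                                  in evN e′ , evN e′)
          (λ i j s′ i<p j<n ag i≡ j≡ → ev-lit z≤n))
      where
      Y₁ = grid (var 0) (var 0) (setWord 23 (var 9) (var 10) (lit 1 ⊖ word 1 (var 9) (var 10)))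
      Y₂ = grid (var 0) (var 0) (setWord 24 (var 9) (var 10) (lit 0))

    marked≤1 : ∀ r k → marked r k ≤ 1
    marked≤1 r k = m∸n≤m 1 (rank (r div G) k div sz ∸ (r ∸ r div G * G))

    unmarked≤1 : ∀ k j → unmarked k j ≤ 1
    unmarked≤1 k j = m∸n≤m 1 (B k j)

    record Built (dim x sx y sy : Array ℕ) : Set where
      constructor built
      field
        rows  : dim 0 0 ≡ p
        inner : dim 0 1 ≡ n
        cols  : dim 0 2 ≡ n
        left  : Filled p n x marked
        leftSign : Filled p n sx (λ _ _ → 0)
        right : Filled n n y unmarked
        rightSign : Filled n n sy (λ _ _ → 0)

    BuiltOf : State → Set
    BuiltOf s = Built (words s 20) (words s 21) (words s 22) (words s 23) (words s 24)

    buildCost : ℕ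
    buildCost = (gridCost p n 1 + gridCost p n 1) + ((gridCost n n 1 + gridCost n n 1) + 3)

    run-build : ∀ s → EnvOf s → Run build s buildCost (λ s′ → BuiltOf s′)
    run-build s e =
      run-fillXs s e >>> λ { s₁ ag₁ (x , sx) →
      let e₁ = env-agree {fillXs} ag₁ (refl , refl , refl , refl , refl , refl) e in
      run-fillYs s₁ e₁ >>> λ { s₂ ag₂ (y , sy) →
      let e₂ = env-agree {fillYs} ag₂ (refl , refl , refl , refl , refl , refl) e₁ in
      run-set⨾ (ev-lit z≤n) (ev-lit z≤n) (evP e₂)
        (run-set⨾ (ev-lit z≤n) (ev-lit (n≤M 1≤n)) (ev-var {x = 0} (Env.n≡ e₂) (n≤M ≤-refl))
          (run-set (ev-lit z≤n) (ev-lit (2n≤M (*-monoʳ-≤ 2 (s≤s z≤n))))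
            (ev-var {x = 0} (Env.n≡ e₂) (n≤M ≤-refl))
            (built refl refl refl (λ i j l m → keep {fillYs} ag₂ 21 refl (x i j l m))
              (λ i j l m → keep {fillYs} ag₂ 22 refl (sx i j l m)) y sy))) } }

    -- The entry of the product that counts the columns k marked in row r with b k j = -∞. Only
    -- whether it vanishes is used later.
    common : ℕ → ℕ → ℕ
    common r j = natSum {n} (λ k → marked r (toℕ k) * unmarked (toℕ k) j)

    shift-preserves : ∀ P → Preserves (shift P)
    shift-preserves P = at 0 (s≤s z≤n) , at 1 (s≤s (s≤s z≤n)) , at 3 (s≤s (s≤s (s≤s (s≤s z≤n)))) ,
      at 4 (m≤m+n 5 15) ,
                        at 14 (m≤m+n 15 5) , at 15 (m≤m+n 16 4)
      where
      at : ∀ x → x < offset → touches (shift P) x ≡ false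
      at = shift-touches P

    run-multiply : ∀ {P ℓ K a w} → suc n ^ ℓ ≤ M → Multiplies P ℓ K n a w → fromℕ p ≤ᶠ n ^ᴿ a →
      ∀ s → BuiltOf s →
      ∃[ c ] (fromℕ c ≤ᶠ fromℕ K *ᶠ n ^ᴿ w ×
        Run (shift P) s c (λ s′ → Filled p n (words s′ 25) common))
    run-multiply {P} {ℓ} ℓ≤M mult p≤ s b with mult p p≤ X Y
      (λ i j → ≤-trans (≤-reflexive (left _ _ (toℕ<n i) (toℕ<n j))) (marked≤1 (toℕ i) (toℕ j)))
        (λ i j → ≤-trans (≤-reflexive (right _ _ (toℕ<n i) (toℕ<n j))) (unmarked≤1 (toℕ i) (toℕ j)))
          view
        (record { rows = rows ; inner = inner ; cols = cols
                ; left = (λ _ _ → refl) , (λ i j → leftSign _ _ (toℕ<n i) (toℕ<n j))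
                ; right = (λ _ _ → refl) , (λ i j → rightSign _ _ (toℕ<n i) (toℕ<n j)) })
      where
      open Built b
      -- The memory as the multiplication program sees it. Whatever its other arrays contain passes
      -- as uninitialised memory.
      view : State
      view = mkState (λ x → words s (20 + x)) (λ x → reals s (20 + x))
      X : Matrix ℤ p n
      X i j = ℤ.+ words s 21 (toℕ i) (toℕ j)
      Y : Matrix ℤ n n
      Y i j = ℤ.+ words s 23 (toℕ i) (toℕ j)
    ... | v , τ , exec , (out , _) ,
      τ≤ with shift-exec {u = s} ℓ≤M
      (record { words-eq = λ _ _ _ → refl ; reals-eq = λ _ _ _ → refl }) exec
    ... | s′ , exec′ , eqs = τ , τ≤ , run exec′ ≤-refl post
      where
      open Built b
      entry : ∀ (i : Fin p) (j : Fin n) → words s′ 25 (toℕ i) (toℕ j) ≡ common (toℕ i) (toℕ j)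
      entry i j = trans (_≈ₛ_.words-eq eqs 5 (toℕ i) (toℕ j)) (trans (out i j)
        (cong ∣_∣ (product-nonneg {p} {n} {n} _ _ (λ i k → marked (toℕ i) (toℕ k))
          (λ k j → unmarked (toℕ k) (toℕ j))
          (λ i k → cong ℤ.+_ (left _ _ (toℕ<n i) (toℕ<n k)))
            (λ k j → cong ℤ.+_ (right _ _ (toℕ<n k) (toℕ<n j))) i j)))
      post : Filled p n (words s′ 25) common
      post r j r<p j<n = subst₂ (λ a b → words s′ 25 a b ≡ common a b) (toℕ-fromℕ< r<p)
        (toℕ-fromℕ< j<n)
        (entry (fromℕ< r<p) (fromℕ< j<n))

    div-lower : ∀ {f} r → f ≤ r div sz → f * sz ≤ r
    div-lower r l = ≤-trans (*-monoˡ-≤ sz l) (div*≤ r sz)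

    div-upper : ∀ {f} r → r div sz ≤ f → r < f * sz + sz
    div-upper {f} r = go sz 1≤sz
      where
      go : ∀ sz → 1 ≤ sz → r div sz ≤ f → r < f * sz + sz
      go (suc b) _ l = ≤-trans (s≤s (≤-reflexive (m≡m%n+[m/n]*n r (suc b))))
        (≤-trans (+-mono-≤ (m%n<n r (suc b)) (*-monoˡ-≤ (suc b) l))
          (≤-reflexive (+-comm (suc b) (f * suc b))))

    row-div : ∀ i {g} → g < G → (i * G + g) div G ≡ i
    row-div i {g} = go G
      where
      go : ∀ G → g < G → (i * G + g) div G ≡ i
      go (suc G) l = trans (+-distrib-/ (i * suc G) g
          (subst (_< suc G) (sym (cong₂ _+_ (m*n%n≡0 i (suc G)) (m<n⇒m%n≡m l))) l))
        (trans (cong₂ _+_ (m*n/n≡m i (suc G)) (m<n⇒m/n≡0 l)) (+-identityʳ i))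

    marked-row : ∀ i {g} → g < G → ∀ k → marked (i * G + g) k ≡ 1 ∸ (rank i k div sz ∸ g)
    marked-row i {g} l k rewrite row-div i l = cong (λ z → 1 ∸ (rank i k div sz ∸ z))
      (m+n∸m≡n (i * G) g)

    common-zero : ∀ i {g} j → g < G → common (i * G + g) j ≡ 0 → ∀ {k} → k < n →
      rank i k div sz ≤ g → B k j ≢ 0
    common-zero i {g} j g<G e {k} k<n l Bkj =
      1+n≢0 (trans (sym one) (natSum-zero {n} _ e (fromℕ< k<n)))
      where
      one : marked (i * G + g) (toℕ (fromℕ< k<n)) * unmarked (toℕ (fromℕ< k<n)) j ≡ 1
      one rewrite toℕ-fromℕ< k<n | marked-row i g<G k | m≤n⇒m∸n≡0 l | Bkj = refl

    common-nonzero : ∀ i {g} j → g < G → common (i * G + g) j ≢ 0 →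
      ∃[ k ] (k < n × rank i k div sz ≤ g × B k j ≡ 0)
    common-nonzero i {g} j g<G ne with natSum-nonzero {n} _ ne
    ... | x , h = toℕ x , toℕ<n x , near , free
      where
      near : rank i (toℕ x) div sz ≤ g
      near with rank i (toℕ x) div sz ≤? g
      ... | yes l = l
      ... | no l = ⊥-elim (h (cong (_* unmarked (toℕ x) j)
              (trans (marked-row i g<G (toℕ x)) (m≤n⇒m∸n≡0 {1} (m<n⇒0<n∸m (≰⇒> l))))))
      free : B (toℕ x) j ≡ 0
      free with B (toℕ x) j
      ... | zero = refl
      ... | suc b = ⊥-elim (h (trans (cong (marked (i * G + g) (toℕ x) *_)
              (0∸n≡0 b)) (*-zeroʳ (marked (i * G + g) (toℕ x)))))

    common≤n : ∀ r j → common r j ≤ n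
    common≤n r j = natSum-bounded _ (λ k → *-mono-≤ (marked≤1 r (toℕ k)) (unmarked≤1 (toℕ k) j))

    -- For a restricted input this says that the target is the minimum; see `attained` in `MinMax`.
    Attained : ℕ → ℕ → Set
    Attained i j = ∃[ k ] (k < n × B k j ≡ 0 × A i k ≤ᶠ T i j)

    record First (i j g f : ℕ) : Set where
      constructor first
      field
        f≤g     : f ≤ g
        empty   : ∀ {g′} → g′ < f → common (i * G + g′) j ≡ 0
        nonzero : f < g → common (i * G + f) j ≢ 0

    Good : ℕ → ℕ → ℕ → ℕ → Set
    Good i j f x = f * sz + x < n × B (ord i (f * sz + x)) j ≡ 0 × A i (ord i (f * sz + x)) ≤ᶠ T i j

    -- Every k with b k j = -∞ lies in bucket f or later. If it lies in a later one, then some element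
    -- of bucket f, which is smaller, has this property as well.
    scan-complete : ∀ {i j f} → i < n → First i j G f → Attained i j →
      ∃[ x ] (x < sz × Good i j f x)
    scan-complete {i} {j} {f} i<n (first f≤G empty nonzero) (k , k<n , Bkj , Aik≤T) =
      cases (rank i k <? f * sz + sz)
      where
      open Order (A i) (order i i<n)
      late : ∀ {k} → k < n → B k j ≡ 0 → f ≤ rank i k div sz
      late {k} k<n Bkj = ≮⇒≥ λ l → common-zero i j (<-≤-trans l f≤G) (empty l) k<n ≤-refl Bkj
      good : ∀ {k} → k < n → B k j ≡ 0 → A i k ≤ᶠ T i j → rank i k < f * sz + sz →
        ∃[ x ] (x < sz × Good i j f x)
      good {k} k<n Bkj A≤T l = x , +-cancelˡ-< (f * sz) x sz (subst (_< f * sz + sz) (sym back) l) ,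
        subst (_< n) (sym back) (rank< k<n) ,
        trans (cong (λ z → B z j) at) Bkj ,
        subst (λ z → A i z ≤ᶠ T i j) (sym at) A≤T
        where
        x = rank i k ∸ f * sz
        back : f * sz + x ≡ rank i k
        back = m+[n∸m]≡n (div-lower (rank i k) (late k<n Bkj))
        at : ord i (f * sz + x) ≡ k
        at = trans (cong (ord i) back) (ord-rank k<n)
      cases : _ → ∃[ x ] (x < sz × Good i j f x)
      cases (yes l) = good k<n Bkj Aik≤T l
      cases (no l) with f <? G
      -- f = G is the incomplete last bucket. It reaches beyond position n, so no later element
      -- exists.
      ... | no f≮G = ⊥-elim (<⇒≱ n<G*sz+sz
        (≤-trans (+-monoˡ-≤ sz (*-monoˡ-≤ sz (≮⇒≥ f≮G))) (≤-trans (≮⇒≥ l) (<⇒≤ (rank< k<n)))))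
      ... | yes f<G with common-nonzero i j f<G (nonzero f<G)
      ...   | k′ , k′<n , near , Bk′j = good k′<n Bk′j
                (CompleteOrderedField.≤-trans F
                  (subst₂ (λ a b → A i a ≤ᶠ A i b) (ord-rank k′<n) (ord-rank k<n)
                    (mono (<⇒≤ (<-≤-trans (div-upper (rank i k′) near) (≮⇒≥ l))) (rank< k<n)))
                      Aik≤T)
                (div-upper (rank i k′) near)

    Answer : ℕ → ℕ → ℕ → Set
    Answer i j c = (c ≡ 0 ⊎ c ≡ 1) × (c ≡ 1 → Attained i j) × (Attained i j → c ≡ 1)

    cellCost : ℕ
    cellCost = (1 + forCost G 2) + ((1 + forCost sz 5) + 1)

    module _ {i j : ℕ} (i<n : i < n) (j<n : j < n) where
      private
        ev0 : ∀ {s} → Ev s (lit 0) 0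
        ev0 = ev-lit z≤n
        ev1 : ∀ {s} → Ev s (lit 1) 1
        ev1 = ev-lit (n≤M 1≤n)
        sz<M : sz < M
        sz<M = 2n<M sz≤2n

      run-findFirst : ∀ s → EnvOf s → words s 9 0 0 ≡ i → words s 10 0 0 ≡ j →
        Filled p n (words s 25) common →
        Run findFirst s (1 + forCost G 2) (λ s′ → First i j G (words s′ 16 0 0))
      run-findFirst s e i≡ j≡ z = run-set⨾ ev0 ev0 ev0
        (run-for (λ g s′ → First i j g (words s′ 16 0 0)) s₀ (≤-<-trans G≤n n<M) refl
          (λ _ _ _ h → h)
          (λ _ s′ ag _ → evG (env-agree {L} {s₀} {s′} ag (refl , refl , refl , refl , refl , refl)
            e₀)) step
          (first z≤n (λ ()) (λ ())))
        where
        s₀ = put s 16 0 0 0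
        L = forLoop 11 (var 4) findStep
        e₀ : EnvOf s₀
        e₀ = record { Env e }
        step : ∀ g s′ → g < G → Agree L s₀ s′ → words s′ 11 0 0 ≡ g →
          First i j g (words s′ 16 0 0) →
               Run findStep s′ 2 (λ s″ → First i j (suc g) (words s″ 16 0 0))
        step g s′ g<G ag g≡ (first f≤g empty nonzero) =
          -- As f ≤ g is invariant, the single test g + zg ≤ f holds if and only if f = g and zg =
          -- 0. Once a bucket f with a nonzero entry has been met, f stays behind g and never moves
          -- again.
          run-if≤ (ev-⊕ evIdx evZ (2n≤M (≤-trans (+-mono-≤ (<⇒≤ (<-≤-trans g<G G≤n)) (common≤n _ j))
            (≤-trans (≤-reflexive (sym (2n≡n+n n))) (*-monoʳ-≤ 2 (n≤1+n n))))))
            evF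
            (λ l → run-set ev0 ev0 (ev-⊕ evF ev1
              (≤-trans (≤-reflexive (+-comm f 1))
              (<⇒≤ (≤-<-trans (≤-trans (s≤s f≤g) g<G) (≤-<-trans G≤n n<M)))))
              (subst (First i j (suc g)) (sym (+-comm f 1))
                (advance (≤-antisym f≤g (≤-trans (m≤m+n g _) l)) l)))
            (λ l → run-skip (first (m≤n⇒m≤1+n f≤g) empty (λ m → stay m l)))
          where
          e′ = env-agree {L} {s₀} {s′} ag (refl , refl , refl , refl , refl , refl) e₀
          f = words s′ 16 0 0
          zg = common (i * G + g) j
          row<p : i * G + g < p
          row<p = ≤-trans (+-monoʳ-< (i * G) g<G)
            (≤-trans (≤-reflexive (+-comm (i * G) G)) (*-monoˡ-≤ G i<n))
          evIdx : Ev s′ (var 11) g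
          evIdx = ev-var g≡ (<⇒≤ (<-trans g<G (≤-<-trans G≤n n<M)))
          evF : Ev s′ (var 16) f
          evF = ev-var refl (<⇒≤ (≤-<-trans f≤g (<-trans g<G (≤-<-trans G≤n n<M))))
          evZ : Ev s′ (word 25 cellIndex (var 10)) zg
          evZ = ev-word
            (ev-⊕ (ev-⊗ (ev-var (keep {L} ag 9 refl i≡) (n≤M (<⇒≤ i<n))) (evG e′)
                     (≤-trans (m≤m+n (i * G) g) (<⇒≤ (<-trans row<p p<M)))) evIdx
                       (<⇒≤ (<-trans row<p p<M)))
            (ev-var (keep {L} ag 10 refl j≡) (n≤M (<⇒≤ j<n)))
            (keep {L} ag 25 refl (z _ _ row<p j<n)) (n≤M (common≤n (i * G + g) j))
          advance : f ≡ g → g + zg ≤ f → First i j (suc g) (suc f)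
          advance eq l = first (s≤s f≤g) empty′ (λ m → ⊥-elim (<⇒≢ m (cong suc eq)))
            where
            zg≡0 : zg ≡ 0
            zg≡0 = n≤0⇒n≡0 (+-cancelˡ-≤ g zg 0
              (≤-trans l (≤-reflexive (trans eq (sym (+-identityʳ g))))))
            empty′ : ∀ {g′} → g′ < suc f → common (i * G + g′) j ≡ 0
            empty′ (s≤s m) with m≤n⇒m<n∨m≡n m
            ... | inj₁ m′ = empty m′
            ... | inj₂ refl = trans (cong (λ x → common (i * G + x) j) eq) zg≡0
          stay : f < suc g → f < g + zg → common (i * G + f) j ≢ 0
          stay (s≤s m) l with m≤n⇒m<n∨m≡n m
          ... | inj₁ m′ = nonzero m′
          ... | inj₂ eq = λ zf → <⇒≱ l
            (≤-reflexive (trans (cong (g +_)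
            (trans (cong (λ x → common (i * G + x) j) (sym eq)) zf))
                              (trans (+-identityʳ g) (sym eq))))

      record Scanned (f x c : ℕ) : Set where
        constructor scanned
        field
          bit      : c ≡ 0 ⊎ c ≡ 1
          sound    : c ≡ 1 → Attained i j
          complete : ∀ {x′} → x′ < x → Good i j f x′ → c ≡ 1

      run-scan : ∀ s f → EnvOf s → words s 9 0 0 ≡ i → words s 10 0 0 ≡ j → words s 16 0 0 ≡ f →
        f ≤ G →
        Run scan s (1 + forCost sz 5) (λ s′ → Scanned f sz (words s′ 18 0 0))
      run-scan s f e i≡ j≡ f≡ f≤G = run-set⨾ ev0 ev0 ev0
        (run-for (λ x s′ → Scanned f x (words s′ 18 0 0)) s₀ sz<M refl (λ _ _ _ h → h)
          (λ _ s′ ag _ → evSz (env-agree {L} {s₀} {s′} ag (refl , refl , refl , refl , refl , refl)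
            e₀)) step
          (scanned (inj₁ refl) (λ ()) (λ ())))
        where
        s₀ = put s 18 0 0 0
        L = forLoop 11 (var 3) scanStep
        e₀ : EnvOf s₀
        e₀ = record { Env e }
        step : ∀ x s′ → x < sz → Agree L s₀ s′ → words s′ 11 0 0 ≡ x →
          Scanned f x (words s′ 18 0 0) →
               Run scanStep s′ 5 (λ s″ → Scanned f (suc x) (words s″ 18 0 0))
        step x s′ x<sz ag x≡ (scanned bit sound complete) =
          run-if≤ (ev-⊕ evPos ev1 (4n≤M pos+1≤)) (evN e′)
            (λ l → let pos<n = ≤-trans (≤-reflexive (+-comm 1 pos)) l in
              run-set⨾ ev0 ev0 (ev-word evI evPos (cong (λ w → w i pos) (Env.ord≡ e′))
                (n≤M (<⇒≤ (Order.ord< (order i i<n) pos<n))))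
                (run-if≤ (ev-word {x = 1} {v = B (ord i pos) j}
                  (ev-var {x = 12} refl (n≤M (<⇒≤ (Order.ord< (order i i<n) pos<n)))) evJ₁
                            (cong (λ w → w (ord i pos) j) (Env.B≡ e′))
                              (n≤M (≤-trans (B≤1 _ j (Order.ord< (order i i<n) pos<n) j<n) 1≤n)))
                              ev0
                  (λ B≤0 → run-ifᶠ {a = A i (ord i pos)} {b = T i j}
                    (ev-real (ev-var {x = 9} i≡′ (n≤M (<⇒≤ i<n)))
                      (ev-var {x = 12} refl (n≤M (<⇒≤ (Order.ord< (order i i<n) pos<n))))
                      (cong (λ w → w i (ord i pos)) (Env.A≡ e′)))
                    (ev-real (ev-var {x = 9} i≡′ (n≤M (<⇒≤ i<n))) evJ₁
                      (cong (λ w → w i j) (Env.T≡ e′)))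
                    (λ A≤T → run-set ev0 ev0 ev1 (scanned (inj₂ refl)
                      (λ _ → ord i pos , Order.ord< (order i i<n) pos<n , n≤0⇒n≡0 B≤0 , A≤T)
                        (λ _ _ → refl)))
                    (λ A≰T → run-skip (unchanged (λ g → A≰T (proj₂ (proj₂ g))))))
                  (λ 0<B → run-if-skip (unchanged (λ g → <⇒≢ 0<B (sym (proj₁ (proj₂ g))))))))
            (λ l → run-if-skip (unchanged
              (λ g → <⇒≱ l (≤-trans (≤-reflexive (+-comm pos 1)) (proj₁ g)))))
          where
          e′ = env-agree {L} {s₀} {s′} ag (refl , refl , refl , refl , refl , refl) e₀
          pos = f * sz + x
          f*sz≤n : f * sz ≤ n
          f*sz≤n = ≤-trans (*-monoˡ-≤ sz f≤G) G*sz≤n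
          -- The guard is evaluated even where it fails. Positions may lie beyond n, since the last
          -- bucket is incomplete and the bucket size can be as large as 2n.
          pos+1≤ : pos + 1 ≤ 4 * suc n
          pos+1≤ = ≤-trans (≤-reflexive
            (trans (+-assoc (f * sz) x 1) (cong (f * sz +_) (+-comm x 1))))
            (≤-trans (+-mono-≤ f*sz≤n (≤-trans x<sz sz≤2n))
              (≤-trans (*-monoˡ-≤ n {3} {4} (s≤s (s≤s (s≤s z≤n)))) (*-monoʳ-≤ 4 (n≤1+n n))))
          i≡′ = keep {L} ag 9 refl i≡
          evI : Ev s′ (var 9) i
          evI = ev-var i≡′ (n≤M (<⇒≤ i<n))
          evJ₁ : Ev (put s′ 12 0 0 (ord i pos)) (var 10) j
          evJ₁ = ev-var {x = 10} (keep {L} ag 10 refl j≡) (n≤M (<⇒≤ j<n))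
          evPos : Ev s′ position pos
          evPos = ev-⊕ (ev-⊗ (ev-var (keep {L} ag 16 refl f≡) (n≤M (≤-trans f≤G G≤n))) (evSz e′)
            (n≤M f*sz≤n))
                    (ev-var x≡ (<⇒≤ (<-trans x<sz sz<M))) (≤-trans (m≤m+n pos 1) (4n≤M pos+1≤))
          unchanged : ¬ Good i j f x → Scanned f (suc x) (words s′ 18 0 0)
          unchanged bad = scanned bit sound λ { (s≤s m) g → rest m g (m≤n⇒m<n∨m≡n m) }
            where
            rest : ∀ {x′} → x′ ≤ x → Good i j f x′ → x′ < x ⊎ x′ ≡ x → words s′ 18 0 0 ≡ 1
            rest _ g (inj₁ m)    = complete m g
            rest _ g (inj₂ refl) = ⊥-elim (bad g)
          run-if-skip : ∀ {s c} {Q : State → Set} → Q s → Run skip s (suc c) Q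
          run-if-skip q = weaken (s≤s z≤n) (run-skip q)

      run-cell : ∀ s → EnvOf s → words s 9 0 0 ≡ i → words s 10 0 0 ≡ j →
        Filled p n (words s 25) common →
        Run cell s cellCost (λ s′ → Answer i j (words s′ 2 i j) × OtherCells 2 i j s s′)
      run-cell s e i≡ j≡ z =
        run-findFirst s e i≡ j≡ z >>> λ s₁ ag₁ fst →
        run-scan s₁ _ (env-agree {findFirst} ag₁ (refl , refl , refl , refl , refl , refl) e)
          (keep {findFirst} ag₁ 9 refl i≡) (keep {findFirst} ag₁ 10 refl j≡) refl (First.f≤g fst)
            >>> λ s₂ ag₂ sc →
        run-set (ev-var (keep {scan} ag₂ 9 refl (keep {findFirst} ag₁ 9 refl i≡)) (n≤M (<⇒≤ i<n)))
          (ev-var (keep {scan} ag₂ 10 refl (keep {findFirst} ag₁ 10 refl j≡)) (n≤M (<⇒≤ j<n)))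
          (ev-var refl (bit≤M (Scanned.bit sc)))
          (subst (Answer i j) (sym (update-same (words s₂) 2 i j (words s₂ 18 0 0)))
            (Scanned.bit sc , Scanned.sound sc , λ w → answer fst sc (scan-complete i<n fst w)) ,
           λ i′ j′ ne → trans (update-cell (words s₂) 2 i j (words s₂ 18 0 0) i′ j′ ne)
             (cong (λ w → w i′ j′) (trans (proj₁ (ag₂ 2 refl)) (proj₁ (ag₁ 2 refl)))))
        where
        bit≤M : ∀ {c} → c ≡ 0 ⊎ c ≡ 1 → c ≤ M
        bit≤M (inj₁ refl) = z≤n
        bit≤M (inj₂ refl) = n≤M 1≤n
        answer : ∀ {f c} → First i j G f → Scanned f sz c → ∃[ x ] (x < sz × Good i j f x) → c ≡ 1
        answer _ sc (x , l , g) = Scanned.complete sc l g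

    run-query : ∀ s → EnvOf s → Filled p n (words s 25) common →
      Run query s (gridCost n n cellCost) (λ s′ → ∀ i j → i < n → j < n →
        Answer i j (words s′ 2 i j))
    run-query s e z =
      run-grid 2 Answer s n<M n<M refl refl refl refl
        (λ s′ ag → let e′ = env-agree {query} ag (refl , refl , refl , refl , refl , refl) e in evN e′ , evN e′)
        (λ i j s′ i<n j<n ag i≡ j≡ →
          run-cell i<n j<n s′ (env-agree {query} ag (refl , refl , refl , refl , refl , refl) e) i≡
            j≡
            (λ r j l m → keep {query} ag 25 refl (z r j l m)))

  -- The running time outside the multiplication

  totalCost : (n Q G sz : ℕ) → ℕ
  totalCost n Q G sz =
    (3 + n * 3 + (3 + (2 * n) * 3 + 1)) +
    ((2 + n * (2 + ((2 + (2 * n) * 3) +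
      ((2 + n * (2 + (3 + Q * 6))) + (2 + n * (2 + (6 + Q * 6))))))) +
     ((((2 + (n * G) * (2 + (2 + n * (2 + 1)))) + (2 + (n * G) * (2 + (2 + n * (2 + 1))))) +
       (((2 + n * (2 + (2 + n * (2 + 1)))) + (2 + n * (2 + (2 + n * (2 + 1))))) + 3)) +
      (2 + n * (2 + (2 + n * (2 + ((1 + (2 + G * 4)) + ((1 + (2 + sz * 7)) + 1))))))))

  -- The left-hand side is `totalCost` written out, so that the ring solver is given a polynomial in
  -- plain sight.
  totalCost-expand : ∀ n Q G sz →
    (3 + n * 3 + (3 + (2 * n) * 3 + 1)) +
    ((2 + n * (2 + ((2 + (2 * n) * 3) +
      ((2 + n * (2 + (3 + Q * 6))) + (2 + n * (2 + (6 + Q * 6))))))) +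
     ((((2 + (n * G) * (2 + (2 + n * (2 + 1)))) + (2 + (n * G) * (2 + (2 + n * (2 + 1))))) +
       (((2 + n * (2 + (2 + n * (2 + 1)))) + (2 + n * (2 + (2 + n * (2 + 1))))) + 3)) +
      (2 + n * (2 + (2 + n * (2 + ((1 + (2 + G * 4)) + ((1 + (2 + sz * 7)) + 1)))))))) ≡
    22 * 1 + 29 * n + 34 * (n * n) + 12 * (Q * (n * n)) + 8 * (n * G) + 10 * (n * G * n) + 7 *
      (n * n * sz)
  totalCost-expand = solve-∀

  -- 122 is the sum of the coefficients of the expanded polynomial. Each of its monomials is at most
  -- Q(n²s + n²G), as n, Q and s are positive.
  totalCost-bound : ∀ n Q G sz → 1 ≤ n → 1 ≤ Q → 1 ≤ sz →
    totalCost n Q G sz ≤ 122 * (Q * (n * n * sz + n * G * n))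
  totalCost-bound n Q G sz 1≤n 1≤Q 1≤sz = begin
    totalCost n Q G sz ≡⟨ totalCost-expand n Q G sz ⟩
    22 * 1 + 29 * n + 34 * (n * n) + 12 * (Q * (n * n)) + 8 * (n * G) + 10 * (n * G * n) + 7 *
      (n * n * sz)
      ≤⟨ +-mono-≤ (+-mono-≤ (+-mono-≤ (+-mono-≤ (+-mono-≤ (+-mono-≤
           (*-monoʳ-≤ 22 (≤-trans 1≤n n≤W)) (*-monoʳ-≤ 29 n≤W)) (*-monoʳ-≤ 34 n²≤W))
           (*-monoʳ-≤ 12 Qn²≤W)) (*-monoʳ-≤ 8 (≤-trans (m≤m*n (n * G) n) V≤W))) (*-monoʳ-≤ 10 V≤W))
             (*-monoʳ-≤ 7 U≤W) ⟩
    22 * W + 29 * W + 34 * W + 12 * W + 8 * W + 10 * W + 7 * W ≡⟨ collect W ⟩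
    122 * W ∎
    where
    open ≤-Reasoning
    instance
      nz : NonZero n
      nz = >-nonZero 1≤n
      sznz : NonZero sz
      sznz = >-nonZero 1≤sz
      Qnz : NonZero Q
      Qnz = >-nonZero 1≤Q
    U = n * n * sz
    V = n * G * n
    W = Q * (U + V)
    collect : ∀ W → 22 * W + 29 * W + 34 * W + 12 * W + 8 * W + 10 * W + 7 * W ≡ 122 * W
    collect = solve-∀
    U≤W : U ≤ W
    U≤W = ≤-trans (m≤m+n U V) (m≤n*m (U + V) Q)
    V≤W : V ≤ W
    V≤W = ≤-trans (m≤n+m V U) (m≤n*m (U + V) Q)
    n²≤U : n * n ≤ U
    n²≤U = m≤m*n (n * n) sz
    n²≤W : n * n ≤ W
    n²≤W = ≤-trans n²≤U U≤W
    n≤W : n ≤ W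
    n≤W = ≤-trans (m≤m*n n n) n²≤W
    Qn²≤W : Q * (n * n) ≤ W
    Qn²≤W = *-monoʳ-≤ Q (≤-trans n²≤U (m≤m+n U V))

  -- When a target is attained

  module MinMax (F : CompleteOrderedField) where
    private module R = CompleteOrderedField F
    open R using (Carrier; _≈_) renaming (_≤_ to _≤ᶠ_)
    open Machine F
    open TargetProduct F
    private
      module E  = TotalOrder extendedOrder
      module Mn = Min extendedOrder
      module Mx = Max extendedOrder
    open import Relation.Binary.Construct.Add.Extrema.NonStrict _≤ᶠ_ using ([≤]-injective)
    import Relation.Binary.Construct.Add.Extrema.NonStrict _≤ᶠ_ as X

    -- The threshold is finite, so the initial value `⊤±` of the fold never lies below it and needs
    -- no case.
    minimum-below : ∀ {n x} (f : Fin n → Carrier ±) →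
      foldr _⊓_ ⊤± f ≤± [ x ] ⇔ (∃[ k ] f k ≤± [ x ])
    minimum-below {n} {x} f = mk⇔ (to f) (λ (k , l) → from f k l)
      where
      to : ∀ {n} (f : Fin n → Carrier ±) → foldr _⊓_ ⊤± f ≤± [ x ] → ∃[ k ] f k ≤± [ x ]
      to {suc n} f l with Mn.⊓-sel (f zero) (foldr _⊓_ ⊤± (λ k → f (suc k)))
      ... | inj₁ e = zero , E.trans (E.reflexive (E.Eq.sym e)) l
      ... | inj₂ e with to (λ k → f (suc k)) (E.trans (E.reflexive (E.Eq.sym e)) l)
      ...   | k , h = suc k , h
      from : ∀ {n} (f : Fin n → Carrier ±) k → f k ≤± [ x ] → foldr _⊓_ ⊤± f ≤± [ x ]
      from f zero    l = E.trans (Mn.x⊓y≤x (f zero) (foldr _⊓_ ⊤± (λ k → f (suc k)))) l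
      from f (suc k) l = E.trans (Mn.x⊓y≤y (f zero) (foldr _⊓_ ⊤± (λ k → f (suc k))))
        (from (λ k → f (suc k)) k l)

    maximum-below : ∀ {a x} b → [ a ] ⊔ extended b ≤± [ x ] ⇔ (b ≡ -∞ × a ≤ᶠ x)
    maximum-below {a} {x} b = mk⇔ (to b) (λ { (refl , l) → Mx.⊔-lub X.[ l ] (X.⊥±≤ [ x ]) })
      where
      to : ∀ b → [ a ] ⊔ extended b ≤± [ x ] → b ≡ -∞ × a ≤ᶠ x
      to -∞ l = refl , [≤]-injective (E.trans (Mx.x≤x⊔y [ a ] ⊥±) l)
      to +∞ l with E.trans (Mx.x≤y⊔x [ a ] ⊤±) l
      ... | ()

    module _ {n : ℕ} (A : Matrix Carrier n n) (B : Matrix Infinity n n) (T : Matrix Carrier n n)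
      (restricted : Restricted A B T) where
      -- The restriction supplies one inequality, so equality means that the minimum is at most
      -- `T i j`. Some maximum is then at most this finite value, which rules out b k j = +∞.
      attained : ∀ i j → [ T i j ] ≈± minMax A B i j ⇔ (∃[ k ] (B k j ≡ -∞ × A i k ≤ᶠ T i j))
      attained i j = mk⇔
        (λ e → let k , l = to (minimum-below f) (E.reflexive (E.Eq.sym e)) in k , to (maximum-below (B k j)) l)
        (λ (k , h) → E.antisym (restricted i j)
          (from (minimum-below f) (k , from (maximum-below (B k j)) h)))
        where
        open Equivalence using (to; from)
        f = λ k → [ A i k ] ⊔ extended (B k j)

      infinityBit-zero : ∀ {b} → infinityBit b ≡ 0 → b ≡ -∞
      infinityBit-zero { -∞} _ = refl

      -- Passes from memory, indexed by natural numbers and holding reals only up to `≈`, to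
      -- matrices over `Fin n`. The output matrix is read off the memory, whose cells are known to
      -- hold 0 or 1.
      product-from-bits : (a u : Array Carrier) (b c : Array ℕ) → HoldsReals a A →
        HoldsWords b (λ i j → infinityBit (B i j)) →
        HoldsReals u T →
        (∀ i j → i < n → j < n → (c i j ≡ 0 ⊎ c i j ≡ 1) ×
          (c i j ≡ 1 → ∃[ k ] (k < n × b k j ≡ 0 × a i k ≤ᶠ u i j)) ×
          (∃[ k ] (k < n × b k j ≡ 0 × a i k ≤ᶠ u i j) → c i j ≡ 1)) →
        ∃[ C ] (IsTargetProduct A B T C × HoldsWords c (λ i j → toℕ (C i j)))
      product-from-bits a u b c a≈ b≡ u≈ answer = C , correct , holds
        where
        open Equivalence using (to; from)
        toBit : ℕ → Fin 2
        toBit 0       = zero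
        toBit (suc _) = suc zero
        C : Matrix (Fin 2) n n
        C i j = toBit (c (toℕ i) (toℕ j))
        holds : ∀ i j → c (toℕ i) (toℕ j) ≡ toℕ (C i j)
        holds i j with c (toℕ i) (toℕ j) | proj₁ (answer (toℕ i) (toℕ j) (toℕ<n i) (toℕ<n j))
        ... | _ | inj₁ refl = refl
        ... | _ | inj₂ refl = refl
        correct : IsTargetProduct A B T C
        correct i j = mk⇔
          (λ C≡1 → from (attained i j)
            (fromMemory (proj₁ (proj₂ ans) (trans (holds i j) (cong toℕ C≡1)))))
          (λ e → cong toBit (proj₂ (proj₂ ans) (toMemory (to (attained i j) e))))
          where
          ans = answer (toℕ i) (toℕ j) (toℕ<n i) (toℕ<n j)
          fromMemory : ∃[ k ] (k < n × b k (toℕ j) ≡ 0 × a (toℕ i) k ≤ᶠ u (toℕ i) (toℕ j)) →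
            ∃[ k ] (B k j ≡ -∞ × A i k ≤ᶠ T i j)
          fromMemory (k , k<n , b≡0 , l) = fromℕ< k<n ,
            infinityBit-zero (trans (sym (b≡ (fromℕ< k<n) j))
              (trans (cong (λ z → b z (toℕ j)) (toℕ-fromℕ< k<n)) b≡0)) ,
            RealPower.≤-resp₂ F (R.trans (R.reflexive (cong (a (toℕ i)) (sym (toℕ-fromℕ< k<n))))
              (a≈ i (fromℕ< k<n))) (u≈ i j) l
          toMemory : ∃[ k ] (B k j ≡ -∞ × A i k ≤ᶠ T i j) →
            ∃[ k ] (k < n × b k (toℕ j) ≡ 0 × a (toℕ i) k ≤ᶠ u (toℕ i) (toℕ j))
          toMemory (k , B≡ , l) = toℕ k , toℕ<n k , trans (b≡ k j) (cong infinityBit B≡) ,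
            RealPower.≤-resp₂ F (R.sym (a≈ i k)) (R.sym (u≈ i j)) l

  -- Assembling correctness and running time

  module Main (F : CompleteOrderedField) (t : CompleteOrderedField.Carrier F)
      (0≤t : CompleteOrderedField._≤_ F (CompleteOrderedField.0# F) t)
      (t≤1 : CompleteOrderedField._≤_ F t (CompleteOrderedField.1# F)) where
    private module R = CompleteOrderedField F
    open R using (Carrier; 0#; 1#; fromℕ; _-_)
      renaming (_≤_ to _≤ᶠ_; _*_ to _*ᶠ_; _+_ to _+ᶠ_)
    open RealPower F using (≤-resp₂; 0≤fromℕ; fromℕ-mono-≤; _^ᴿ_; RationalPower;
      RationalPower-bounded)
      renaming (*-monoʳ-≤ to *ᶠ-monoʳ-≤; *-monoˡ-≤ to *ᶠ-monoˡ-≤; +-mono-≤ to +ᶠ-mono-≤;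
        +-monoʳ-≤ to +ᶠ-monoʳ-≤)
    open Mult R.semiring using (×-homo-+; ×1-homo-*)
    open Machine F
    open Execution F
    open Algorithm F
    open Multiplication F
    open MatrixMultiplication F
    open TargetProduct F
    open Bounds F t 0≤t t≤1

    power≥0 : ∀ n α → 0# ≤ᶠ n ^ᴿ α
    power≥0 n α = proj₁ (proj₂
      (R.complete (RationalPower n α) (0# , inj₁ R.refl) (RationalPower-bounded n α))) 0#
      (inj₁ R.refl)

    module Big (S : Carrier) (0≤S : 0# ≤ᶠ S) where
      -- A record, so that x and k can be inferred.
      record _≲_ (x k : ℕ) : Set where
        constructor bounded
        field
          bound : fromℕ x ≤ᶠ fromℕ k *ᶠ S

      ≲-+ : ∀ {x y k l} → x ≲ k → y ≲ l → (x + y) ≲ (k + l)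
      ≲-+ {x} {y} {k} {l} (bounded p) (bounded q) = bounded (≤-resp₂ (R.sym (×-homo-+ 1# x y))
        (R.trans (R.sym (R.distribʳ S (fromℕ k) (fromℕ l))) (R.*-congʳ (R.sym (×-homo-+ 1# k l))))
          (+ᶠ-mono-≤ p q))

      ≲-* : ∀ c {x k} → x ≲ k → (c * x) ≲ (c * k)
      ≲-* c {x} {k} (bounded p) = bounded (≤-resp₂ (R.sym (×1-homo-* c x))
        (R.trans (R.sym (R.*-assoc _ _ _)) (R.*-congʳ (R.sym (×1-homo-* c k))))
          (*ᶠ-monoʳ-≤ (0≤fromℕ c) p))

      ≲-mono : ∀ {x y k l} → x ≤ y → k ≤ l → y ≲ k → x ≲ l
      ≲-mono x≤y k≤l (bounded p) =
        bounded (R.≤-trans (fromℕ-mono-≤ x≤y) (R.≤-trans p (*ᶠ-monoˡ-≤ 0≤S (fromℕ-mono-≤ k≤l))))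

    -- As `suc n` is at least 2, two of the factors absorb the 4. The exponent also exceeds ℓ, so
    -- the words suffice for the multiplication program.
    fits : ∀ n ℓ → 1 ≤ n → 4 * (suc n * suc n) ≤ suc n ^ (4 + ℓ)
    fits n ℓ 1≤n = ≤-trans
      (≤-trans (*-mono-≤ (*-mono-≤ (s≤s 1≤n) (s≤s 1≤n))
        (≤-reflexive (cong (suc n *_) (sym (*-identityʳ (suc n))))))
        (≤-reflexive (*-assoc (suc n) (suc n) (suc n ^ 2))))
      (^-monoʳ-≤ (suc n) (m≤m+n 4 ℓ))

    module Correctness {P : Program} {ℓ K : ℕ} {ω : Carrier} (n : ℕ) (1≤n : 1 ≤ n)
        (multiplies : Multiplies P ℓ K n (fromℕ 2 - t) ω)
        (A : Matrix Carrier n n) (B : Matrix Infinity n n) (T : Matrix Carrier n n)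
          (restricted : Restricted A B T)
        (s : State) (input : TargetInput A B T s) where
      open TargetInput input

      M : ℕ
      M = suc n ^ (4 + ℓ)

      S : Carrier
      S = n ^ᴿ (fromℕ 2 +ᶠ t) +ᶠ n ^ᴿ ω

      open Hoare F M using (Run; run; forCost)
      open Grid F M using (gridCost)

      -- κ is a variable because unfolding the actual constant is expensive.
      Fast : ℕ → ℕ → Set
      Fast κ τ = fromℕ τ ≤ᶠ fromℕ (κ * suc ⌊log₂ n ⌋ ^ 1) *ᶠ S

      Outcome : ℕ → Set
      Outcome κ = ∃[ s′ ] ∃[ τ ] (M ⊢ targetProduct t P , s ⇓ s′ ⟨ τ ⟩ ×
        (∃[ C ] (IsTargetProduct A B T C × TargetOutput C s′)) × Fast κ τ)

      bit≤1 : ∀ b → infinityBit b ≤ 1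
      bit≤1 -∞ = z≤n
      bit≤1 +∞ = ≤-refl

      B≤1 : ∀ k j → k < n → j < n → words s 1 k j ≤ 1
      B≤1 k j k<n j<n = ≤-trans
        (≤-reflexive (subst₂ (λ x y → words s 1 x y ≡ infinityBit (B (fromℕ< k<n) (fromℕ< j<n)))
        (toℕ-fromℕ< k<n) (toℕ-fromℕ< j<n) (right (fromℕ< k<n) (fromℕ< j<n))))
          (bit≤1 (B (fromℕ< k<n) (fromℕ< j<n)))

      module AfterSort {s₁ s₂ : State} {τ₁ τ₂ : ℕ} (e₁ : M ⊢ setup t , s ⇓ s₁ ⟨ τ₁ ⟩)
        (e₂ : M ⊢ sortRows , s₁ ⇓ s₂ ⟨ τ₂ ⟩)
          {Q m : ℕ} (ps : Setup.Params F t M n 1≤n (fits n ℓ 1≤n) Q m)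
          (sz≡ : words s₁ 3 0 0 ≡ 2 ^ m) (G≡ : words s₁ 4 0 0 ≡ _/_ n (2 ^ m) {{m^n≢0 2 m}})
          (order : ∀ i → i < n → Tournament.Order F n (reals s 0 i) (words s₂ 14 i) (words s₂ 15 i))
            where
        open Setup.Params ps

        sz : ℕ
        sz = 2 ^ m

        instance
          sz≢0 : NonZero sz
          sz≢0 = m^n≢0 2 m

        G : ℕ
        G = n / sz

        sz≤2n : sz ≤ 2 * n
        sz≤2n = ≤-trans (^-monoʳ-≤ 2 m≤Q) (subst (λ q → 2 ^ q ≤ 2 * n) (sym Q≡) (*-monoʳ-≤ 2 2^L≤n))

        n<G*sz+sz : n < G * sz + sz
        n<G*sz+sz = ≤-trans (s≤s (≤-reflexive (m≡m%n+[m/n]*n n sz)))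
          (≤-trans (+-monoˡ-≤ (G * sz) (m%n<n n sz)) (≤-reflexive (+-comm sz (G * sz))))

        open Buckets F M n 1≤n (fits n ℓ 1≤n) (reals s 0) (reals s 1) (words s 1) B≤1 sz G
          (m^n>0 2 m) sz≤2n
          (m/n*n≤m n sz) n<G*sz+sz (words s₂ 14) (words s₂ 15) order public

        rows≤ : fromℕ (n * G) ≤ᶠ n ^ᴿ (fromℕ 2 - t)
        rows≤ = rows-bound 1≤n (fits n ℓ 1≤n) ps

        unchanged : ∀ x → touches (setup t) x ≡ false → touches sortRows x ≡ false →
                    words s₂ x ≡ words s x × reals s₂ x ≡ reals s x
        unchanged x p q = trans (proj₁ (frame e₂ x q)) (proj₁ (frame e₁ x p)) ,
          trans (proj₂ (frame e₂ x q)) (proj₂ (frame e₁ x p))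

        env₂ : EnvOf s₂
        env₂ = env
          (trans (cong (λ f → f 0 0) (proj₁ (unchanged 0 refl refl))) size)
          (proj₁ (unchanged 1 refl refl))
          (trans (cong (λ f → f 0 0) (proj₁ (frame e₂ 3 refl))) sz≡)
          (trans (cong (λ f → f 0 0) (proj₁ (frame e₂ 4 refl))) G≡)
          refl refl (proj₂ (unchanged 0 refl refl)) (proj₂ (unchanged 1 refl refl))

        0≤a : 0# ≤ᶠ n ^ᴿ (fromℕ 2 +ᶠ t)
        0≤a = power≥0 n (fromℕ 2 +ᶠ t)

        0≤b : 0# ≤ᶠ n ^ᴿ ω
        0≤b = power≥0 n ω

        open Big S (≤-resp₂ (R.+-identityʳ 0#) R.refl (+ᶠ-mono-≤ 0≤a 0≤b))

        Q≤log : Q ≤ suc ⌊log₂ n ⌋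
        Q≤log = ≤-trans (≤-reflexive Q≡)
          (s≤s (≤-trans (≤-reflexive (sym (⌊log₂[2^n]⌋≡n L))) (⌊log₂⌋-mono-≤ 2^L≤n)))

        1≤Q : 1 ≤ Q
        1≤Q = ≤-trans (s≤s z≤n) (≤-reflexive (sym Q≡))

        b≲ : ∀ {x} → fromℕ x ≤ᶠ fromℕ K *ᶠ n ^ᴿ ω → x ≲ K
        b≲ l = bounded (R.≤-trans l
          (*ᶠ-monoʳ-≤ (0≤fromℕ K) (≤-resp₂ (R.+-identityˡ _) R.refl (+ᶠ-mono-≤ 0≤a R.≤-refl))))

        scan≲ : (n * n * sz) ≲ 4
        scan≲ = bounded (R.≤-trans (scan-bound 1≤n (fits n ℓ 1≤n) ps)
          (*ᶠ-monoʳ-≤ (0≤fromℕ 4) (≤-resp₂ (R.+-identityʳ _) R.refl (+ᶠ-mono-≤ R.≤-refl 0≤b))))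

        -- `scan-bound` pays for n²s with constant 4, and `output-size` for n²G with the constant K
        -- of the multiplication. Q becomes the logarithmic factor, and c is the multiplication
        -- itself, with K once more.
        time : ∀ {τ c} k → τ ≤ k * (Q * (n * n * sz + n * G * n)) + c →
          fromℕ c ≤ᶠ fromℕ K *ᶠ n ^ᴿ ω → Fast (k * (4 + K) + K) τ
        time {τ} {c} k τ≤ c≤ = _≲_.bound (≲-mono τ≤
          (≤-trans (+-mono-≤ (*-monoʳ-≤ k (*-monoˡ-≤ (4 + K) Q≤log)) (m≤n*m K (suc ⌊log₂ n ⌋)))
            (≤-reflexive (factor k (4 + K) K (suc ⌊log₂ n ⌋))))
          (≲-+ (≲-* k (≲-* Q (≲-+ scan≲ (b≲ (output-size {P} {ℓ} {K} multiplies (n * G) rows≤)))))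
            (b≲ c≤)))
          where
          factor : ∀ k x y u → k * (u * x) + u * y ≡ (k * x + y) * (u * 1)
          factor = solve-∀

        cost₁ cost₂ cost₅ : ℕ
        cost₁ = 3 + n * 3 + (3 + (2 * n) * 3 + 1)
        cost₂ = forCost n (Sort.rowCost F M n 1≤n (fits n ℓ 1≤n) (reals s 0) Q n<2^Q)
        cost₅ = gridCost n n cellCost

        finish : τ₁ ≤ cost₁ → τ₂ ≤ cost₂ → ∀ k →
          totalCost n Q G sz ≤ k * (Q * (n * n * sz + n * G * n)) →
                 Outcome (k * (4 + K) + K)
        finish b₁ b₂ k total≤ = afterBuild (run-build s₂ env₂)
          where
          sum≤ : ∀ {τ₃ τ₄ τ₅ c} → τ₃ ≤ buildCost → τ₄ ≤ c → τ₅ ≤ cost₅ →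
                 τ₁ + (τ₂ + (τ₃ + (τ₄ + τ₅))) ≤ k * (Q * (n * n * sz + n * G * n)) + c
          sum≤ {c = c} b₃ b₄ b₅ = ≤-trans (+-mono-≤ b₁ (+-mono-≤ b₂ (+-mono-≤ b₃ (+-mono-≤ b₄ b₅))))
            (≤-trans (≤-reflexive (swap cost₁ cost₂ buildCost c cost₅)) (+-monoˡ-≤ c total≤))
            where
            swap : ∀ v w x y z → v + (w + (x + (y + z))) ≡ v + (w + (x + z)) + y
            swap = solve-∀
          afterQuery : ∀ {s₃ s₄ τ₃ τ₄ c} → M ⊢ build , s₂ ⇓ s₃ ⟨ τ₃ ⟩ → τ₃ ≤ buildCost →
            M ⊢ shift P , s₃ ⇓ s₄ ⟨ τ₄ ⟩ → τ₄ ≤ c → fromℕ c ≤ᶠ fromℕ K *ᶠ n ^ᴿ ω →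
            Run query s₄ cost₅ (λ s′ → ∀ i j → i < n → j < n → Answer i j (words s′ 2 i j)) →
              Outcome (k * (4 + K) + K)
          afterQuery e₃ b₃ e₄ b₄ c≤ (run {s₅} e₅ b₅ answer) =
            s₅ , _ , seq e₁ (seq e₂ (seq e₃ (seq e₄ e₅))) ,
            MinMax.product-from-bits F A B T restricted (reals s 0) (reals s 1) (words s 1)
              (words s₅ 2) left right target answer ,
            time k (sum≤ b₃ b₄ b₅) c≤
          afterMultiply : ∀ {s₃ τ₃} → M ⊢ build , s₂ ⇓ s₃ ⟨ τ₃ ⟩ → τ₃ ≤ buildCost →
            ∃[ c ] (fromℕ c ≤ᶠ fromℕ K *ᶠ n ^ᴿ ω ×
              Run (shift P) s₃ c (λ s′ → Filled p n (words s′ 25) common)) →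
            Outcome (k * (4 + K) + K)
          afterMultiply {s₃} e₃ b₃ (c , c≤ , run {s₄} e₄ b₄ filled) = afterQuery e₃ b₃ e₄ b₄ c≤
            (run-query s₄ (env-agree {shift P} (frame e₄) (shift-preserves P)
              (env-agree {build} (frame e₃) (refl , refl , refl , refl , refl , refl) env₂)) filled)
          afterBuild : Run build s₂ buildCost BuiltOf → Outcome (k * (4 + K) + K)
          afterBuild (run {s₃} e₃ b₃ factors) = afterMultiply e₃ b₃
            (run-multiply {P} {ℓ} {K} (^-monoʳ-≤ (suc n) (m≤n+m ℓ 4)) multiplies rows≤ s₃ factors)

      outcome : ∀ k → (∀ Q G sz → 1 ≤ Q → 1 ≤ sz →
        totalCost n Q G sz ≤ k * (Q * (n * n * sz + n * G * n))) →
                Outcome (k * (4 + K) + K)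
      outcome k total≤ = afterSetup (Setup.run-setup F t M n 1≤n (fits n ℓ 1≤n) 0≤t t≤1 s size)
        where
        afterSetup : Run (setup t) s _ _ → Outcome (k * (4 + K) + K)
        afterSetup (run {s₁} e₁ b₁ (Q , m , ps , sz≡ , G≡)) = afterSort
          (Sort.run-sortRows F M n 1≤n (fits n ℓ 1≤n) (reals s 0) Q (Setup.Params.n<2^Q ps) s₁
            (trans (cong (λ f → f 0 0) (proj₁ (frame e₁ 0 refl))) size) (proj₂ (frame e₁ 0 refl)))
          where
          afterSort : Run sortRows s₁ _ _ → Outcome (k * (4 + K) + K)
          afterSort (run {s₂} e₂ b₂ order) = finish b₁ b₂ k (total≤ Q G sz 1≤Q (m^n>0 2 m))
            where open AfterSort e₁ e₂ ps sz≡ G≡ order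

    solves : ∀ ω → Isω (fromℕ 2 - t) 1# 1# ω →
      ∃[ P ] SolvesInÕ P (λ n → n ^ᴿ (fromℕ 2 +ᶠ t) +ᶠ n ^ᴿ ω)
    solves ω isω =
      -- κ = 0 suffices: the factors have entries 0 and 1, and n^0 = 1.
      let P , ℓ , K , spec = Isω.attained isω 0 in
      targetProduct t P , 4 + ℓ , 122 * (4 + K) + K , 1 , λ n 1≤n A B T restricted s input →
        Correctness.outcome {P} {ℓ} {K} {ω} n 1≤n (λ p p≤ → spec n 1≤n p n n p≤ (n≤n^1 n) (n≤n^1 n))
          A B T restricted s input
          122 (λ Q G sz 1≤Q 1≤sz → totalCost-bound n Q G sz 1≤n 1≤Q 1≤sz)

theorem1p5 :
  (F : CompleteOrderedField) →
  let open CompleteOrderedField F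
      open RealPower F
      open Machine F
      open MatrixMultiplication F
      open TargetProduct F
  in
  ∀ (t : Carrier) → 0# ≤ t → t ≤ 1# →
  ∀ (ω : Carrier) → Isω (fromℕ 2 - t) 1# 1# ω →
  ∃[ P ] SolvesInÕ P (λ n → n ^ᴿ (fromℕ 2 + t) + n ^ᴿ ω)
theorem1p5 F t 0≤t t≤1 ω isω = Development.Main.solves F t 0≤t t≤1 ω isω
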